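{- Let $J_0\subset\mathbb{R}$ be a finite open interval, let $\varphi:J_0\to\mathbb{R}$ be a continuously differentiable function satisfying $$\sup_{x\in J_0}|\varphi'(x)|<\infty,\qquad \#\{x\in J_0:\varphi(x)=x\}<\infty,$$ and let $J\subset J_0$ be an interval of positive length. Let $n\ge 3$ be an integer and let $0<\gamma<1$. For a constant $c_1>0$ and a real number $Q>1$ put $$\tilde M^n_\varphi(Q,\gamma,J)=\left\{\boldsymbol{\alpha}=(\alpha_1,\alpha_2)\in\tilde{\mathbb{A}}_n^2(Q):\ \alpha_1\in J,\ |\varphi(\alpha_1)-\alpha_2|<c_1Q^{ -\gamma}\right\}.$$ Then, provided the constant $c_1$ (independent of $Q$) is sufficiently large, there exist constants $c_2,c_3>0$ independent of $Q$ and a number $Q_0=Q_0(n,J,\varphi,\gamma)$ such that for all $Q>Q_0$ $$c_2\,Q^{n-\gamma}<\#\tilde M^n_\varphi(Q,\gamma,J)<c_3\,Q^{n-\gamma}.$$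
   Context: The height $H(P)$ of a polynomial $P\in\mathbb{Z}[t]$ is the maximum of the absolute values of its coefficients. An algebraic integer point is a point $\boldsymbol{\alpha}=(\alpha_1,\alpha_2)\in\mathbb{R}^2$ whose coordinates are two distinct (conjugate) roots of the same monic polynomial $P\in\mathbb{Z}[t]$ that is irreducible over $\mathbb{Q}$; $P$ is the minimal polynomial of $\boldsymbol{\alpha}$, and $\deg\boldsymbol{\alpha}:=\deg P$, $H(\boldsymbol{\alpha}):=H(P)$. $\tilde{\mathbb{A}}_n^2(Q)$ denotes the set of algebraic integer points $\boldsymbol{\alpha}$ with $\deg\boldsymbol{\alpha}=n$ and $H(\boldsymbol{\alpha})\le Q$. $\#S$ is the cardinality of a finite set $S$. The constants $c_1,c_2,c_3$ do not depend on $Q$, but may depend on the other data; $c_1$ is regarded as fixed when $c_2,c_3,Q_0$ are chosen. -}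

module Defs where

open import Algebra.Bundles using (CommutativeRing; RawSemiring; Semiring)
import Algebra.Definitions.RawSemiring as RawSemiringDefs
open import Axiom.ExcludedMiddle using (ExcludedMiddle)
open import Data.Fin.Base using (Fin)
open import Data.Integer.Base as ℤ using (ℤ)
open import Data.List.Base using (List; []; _∷_; map; foldr)
open import Data.Nat.Base as ℕ using (ℕ; zero; suc)
open import Data.Product.Base using (Σ; ∃; ∃-syntax; _×_; _,_; proj₁; proj₂)
open import Data.Product.Relation.Binary.Pointwise.NonDependent using (×-setoid)
open import Data.Rational.Base as ℚ using (ℚ)
import Data.Rational.Properties as ℚ
open import Function.Bundles using (Func; Bijection)
open import Level using (0ℓ)
open import Relation.Binary.Bundles using (Setoid)
open import Relation.Binary.Core using (Rel)
open import Relation.Binary.Definitions using (tri<; tri≈; tri>)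
open import Relation.Binary.PropositionalEquality.Core using (_≡_)
open import Relation.Binary.PropositionalEquality.Properties using (setoid)
open import Relation.Binary.Structures using (IsStrictTotalOrder)
import Relation.Binary.Construct.On as On
import Relation.Binary.Construct.StrictToNonStrict as StrictToNonStrict
open import Relation.Nullary.Decidable.Core using (yes; no)
open import Relation.Nullary.Negation.Core using (¬_)
open import Relation.Unary using (Pred; Satisfiable)

subsetoid : (X : Setoid 0ℓ 0ℓ) → Pred (Setoid.Carrier X) 0ℓ → Setoid 0ℓ 0ℓ
subsetoid X S = On.setoid X (proj₁ {B = S})

HasCardinality : (X : Setoid 0ℓ 0ℓ) → Pred (Setoid.Carrier X) 0ℓ → ℕ → Set
HasCardinality X S N = Bijection (setoid (Fin N)) (subsetoid X S)

Finite : (X : Setoid 0ℓ 0ℓ) → Pred (Setoid.Carrier X) 0ℓ → Set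
Finite X S = ∃ (HasCardinality X S)

-- Polynomials are lists of coefficients, constant term first.  Trailing
-- zeros are allowed, so equality of polynomials is _≋_, not _≡_.

coeff : ∀ {a} {A : Set a} → A → List A → ℕ → A
coeff z []      _       = z
coeff z (a ∷ _) zero    = a
coeff z (_ ∷ p) (suc i) = coeff z p i

module Polynomial (R : CommutativeRing 0ℓ 0ℓ) where
  open CommutativeRing R

  infix  4 _≋_
  infixl 6 _⊞_
  infixl 7 _⊠_

  _≋_ : Rel (List Carrier) 0ℓ
  p ≋ q = ∀ i → coeff 0# p i ≈ coeff 0# q i

  _⊞_ : List Carrier → List Carrier → List Carrier
  []      ⊞ q       = q
  (a ∷ p) ⊞ []      = a ∷ p
  (a ∷ p) ⊞ (b ∷ q) = (a + b) ∷ (p ⊞ q)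

  _⊠_ : List Carrier → List Carrier → List Carrier
  []      ⊠ q = []
  (a ∷ p) ⊠ q = map (a *_) q ⊞ (0# ∷ (p ⊠ q))

  rawSemiring : RawSemiring 0ℓ 0ℓ
  rawSemiring = record
    { Carrier = List Carrier
    ; _≈_     = _≋_
    ; _+_     = _⊞_
    ; _*_     = _⊠_
    ; 0#      = []
    ; 1#      = 1# ∷ []
    }

ℤ[t] : Set
ℤ[t] = List ℤ

IrreducibleOverℚ : Pred ℤ[t] 0ℓ
IrreducibleOverℚ P = RawSemiringDefs.Irreducible
  (Polynomial.rawSemiring ℚ.+-*-commutativeRing) (map (λ a → a ℚ./ 1) P)

record MonicOfDegree (n : ℕ) (P : ℤ[t]) : Set where
  field
    leading : coeff ℤ.0ℤ P n ≡ ℤ.1ℤ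
    above   : ∀ {i} → n ℕ.< i → coeff ℤ.0ℤ P i ≡ ℤ.0ℤ

height : ℤ[t] → ℕ
height P = foldr ℕ._⊔_ 0 (map ℤ.∣_∣ P)

record IsSupremum {A : Set} (_≤_ : Rel A 0ℓ) (S : Pred A 0ℓ) (s : A) : Set where
  field
    upperBound : ∀ {x} → S x → x ≤ s
    least      : ∀ b → (∀ {x} → S x → x ≤ b) → s ≤ b

-- The real numbers, given axiomatically as a Dedekind-complete ordered
-- field; together with excluded middle these axioms are categorical.

record RealField : Set₁ where
  field
    commutativeRing : CommutativeRing 0ℓ 0ℓ

  open CommutativeRing commutativeRing public
    renaming (Carrier to ℝ; setoid to ℝ-setoid)

  infix 4 _<_
  infix 8 _⁻¹

  field
    _<_                : Rel ℝ 0ℓ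
    isStrictTotalOrder : IsStrictTotalOrder _≈_ _<_
    0<1                : 0# < 1#
    +-mono-<           : ∀ {x y} z → x < y → x + z < y + z
    *-pos              : ∀ {x y} → 0# < x → 0# < y → 0# < x * y
    -- 0# ⁻¹ is left unspecified.
    _⁻¹                : ℝ → ℝ
    inverseʳ           : ∀ {x} → ¬ (x ≈ 0#) → x * x ⁻¹ ≈ 1#

  open IsStrictTotalOrder isStrictTotalOrder public using (compare)
  open StrictToNonStrict _≈_ _<_ public using (_≤_)

  field
    complete : (S : Pred ℝ 0ℓ) → Satisfiable S →
               (∃[ b ] ∀ {x} → S x → x ≤ b) → ∃ (IsSupremum _≤_ S)

  open RawSemiringDefs (Semiring.rawSemiring semiring) public
    using (_^_) renaming (_×_ to _·_)

  fromℕ : ℕ → ℝ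
  fromℕ n = n · 1#

  fromℤ : ℤ → ℝ
  fromℤ (ℤ.+ n)    = fromℕ n
  fromℤ ℤ.-[1+ n ] = - fromℕ (suc n)

  ∣_∣ : ℝ → ℝ
  ∣ x ∣ with compare x 0#
  ... | tri< _ _ _ = - x
  ... | tri≈ _ _ _ = x
  ... | tri> _ _ _ = x

  eval : ℤ[t] → ℝ → ℝ
  eval P x = foldr (λ a v → fromℤ a + x * v) 0# P

data Endpoint : Set where
  included excluded : Endpoint

module Theory (em : ExcludedMiddle 0ℓ) (R : RealField) where
  open RealField R

  -- The rational powers x ^ r with r = (a - b) / k ≤ y.
  RationalPowersBelow : ℝ → ℝ → Pred ℝ 0ℓ
  RationalPowersBelow x y w =
    ∃[ a ] ∃[ b ] ∃[ k ] (1 ℕ.≤ k) × (fromℕ a ≤ fromℕ k * y + fromℕ b) ×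
                         (0# < w) × (w ^ k * x ^ b ≈ x ^ a)

  -- x ^ y for real y, as the supremum of the x ^ r with r rational, r ≤ y.
  -- This is the right definition for 1 < x, when the supremum exists by
  -- completeness; it is only to be used for such x.
  rpow : ℝ → ℝ → ℝ
  rpow x y with em {∃ (IsSupremum _≤_ (RationalPowersBelow x y))}
  ... | yes (s , _) = s
  ... | no  _       = 0#

  record Interval : Set where
    constructor interval
    field
      left right       : ℝ
      leftEnd rightEnd : Endpoint

  openInterval : ℝ → ℝ → Interval
  openInterval a b = interval a b excluded excluded

  length : Interval → ℝ
  length I = Interval.right I - Interval.left I

  infix 4 ⟨_⟩_≺_ _∈_ _⊆_

  ⟨_⟩_≺_ : Endpoint → ℝ → ℝ → Set
  ⟨ included ⟩ x ≺ y = x ≤ y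
  ⟨ excluded ⟩ x ≺ y = x < y

  record _∈_ (x : ℝ) (I : Interval) : Set where
    constructor between
    open Interval I
    field
      lower : ⟨ leftEnd ⟩ left ≺ x
      upper : ⟨ rightEnd ⟩ x ≺ right

  _⊆_ : Interval → Interval → Set
  I ⊆ I′ = ∀ {x} → x ∈ I → x ∈ I′

  RealFunction : Interval → Set
  RealFunction I = Func (subsetoid ℝ-setoid (_∈ I)) ℝ-setoid

  module _ {I : Interval} where

    infixl 10 _⟨_⟩

    _⟨_⟩ : RealFunction I → Σ ℝ (_∈ I) → ℝ
    f ⟨ x ⟩ = Func.to f x

    IsDerivativeOf : RealFunction I → RealFunction I → Set
    IsDerivativeOf f′ f = ∀ x (x∈ : x ∈ I) ε → 0# < ε →
      ∃[ δ ] 0# < δ × (∀ y (y∈ : y ∈ I) → ¬ (y ≈ x) → ∣ y - x ∣ < δ →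
        ∣ (f ⟨ y , y∈ ⟩ - f ⟨ x , x∈ ⟩) * (y - x) ⁻¹ - f′ ⟨ x , x∈ ⟩ ∣ < ε)

    Continuous : RealFunction I → Set
    Continuous f = ∀ x (x∈ : x ∈ I) ε → 0# < ε →
      ∃[ δ ] 0# < δ × (∀ y (y∈ : y ∈ I) → ∣ y - x ∣ < δ →
        ∣ f ⟨ y , y∈ ⟩ - f ⟨ x , x∈ ⟩ ∣ < ε)

    Bounded : RealFunction I → Set
    Bounded f = ∃[ K ] ∀ x (x∈ : x ∈ I) → ∣ f ⟨ x , x∈ ⟩ ∣ ≤ K

    FixedPoint : RealFunction I → Pred ℝ 0ℓ
    FixedPoint f x = Σ (x ∈ I) λ x∈ → f ⟨ x , x∈ ⟩ ≈ x

  ℝ² : Setoid 0ℓ 0ℓ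
  ℝ² = ×-setoid ℝ-setoid ℝ-setoid

  -- (α₁ , α₂) is an algebraic integer point of degree n with minimal
  -- polynomial P.
  record IsMinimalPolynomial (n : ℕ) (P : ℤ[t]) (α : ℝ × ℝ) : Set where
    α₁ = proj₁ α
    α₂ = proj₂ α
    field
      monic       : MonicOfDegree n P
      irreducible : IrreducibleOverℚ P
      root₁       : eval P α₁ ≈ 0#
      root₂       : eval P α₂ ≈ 0#
      distinct    : ¬ (α₁ ≈ α₂)

  -- The set Ã²ₙ(Q).
  AlgebraicIntegerPoint : ℕ → ℝ → Pred (ℝ × ℝ) 0ℓ
  AlgebraicIntegerPoint n Q α =
    ∃[ P ] IsMinimalPolynomial n P α × fromℕ (height P) ≤ Q

  -- The set M̃ⁿ_φ(Q, γ, J), for a given constant c₁.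
  M̃ : {J₀ : Interval} (φ : RealFunction J₀) (n : ℕ) (Q γ : ℝ)
      (J : Interval) → J ⊆ J₀ → (c₁ : ℝ) → Pred (ℝ × ℝ) 0ℓ
  M̃ φ n Q γ J J⊆J₀ c₁ (α₁ , α₂) =
    AlgebraicIntegerPoint n Q (α₁ , α₂) ×
    Σ (α₁ ∈ J) λ α₁∈J →
      ∣ φ ⟨ α₁ , J⊆J₀ α₁∈J ⟩ - α₂ ∣ < c₁ * rpow Q (- γ)

{-# OPTIONS --safe #-}

-- Put q = Q^(-γ).
--
-- Upper bound.  Fix the coefficients a₂, …, aₙ₋₁ and let α₁ range over an interval of length q;
-- then α₂ ranges over an interval of length O(q), because φ is Lipschitz.  Since α₁ ≠ α₂ are roots,
-- a₁ is minus the divided difference of tⁿ + aₙ₋₁ tⁿ⁻¹ + … + a₂ t² at (α₁ , α₂), which is a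
-- Lipschitz function of the point with constant O(Q); hence a₁, and then likewise a₀, takes O(Q q)
-- values.  The total is O(q⁻¹ · Qⁿ⁻² · (Q q)²) = O(Qⁿ q), and no special care is needed near the
-- diagonal.
--
-- Lower bound.  On an interval where |φ(x) - x| ≥ ε take points x on a grid of mesh 3 q and
-- y = φ(x).  Choose a₃, …, aₙ₋₁ freely up to a small multiple of Q and a₂ of order Q dominating
-- them; let a₁, a₀ be within δ Q q of the real values for which the polynomial vanishes at x and y.
-- The polynomial is then (t - x)(t - y) S(t) plus a linear error of size O(δ Q q), with S(t) ≫ Q,
-- so it changes sign within q of x and within q of y.  Taking the lower coefficients even and
-- a₀ ≡ 2 mod 4 makes it an Eisenstein polynomial at 2, hence irreducible and determined by any one
-- of its roots, so that different choices give different points.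
module Submission where

open import Defs
open import Algebra.Bundles using (CommutativeRing)
import Algebra.Definitions.RawSemiring as RawSemiringDefs
import Algebra.Properties.AbelianGroup as AbelianGroupProperties
import Algebra.Properties.CommutativeSemiring.Exp as CommutativeSemiringExp
import Algebra.Properties.CommutativeSemigroup as CommutativeSemigroupProperties
import Algebra.Properties.Monoid.Mult.TCOptimised as MonoidMult
import Algebra.Properties.Ring as RingProperties
import Algebra.Properties.Semiring.Exp as SemiringExp
import Algebra.Properties.Semiring.Mult as SemiringMult
import Algebra.Solver.Ring as RingSolver
open import Algebra.Solver.Ring.AlmostCommutativeRing using
  (_-Raw-AlmostCommutative⟶_; fromCommutativeRing)
open import Axiom.ExcludedMiddle using (ExcludedMiddle)
open import Data.Empty using (⊥; ⊥-elim)
open import Data.Fin.Base as Fin using (Fin; zero; suc; toℕ)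
import Data.Fin.Properties as Fin
open import Data.Integer.Base as ℤ using (ℤ; +_; -[1+_]; 0ℤ; 1ℤ)
open import Data.Integer.Divisibility.Signed using
  (_∣_; divides; _∣?_; ∣ᵤ⇒∣; ∣⇒∣ᵤ; 0∣⇒≡0; ∣m∣n⇒∣m+n; ∣m∣n⇒∣m-n; ∣n⇒∣m*n; ∣m⇒∣m*n)
import Data.Integer.Properties as ℤ
open import Data.Integer.Tactic.RingSolver using (solve-∀)
open import Data.List.Base as List using (List; []; _∷_)
open import Data.List.Relation.Unary.All as All using (All; []; _∷_)
open import Data.Maybe.Base using (Maybe; just; nothing)
open import Data.Nat.Base as ℕ using (ℕ; zero; suc; s≤s; z≤n) renaming (_≤_ to _≤ℕ_)
import Data.Nat.Divisibility as ℕ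
open import Data.Nat.Induction using (<-rec)
open import Data.Nat.Primality using (prime[2]; euclidsLemma)
import Data.Nat.Properties as ℕ
open import Data.Product.Base using (Σ; ∃; ∃-syntax; _×_; _,_; proj₁; proj₂)
open import Data.Rational.Base as ℚ using (ℚ)
import Data.Rational.Properties as ℚ
import Data.Rational.Unnormalised.Base as ℚᵘ
import Data.Rational.Unnormalised.Properties as ℚᵘ
open import Data.Sum.Base using (_⊎_; inj₁; inj₂; [_,_]′)
open import Data.Vec.Base as Vec using (Vec; []; _∷_)
open import Data.Vec.Relation.Unary.All as VecAll using ([]; _∷_)
open import Function.Base using (_∘_)
open import Function.Bundles using (Bijection; Func)
open import Level using (0ℓ)
open import Relation.Binary.Bundles using (Setoid)
import Relation.Binary.Construct.StrictToNonStrict as StrictToNonStrict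
open import Relation.Binary.Definitions using (tri<; tri≈; tri>)
open import Relation.Binary.PropositionalEquality as ≡ using (_≡_; _≢_; cong; cong₂; subst)
import Relation.Binary.Reasoning.Setoid as SetoidReasoning
open import Relation.Binary.Structures using (IsStrictTotalOrder; IsTotalOrder)
open import Relation.Nullary.Decidable using (yes; no)
open import Relation.Nullary.Negation.Core using (¬_; contradiction)
open import Relation.Unary using (Pred)

-- Real powers enter only through q: besides Q^(n-γ) = Qⁿ q, the count needs that q tends to 0,
-- which comes from 0 < γ, and that Q q tends to infinity, which comes from γ < 1. The latter makes
-- the windows for a₁ and a₀, of length proportional to Q q, contain a proportional number of
-- integers instead of perhaps none. Degree at least 3 makes a₂ a free coefficient: it keeps S away
-- from 0 near x and y, where a small S would let the linear error destroy the sign change. The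
-- diagonal has to be avoided in the lower bound, since for y close to x the factor t - y no longer
-- keeps the product large; as φ has finitely many fixed points, J contains a point off the
-- diagonal, and a Lipschitz bound spreads the gap to a whole window. If L is a Lipschitz constant
-- of φ, a root within q of x and another within q of y = φ(x) form a point within (L + 1) q of the
-- curve, so every c₁ ≥ L + 2 will do. The parity conditions select a fixed proportion of the
-- coefficients and cost only a constant factor.

module IntegerPolynomials where

  -- Coefficients of products as convolutions

  module Convolution (K : CommutativeRing 0ℓ 0ℓ) where
    open CommutativeRing K hiding (zero)
    open Polynomial K
    open CommutativeSemigroupProperties *-commutativeSemigroup using (x∙yz≈y∙xz)

    -- Coefficient functions replace lists, so trailing zeros are invisible. The sum of `f a * g b`
    -- over a + b = k is peeled from the side of `f`, so that inductions on k only shift `f`.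
    conv : (ℕ → Carrier) → (ℕ → Carrier) → ℕ → Carrier
    conv f g zero    = f 0 * g 0
    conv f g (suc k) = f 0 * g (suc k) + conv (f ∘ suc) g k

    conv-cong : ∀ {f f′ g g′} → (∀ i → f i ≈ f′ i) → (∀ i → g i ≈ g′ i) → ∀ k →
      conv f g k ≈ conv f′ g′ k
    conv-cong f≈ g≈ zero    = *-cong (f≈ 0) (g≈ 0)
    conv-cong f≈ g≈ (suc k) = +-cong (*-cong (f≈ 0) (g≈ (suc k))) (conv-cong (f≈ ∘ suc) g≈ k)

    conv-scaleˡ : ∀ c f g k → conv (λ i → c * f i) g k ≈ c * conv f g k
    conv-scaleˡ c f g zero    = *-assoc c _ _
    conv-scaleˡ c f g (suc k) = trans (+-cong (*-assoc c _ _) (conv-scaleˡ c (f ∘ suc) g k))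
      (sym (distribˡ c _ _))

    conv-scaleʳ : ∀ c f g k → conv f (λ i → c * g i) k ≈ c * conv f g k
    conv-scaleʳ c f g zero    = x∙yz≈y∙xz (f 0) c (g 0)
    conv-scaleʳ c f g (suc k) = trans
      (+-cong (x∙yz≈y∙xz (f 0) c (g (suc k))) (conv-scaleʳ c (f ∘ suc) g k)) (sym (distribˡ c _ _))

    conv-0ˡ : ∀ g k → conv (λ _ → 0#) g k ≈ 0#
    conv-0ˡ g zero    = zeroˡ _
    conv-0ˡ g (suc k) = trans (+-cong (zeroˡ _) (conv-0ˡ g k)) (+-identityˡ 0#)

    coeff-⊞ : ∀ p q i → coeff 0# (p ⊞ q) i ≈ coeff 0# p i + coeff 0# q i
    coeff-⊞ []      q       i       = sym (+-identityˡ _)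
    coeff-⊞ (a ∷ p) []      i       = sym (+-identityʳ _)
    coeff-⊞ (a ∷ p) (b ∷ q) zero    = refl
    coeff-⊞ (a ∷ p) (b ∷ q) (suc i) = coeff-⊞ p q i

    coeff-scale : ∀ c p i → coeff 0# (List.map (c *_) p) i ≈ c * coeff 0# p i
    coeff-scale c []      i       = sym (zeroʳ c)
    coeff-scale c (a ∷ p) zero    = refl
    coeff-scale c (a ∷ p) (suc i) = coeff-scale c p i

    coeff-⊠ : ∀ p q k → coeff 0# (p ⊠ q) k ≈ conv (coeff 0# p) (coeff 0# q) k
    coeff-⊠ []      q k       = sym (conv-0ˡ _ k)
    coeff-⊠ (a ∷ p) q zero    = trans (coeff-⊞ (List.map (a *_) q) _ 0)
      (trans (+-identityʳ _) (coeff-scale a q 0))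
    coeff-⊠ (a ∷ p) q (suc k) = trans (coeff-⊞ (List.map (a *_) q) _ (suc k))
      (+-cong (coeff-scale a q (suc k)) (coeff-⊠ p q k))

  open Convolution ℤ.+-*-commutativeRing using () renaming
    (conv to convℤ; conv-cong to convℤ-cong; conv-scaleˡ to convℤ-scaleˡ; conv-scaleʳ to
    convℤ-scaleʳ; conv-0ˡ to convℤ-0ˡ; coeff-⊞ to coeffℤ-⊞; coeff-scale to coeffℤ-scale) public
  open Convolution ℚ.+-*-commutativeRing using () renaming
    (conv to convℚ; conv-cong to convℚ-cong; conv-scaleˡ to convℚ-scaleˡ; conv-scaleʳ to
    convℚ-scaleʳ; coeff-⊠ to coeffℚ-⊠; coeff-⊞ to coeffℚ-⊞; coeff-scale to coeffℚ-scale)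
  open Polynomial ℤ.+-*-commutativeRing using () renaming (_⊞_ to _⊞ℤ_) public

  open ≡ using (refl; sym; trans)
  open import Data.Integer.Base using (_+_; _*_; _-_; -_)

  -- Dominant terms of a convolution

  conv-∣ : ∀ {m} F G k → (∀ a b → a ℕ.+ b ≡ k → m ∣ F a * G b) → m ∣ convℤ F G k
  conv-∣ F G zero    all = all 0 0 refl
  conv-∣ F G (suc k) all = ∣m∣n⇒∣m+n (all 0 (suc k) refl)
    (conv-∣ (F ∘ suc) G k λ a b a+b≡k → all (suc a) b (cong suc a+b≡k))

  -- One statement for two uses: with m = 2 it isolates the first odd term of a product, and with m
  -- = 0, where divisibility means being zero, its top term.
  conv-dominant : ∀ {m} F G i j → (∀ a b → a ℕ.+ b ≡ i ℕ.+ j → a ≢ i → m ∣ F a * G b) →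
    m ∣ convℤ F G (i ℕ.+ j) - F i * G j
  conv-dominant F G zero zero    others = divides 0ℤ (ℤ.+-inverseʳ (F 0 * G 0))
  conv-dominant {m} F G zero (suc j) others = subst (m ∣_) (sym (cancel (F 0 * G (suc j)) _))
    (conv-∣ (F ∘ suc) G j λ a b a+b≡j → others (suc a) b (cong suc a+b≡j) λ ())
    where
    cancel : ∀ x y → x + y - x ≡ y
    cancel = solve-∀
  conv-dominant {m} F G (suc i) j others =
    subst (m ∣_) (sym (ℤ.+-assoc (F 0 * G (suc (i ℕ.+ j))) _ _))
    (∣m∣n⇒∣m+n (others 0 _ refl λ ())
      (conv-dominant (F ∘ suc) G i j λ a b a+b≡ a≢i →
        others (suc a) b (cong suc a+b≡) (a≢i ∘ ℕ.suc-injective)))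

  FiniteSupport : Pred (ℕ → ℤ) 0ℓ
  FiniteSupport F = ∃[ s ] (∀ i → s ℕ.≤ i → F i ≡ 0ℤ)

  coeff-finite : ∀ p → FiniteSupport (coeff 0ℤ p)
  coeff-finite p = List.length p , beyond p
    where
    beyond : ∀ p i → List.length p ℕ.≤ i → coeff 0ℤ p i ≡ 0ℤ
    beyond []      i       _         = refl
    beyond (a ∷ p) (suc i) (s≤s l) = beyond p i l

  lastNonzero : ∀ F → FiniteSupport F → ∀ i → F i ≢ 0ℤ → ∃[ l ] i ℕ.≤ l × F l ≢ 0ℤ ×
    (∀ j → l ℕ.< j → F j ≡ 0ℤ)
  lastNonzero F (s , vanish) i Fi≢0 = search s vanish
    where
    search : ∀ s → (∀ j → s ℕ.≤ j → F j ≡ 0ℤ) → ∃[ l ] i ℕ.≤ l × F l ≢ 0ℤ ×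
      (∀ j → l ℕ.< j → F j ≡ 0ℤ)
    search zero    vanish = contradiction (vanish i z≤n) Fi≢0
    search (suc s) vanish with F s ℤ.≟ 0ℤ
    ... | no  Fs≢0 = s , ℕ.≮⇒≥ (λ s<i → Fi≢0 (vanish i s<i)) , Fs≢0 , vanish
    ... | yes Fs≡0 = search s λ j s≤j → [ vanish j , (λ { refl → Fs≡0 }) ]′ (ℕ.m≤n⇒m<n∨m≡n s≤j)

  -- If s and t are the last nonzero positions, the coefficient of the product at s + t is
  -- `F s * G t`, which is not zero. Speaking of arbitrary nonzero coefficients avoids a degree
  -- function.
  degree-bound : ∀ {F G n} → FiniteSupport F → FiniteSupport G →
    (∀ k → n ℕ.< k → convℤ F G k ≡ 0ℤ) →
    ∀ {i j} → F i ≢ 0ℤ → G j ≢ 0ℤ → i ℕ.+ j ℕ.≤ n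
  degree-bound {F} {G} {n} finF finG vanish {i} {j} Fi≢0 Gj≢0
    with lastNonzero F finF i Fi≢0 | lastNonzero G finG j Gj≢0
  ... | s , i≤s , Fs≢0 , F>s | t , j≤t , Gt≢0 , G>t =
    ℕ.≤-trans (ℕ.+-mono-≤ i≤s j≤t) (ℕ.≮⇒≥ λ n<s+t →
    [ Fs≢0 , Gt≢0 ]′ (ℤ.i*j≡0⇒i≡0∨j≡0 (F s)
      (trans (sym (ℤ.i-j≡0⇒i≡j _ _ (0∣⇒≡0 top))) (vanish _ n<s+t))))
    where
    other : ∀ a b → a ℕ.+ b ≡ s ℕ.+ t → a ≢ s → 0ℤ ∣ F a * G b
    other a b a+b≡s+t a≢s with ℕ.<-cmp a s
    ... | tri≈ _ a≡s _ = contradiction a≡s a≢s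
    ... | tri> _ _ s<a = subst (λ z → 0ℤ ∣ z * G b) (sym (F>s a s<a)) (divides 0ℤ refl)
    ... | tri< a<s _ _ = subst (λ z → 0ℤ ∣ F a * z) (sym (G>t b t<b)) (divides 0ℤ (ℤ.*-zeroʳ (F a)))
      where
      t<b : t ℕ.< b
      t<b = ℕ.≰⇒> λ b≤t → ℕ.<-irrefl a+b≡s+t (ℕ.+-mono-<-≤ a<s b≤t)
    top : 0ℤ ∣ convℤ F G (s ℕ.+ t) - F s * G t
    top = conv-dominant F G s t other

  -- Eisenstein's criterion at 2

  Even : Pred ℤ 0ℓ
  Even x = + 2 ∣ x

  even-* : ∀ {x y} → Even (x * y) → Even x ⊎ Even y
  even-* {x} {y} 2∣xy with euclidsLemma ℤ.∣ x ∣ ℤ.∣ y ∣ prime[2]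
    (subst (2 ℕ.∣_) (ℤ.abs-* x y) (∣⇒∣ᵤ 2∣xy))
  ... | inj₁ 2∣x = inj₁ (∣ᵤ⇒∣ 2∣x)
  ... | inj₂ 2∣y = inj₂ (∣ᵤ⇒∣ 2∣y)

  firstOdd : ∀ F → FiniteSupport F → (∀ i → Even (F i)) ⊎
    (∃[ i ] ¬ Even (F i) × (∀ j → j ℕ.< i → Even (F j)))
  firstOdd F (s , vanish) = search s F vanish
    where
    search : ∀ s (F : ℕ → ℤ) → (∀ i → s ℕ.≤ i → F i ≡ 0ℤ) → (∀ i → Even (F i)) ⊎
      (∃[ i ] ¬ Even (F i) × (∀ j → j ℕ.< i → Even (F j)))
    search zero    F vanish = inj₁ λ i → subst Even (sym (vanish i z≤n)) (divides 0ℤ refl)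
    search (suc s) F vanish with + 2 ∣? F 0
    ... | no  odd  = inj₂ (0 , odd , λ _ ())
    ... | yes even with search s (F ∘ suc) (λ i s≤i → vanish (suc i) (s≤s s≤i))
    ...   | inj₁ evens = inj₁ λ { zero → even ; (suc i) → evens i }
    ...   | inj₂ (i , odd , evens) =
      inj₂ (suc i , odd , λ { zero _ → even ; (suc j) (s≤s j<i) → evens j j<i })

  -- Any pair of indices with sum i + j other than (i , j) has one index below its first odd
  -- position, so modulo 2 only `F i * G j` remains.
  odd-conv : ∀ {F G i j} → ¬ Even (F i) → (∀ k → k ℕ.< i → Even (F k)) → ¬ Even (G j) →
    (∀ k → k ℕ.< j → Even (G k)) →
    ¬ Even (convℤ F G (i ℕ.+ j))
  odd-conv {F} {G} {i} {j} Fi G<i Gj G<j even = [ Fi ,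
    Gj ]′ (even-* (subst Even (cancel (convℤ F G (i ℕ.+ j)) (F i * G j))
    (∣m∣n⇒∣m-n even (conv-dominant F G i j others))))
    where
    cancel : ∀ x y → x - (x - y) ≡ y
    cancel = solve-∀
    others : ∀ a b → a ℕ.+ b ≡ i ℕ.+ j → a ≢ i → Even (F a * G b)
    others a b a+b≡i+j a≢i with ℕ.<-cmp a i
    ... | tri≈ _ a≡i _ = contradiction a≡i a≢i
    ... | tri< a<i _ _ = ∣m⇒∣m*n (G b) (G<i a a<i)
    ... | tri> _ _ i<a = ∣n⇒∣m*n (F a)
      (G<j b (ℕ.≰⇒> λ j≤b → ℕ.<-irrefl (sym a+b≡i+j) (ℕ.+-mono-<-≤ i<a j≤b)))

  -- `constant` and `half-odd` together say that 2 divides the constant term exactly once.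
  record Eisenstein (n : ℕ) (P : ℕ → ℤ) : Set where
    field
      leading     : ¬ Even (P n)
      lower       : ∀ i → i ℕ.< n → Even (P i)
      above       : ∀ i → n ℕ.< i → P i ≡ 0ℤ
      half        : ℤ
      constant    : P 0 ≡ half * + 2
      half-odd    : ¬ Even half

  Constant : Pred (ℕ → ℤ) 0ℓ
  Constant F = ∀ i → F (suc i) ≡ 0ℤ

  module _ {n : ℕ} {P : ℕ → ℤ} (eis : Eisenstein n P) where
    open Eisenstein eis

    private
      -- A factorisation of `P` over ℚ after clearing denominators; `D` is the product of the two
      -- multipliers.
      Factors : ℤ → (ℕ → ℤ) → (ℕ → ℤ) → Set
      Factors D F G = ∀ k → convℤ F G k ≡ D * P k

      vanish : ∀ {D F G} → Factors D F G → ∀ k → n ℕ.< k → convℤ F G k ≡ 0ℤ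
      vanish {D} fac k n<k = trans (fac k) (trans (cong (D *_) (above k n<k)) (ℤ.*-zeroʳ D))

      odd≢0 : ∀ {x} → ¬ Even x → x ≢ 0ℤ
      odd≢0 odd refl = odd (divides 0ℤ refl)

      all-even : ∀ (F : ℕ → ℤ) → (∀ i → Even (F i)) → Σ (ℕ → ℤ) λ F′ → ∀ i → F i ≡ + 2 * F′ i
      all-even F evens = (λ i → _∣_.quotient (evens i)) , λ i →
        trans (_∣_.equality (evens i)) (ℤ.*-comm (_∣_.quotient (evens i)) (+ 2))

      -- For odd `D` both factors have a first odd coefficient, at i and j say, and `D * P` is odd
      -- at i + j; since n is the only odd position of `P`, i + j = n. If i = 0 then `G` already
      -- uses up the degree n and `F` is constant, and symmetrically for j = 0. If both are
      -- positive, the constant terms of `F` and `G` are even, so 4 divides `D * P 0`, contrary to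
      -- `half-odd`.
      odd-case : ∀ {D F G} → ¬ Even D → FiniteSupport F → FiniteSupport G → Factors D F G →
        Constant F ⊎ Constant G
      odd-case {D} {F} {G} oddD finF finG fac with firstOdd F finF | firstOdd G finG
      ... | inj₁ evens | _ = contradiction
        (subst Even (fac n) (conv-∣ F G n λ a b _ → ∣m⇒∣m*n (G b) (evens a)))
        ([ oddD , leading ]′ ∘ even-*)
      ... | inj₂ _ | inj₁ evens = contradiction
        (subst Even (fac n) (conv-∣ F G n λ a b _ → ∣n⇒∣m*n (F a) (evens b)))
        ([ oddD , leading ]′ ∘ even-*)
      ... | inj₂ (i , Fi , F<i) | inj₂ (j , Gj , G<j) = conclude i j Fi F<i Gj G<j i+j≡n
        where
        odd : ¬ Even (P (i ℕ.+ j))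
        odd even = odd-conv {F} {G} Fi F<i Gj G<j
          (subst Even (sym (fac (i ℕ.+ j))) (∣n⇒∣m*n D even))
        i+j≡n : i ℕ.+ j ≡ n
        i+j≡n with ℕ.<-cmp (i ℕ.+ j) n
        ... | tri< lt _ _ = contradiction (lower _ lt) odd
        ... | tri≈ _ eq _ = eq
        ... | tri> _ _ gt = contradiction (subst Even (sym (above _ gt)) (divides 0ℤ refl)) odd
        ≡0 : ∀ x → ¬ (x ≢ 0ℤ) → x ≡ 0ℤ
        ≡0 x ¬¬ with x ℤ.≟ 0ℤ
        ... | yes eq = eq
        ... | no neq = contradiction neq ¬¬
        conclude : ∀ i j → ¬ Even (F i) → (∀ k → k ℕ.< i → Even (F k)) → ¬ Even (G j) →
          (∀ k → k ℕ.< j → Even (G k)) → i ℕ.+ j ≡ n → Constant F ⊎ Constant G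
        conclude zero j _ _ Gj _ refl = inj₁ λ l → ≡0 _ λ Fl≢0 →
          ℕ.1+n≰n (ℕ.≤-trans (s≤s (ℕ.m≤n+m j l))
            (degree-bound {F} {G} finF finG (vanish {D} {F} {G} fac) {suc l} {j} Fl≢0 (odd≢0 Gj)))
        conclude (suc i) zero Fi _ _ _ i≡n = inj₂ λ l → ≡0 _ λ Gl≢0 →
          ℕ.1+n≰n (ℕ.≤-trans (ℕ.+-monoʳ-≤ 1
            (ℕ.≤-trans (ℕ.≤-reflexive (trans (sym i≡n) (ℕ.+-identityʳ (suc i))))
            (ℕ.m≤m+n (suc i) l)))
            (subst (ℕ._≤ n) (ℕ.+-suc (suc i) l)
              (degree-bound {F} {G} finF finG (vanish {D} {F} {G} fac) {suc i} {suc l}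
              (odd≢0 Fi) Gl≢0)))
        conclude (suc i) (suc j) _ F<i _ G<j _ with F<i 0 (s≤s z≤n) | G<j 0 (s≤s z≤n)
        ... | divides f F0≡ | divides g G0≡ =
          contradiction (divides (f * g) (ℤ.*-cancelʳ-≡ _ _ (+ 2) eq))
          ([ oddD , half-odd ]′ ∘ even-*)
          where
          regroup : ∀ f g → (f * + 2) * (g * + 2) ≡ (f * g * + 2) * + 2
          regroup = solve-∀
          eq : (D * half) * + 2 ≡ (f * g * + 2) * + 2
          eq = trans (ℤ.*-assoc D half (+ 2))
            (trans (cong (D *_) (sym constant))
            (trans (sym (fac 0)) (trans (cong₂ ℤ._*_ F0≡ G0≡) (regroup f g))))

    -- Dividing F or G by 2 whenever D is even reduces to odd D (Gauss's lemma at the prime 2).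
    eisenstein : ∀ {D F G} → D ≢ 0ℤ → FiniteSupport F → FiniteSupport G → Factors D F G →
      Constant F ⊎ Constant G
    eisenstein {D} {F} {G} = descend (suc ℤ.∣ D ∣) {D} {F} {G} ℕ.≤-refl
      where
      descend : ∀ fuel {D F G} → ℤ.∣ D ∣ ℕ.< fuel → D ≢ 0ℤ → FiniteSupport F → FiniteSupport G →
        Factors D F G → Constant F ⊎ Constant G
      descend (suc fuel) {D} {F} {G} (s≤s D≤fuel) D≢0 finF finG fac with + 2 ∣? D
      ... | no  odd = odd-case {D} {F} {G} odd finF finG fac
      ... | yes (divides D′ D≡D′*2) = halve (firstOdd F finF) (firstOdd G finG)
        where
        D′≢0 : D′ ≢ 0ℤ
        D′≢0 refl = D≢0 D≡D′*2
        shrink : ∀ z → z ≢ 0ℤ → ℤ.∣ z ∣ ℕ.< ℤ.∣ z * + 2 ∣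
        shrink z z≢0 = subst (ℤ.∣ z ∣ ℕ.<_) (sym (ℤ.abs-* z (+ 2)))
          (ℕ.m<m*n ℤ.∣ z ∣ 2 ⦃ ℕ.≢-nonZero (z≢0 ∘ ℤ.∣i∣≡0⇒i≡0) ⦄ (s≤s (s≤s z≤n)))
        D′<fuel : ℤ.∣ D′ ∣ ℕ.< fuel
        D′<fuel = ℕ.<-≤-trans (shrink D′ D′≢0) (subst (λ z → ℤ.∣ z ∣ ℕ.≤ fuel) D≡D′*2 D≤fuel)
        halved : ∀ {x} k → + 2 * x ≡ D * P k → x ≡ D′ * P k
        halved {x} k eq = ℤ.*-cancelˡ-≡ (+ 2) _ _
          (trans eq (trans (cong (ℤ._* P k) D≡D′*2) (regroup D′ (P k))))
          where
          regroup : ∀ d p → (d * + 2) * p ≡ + 2 * (d * p)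
          regroup = solve-∀
        zero-half : ∀ {x y} → x ≡ + 2 * y → x ≡ 0ℤ → y ≡ 0ℤ
        zero-half {x} {y} x≡2y x≡0 = ℤ.*-cancelˡ-≡ (+ 2) y 0ℤ (trans (sym x≡2y) x≡0)
        zero-double : ∀ {x y} → x ≡ + 2 * y → y ≡ 0ℤ → x ≡ 0ℤ
        zero-double x≡2y refl = x≡2y
        halve : (∀ i → Even (F i)) ⊎ (∃[ i ] ¬ Even (F i) × (∀ j → j ℕ.< i → Even (F j))) →
          (∀ i → Even (G i)) ⊎ (∃[ i ] ¬ Even (G i) × (∀ j → j ℕ.< i → Even (G j))) → Constant F ⊎
            Constant G
        halve (inj₁ evens) _ with all-even F evens
        ... | F′ , F≡2F′ = [ (λ c → inj₁ λ i → zero-double (F≡2F′ (suc i)) (c i)) , inj₂ ]′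
          (descend fuel {D′} {F′} {G} D′<fuel D′≢0
            (proj₁ finF , λ i s≤i → zero-half (F≡2F′ i) (proj₂ finF i s≤i)) finG
            λ k → halved k (trans (sym (convℤ-scaleˡ (+ 2) F′ G k))
              (trans (sym (convℤ-cong F≡2F′ (λ _ → refl) k)) (fac k))))
        halve (inj₂ _) (inj₁ evens) with all-even G evens
        ... | G′ , G≡2G′ = [ inj₁ , (λ c → inj₂ λ i → zero-double (G≡2G′ (suc i)) (c i)) ]′
          (descend fuel {D′} {F} {G′} D′<fuel D′≢0 finF
            (proj₁ finG , λ i s≤i → zero-half (G≡2G′ i) (proj₂ finG i s≤i))
            λ k → halved k (trans (sym (convℤ-scaleʳ (+ 2) F G′ k))
              (trans (sym (convℤ-cong (λ _ → refl) G≡2G′ k)) (fac k))))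
        -- Two factors with odd coefficients have a product with an odd coefficient, which is
        -- impossible while `D` is even.
        halve (inj₂ (i , Fi , F<i)) (inj₂ (j , Gj , G<j)) = contradiction
          (subst Even (sym (fac (i ℕ.+ j))) (∣m⇒∣m*n (P (i ℕ.+ j)) (divides D′ D≡D′*2)))
            (odd-conv {F} {G} Fi F<i Gj G<j)

  -- Rational factorisations

  ι : ℤ → ℚ
  ι a = a ℚ./ 1

  -- Arithmetic of `ι` is checked on unnormalised fractions, where no common divisor is ever
  -- cancelled.
  ι-toℚᵘ : ∀ a → ℚ.toℚᵘ (ι a) ℚᵘ.≃ ℚᵘ.mkℚᵘ a 0
  ι-toℚᵘ a = ℚ.toℚᵘ-fromℚᵘ (ℚᵘ.mkℚᵘ a 0)

  ι-injective : ∀ {a b} → ι a ≡ ι b → a ≡ b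
  ι-injective {a} {b} eq with ℚ.fromℚᵘ-injective {ℚᵘ.mkℚᵘ a 0} {ℚᵘ.mkℚᵘ b 0} eq
  ... | ℚᵘ.*≡* a*1≡b*1 = trans (sym (ℤ.*-identityʳ a)) (trans a*1≡b*1 (ℤ.*-identityʳ b))

  ι-+ : ∀ a b → ι (a + b) ≡ ι a ℚ.+ ι b
  ι-+ a b = ℚ.toℚᵘ-injective (ℚᵘ.≃-trans (ι-toℚᵘ (a + b)) (ℚᵘ.≃-trans (ℚᵘ.*≡* (arith a b))
    (ℚᵘ.≃-sym (ℚᵘ.≃-trans (ℚ.toℚᵘ-homo-+ (ι a) (ι b)) (ℚᵘ.+-cong (ι-toℚᵘ a) (ι-toℚᵘ b))))))
    where
    arith : ∀ a b → (a + b) * + 1 ≡ (a * + 1 + b * + 1) * + 1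
    arith = solve-∀

  ι-* : ∀ a b → ι (a * b) ≡ ι a ℚ.* ι b
  ι-* a b = ℚ.toℚᵘ-injective (ℚᵘ.≃-trans (ι-toℚᵘ (a * b))
    (ℚᵘ.≃-sym (ℚᵘ.≃-trans (ℚ.toℚᵘ-homo-* (ι a) (ι b)) (ℚᵘ.*-cong (ι-toℚᵘ a) (ι-toℚᵘ b)))))

  ι-denominator : ∀ p → ι (ℚ.↧ p) ℚ.* p ≡ ι (ℚ.↥ p)
  ι-denominator p@record{} = ℚ.toℚᵘ-injective (ℚᵘ.≃-trans (ℚ.toℚᵘ-homo-* (ι (ℚ.↧ p)) p)
    (ℚᵘ.≃-trans (ℚᵘ.*-congʳ (ι-toℚᵘ (ℚ.↧ p)))
      (ℚᵘ.≃-trans (ℚᵘ.*≡* (arith (ℚ.↧ p) (ℚ.↥ p))) (ℚᵘ.≃-sym (ι-toℚᵘ (ℚ.↥ p))))))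
    where
    arith : ∀ d m → (d * m) * + 1 ≡ m * (+ 1 * d)
    arith = solve-∀

  coeff-map-ι : ∀ P i → coeff ℚ.0ℚ (List.map ι P) i ≡ ι (coeff 0ℤ P i)
  coeff-map-ι []      i       = refl
  coeff-map-ι (a ∷ P) zero    = refl
  coeff-map-ι (a ∷ P) (suc i) = coeff-map-ι P i

  convℚ-ι : ∀ F G k → convℚ (ι ∘ F) (ι ∘ G) k ≡ ι (convℤ F G k)
  convℚ-ι F G zero    = sym (ι-* (F 0) (G 0))
  convℚ-ι F G (suc k) = trans (cong₂ ℚ._+_ (sym (ι-* (F 0) (G (suc k)))) (convℚ-ι (F ∘ suc) G k))
    (sym (ι-+ (F 0 * G (suc k)) _))

  -- The multiplier is the plain product of the denominators; minimality is irrelevant because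
  -- `eisenstein` accepts every nonzero `D`.
  clearDenominators : ∀ p → ∃[ A ] ∃[ F ] A ≢ 0ℤ × FiniteSupport F ×
    (∀ i → ι (F i) ≡ ι A ℚ.* coeff ℚ.0ℚ p i)
  clearDenominators [] = 1ℤ , (λ _ → 0ℤ) , (λ ()) , (0 , λ _ _ → refl) , λ i → refl
  clearDenominators (c ∷ p) with clearDenominators p
  ... | A , F , A≢0 , (s , vanish) , spec = ℚ.↧ c * A , F′ ,
    ([ (λ ()) , A≢0 ]′ ∘ ℤ.i*j≡0⇒i≡0∨j≡0 (ℚ.↧ c)) , (suc s , vanish′) , spec′
    where
    F′ : ℕ → ℤ
    F′ zero    = ℚ.↥ c * A
    F′ (suc i) = ℚ.↧ c * F i
    vanish′ : ∀ i → suc s ℕ.≤ i → F′ i ≡ 0ℤ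
    vanish′ (suc i) (s≤s s≤i) = trans (cong (ℚ.↧ c *_) (vanish i s≤i)) (ℤ.*-zeroʳ (ℚ.↧ c))
    open ≡.≡-Reasoning
    spec′ : ∀ i → ι (F′ i) ≡ ι (ℚ.↧ c * A) ℚ.* coeff ℚ.0ℚ (c ∷ p) i
    spec′ zero = begin
      ι (ℚ.↥ c * A)                    ≡⟨ ι-* (ℚ.↥ c) A ⟩
      ι (ℚ.↥ c) ℚ.* ι A                  ≡⟨ cong (ℚ._* ι A) (ι-denominator c) ⟨
      ι (ℚ.↧ c) ℚ.* c ℚ.* ι A            ≡⟨ ℚ.*-assoc (ι (ℚ.↧ c)) c (ι A) ⟩
      ι (ℚ.↧ c) ℚ.* (c ℚ.* ι A)          ≡⟨ cong (ι (ℚ.↧ c) ℚ.*_) (ℚ.*-comm c (ι A)) ⟩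
      ι (ℚ.↧ c) ℚ.* (ι A ℚ.* c)          ≡⟨ ℚ.*-assoc (ι (ℚ.↧ c)) (ι A) c ⟨
      ι (ℚ.↧ c) ℚ.* ι A ℚ.* c            ≡⟨ cong (ℚ._* c) (ι-* (ℚ.↧ c) A) ⟨
      ι (ℚ.↧ c * A) ℚ.* c              ∎
    spec′ (suc i) = begin
      ι (ℚ.↧ c * F i)                                ≡⟨ ι-* (ℚ.↧ c) (F i) ⟩
      ι (ℚ.↧ c) ℚ.* ι (F i)                            ≡⟨ cong (ι (ℚ.↧ c) ℚ.*_) (spec i) ⟩
      ι (ℚ.↧ c) ℚ.* (ι A ℚ.* coeff ℚ.0ℚ p i)           ≡⟨ ℚ.*-assoc (ι (ℚ.↧ c)) (ι A)
        (coeff ℚ.0ℚ p i) ⟨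
      ι (ℚ.↧ c) ℚ.* ι A ℚ.* coeff ℚ.0ℚ p i             ≡⟨ cong (ℚ._* coeff ℚ.0ℚ p i)
        (ι-* (ℚ.↧ c) A) ⟨
      ι (ℚ.↧ c * A) ℚ.* coeff ℚ.0ℚ p i               ∎

  private
    module ℚ[t] = Polynomial ℚ.+-*-commutativeRing
    module ℚ[t]-Divisibility = RawSemiringDefs ℚ[t].rawSemiring

  integerFactors : ∀ {x y A B F G} (P : ℕ → ℤ) → (∀ i → ι (F i) ≡ ι A ℚ.* coeff ℚ.0ℚ x i) →
    (∀ i → ι (G i) ≡ ι B ℚ.* coeff ℚ.0ℚ y i) →
    (∀ i → ι (P i) ≡ coeff ℚ.0ℚ (x ℚ[t].⊠ y) i) → ∀ k → convℤ F G k ≡ (A * B) * P k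
  integerFactors {x} {y} {A} {B} {F} {G} P F≡ G≡ P≡ k = ι-injective (begin
    ι (convℤ F G k)                                              ≡⟨ convℚ-ι F G k ⟨
    convℚ (ι ∘ F) (ι ∘ G) k                                      ≡⟨ convℚ-cong F≡ G≡ k ⟩
    convℚ (λ i → ι A ℚ.* x′ i) (λ i → ι B ℚ.* y′ i) k            ≡⟨ convℚ-scaleˡ (ι A) x′
      (λ i → ι B ℚ.* y′ i) k ⟩
    ι A ℚ.* convℚ x′ (λ i → ι B ℚ.* y′ i) k                      ≡⟨ cong (ι A ℚ.*_)
      (convℚ-scaleʳ (ι B) x′ y′ k) ⟩
    ι A ℚ.* (ι B ℚ.* convℚ x′ y′ k)                              ≡⟨ ℚ.*-assoc (ι A) (ι B)
      (convℚ x′ y′ k) ⟨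
    ι A ℚ.* ι B ℚ.* convℚ x′ y′ k                                ≡⟨ cong₂ ℚ._*_ (ι-* A B)
      (coeffℚ-⊠ x y k) ⟨
    ι (A * B) ℚ.* coeff ℚ.0ℚ (x ℚ[t].⊠ y) k                    ≡⟨ cong (ι (A * B) ℚ.*_) (P≡ k) ⟨
    ι (A * B) ℚ.* ι (P k)                                      ≡⟨ ι-* (A * B) (P k) ⟨
    ι (A * B * P k)                                          ∎)
    where
    open ≡.≡-Reasoning
    x′ y′ : ℕ → ℚ
    x′ = coeff ℚ.0ℚ x
    y′ = coeff ℚ.0ℚ y

  constant-∣1 : ∀ x → coeff ℚ.0ℚ x 0 ≢ ℚ.0ℚ → (∀ i → coeff ℚ.0ℚ x (suc i) ≡ ℚ.0ℚ) →
    x ℚ[t]-Divisibility.∣ (ℚ.1ℚ ∷ [])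
  constant-∣1 x x₀≢0 higher = record { quotient = c ∷ [] ; equality = spec }
    where
    instance
      x₀-nonZero : ℚ.NonZero (coeff ℚ.0ℚ x 0)
      x₀-nonZero = ℚ.≢-nonZero x₀≢0
    c : ℚ
    c = ℚ.1/ coeff ℚ.0ℚ x 0
    expand : ∀ i → coeff ℚ.0ℚ ((c ∷ []) ℚ[t].⊠ x) i ≡ c ℚ.* coeff ℚ.0ℚ x i ℚ.+ coeff ℚ.0ℚ
      (ℚ.0ℚ ∷ []) i
    expand i = trans (coeffℚ-⊞ (List.map (c ℚ.*_) x) (ℚ.0ℚ ∷ []) i)
      (cong (ℚ._+ _) (coeffℚ-scale c x i))
    spec : ∀ i → coeff ℚ.0ℚ ((c ∷ []) ℚ[t].⊠ x) i ≡ coeff ℚ.0ℚ (ℚ.1ℚ ∷ []) i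
    spec zero    = trans (expand 0) (trans (ℚ.+-identityʳ _) (ℚ.*-inverseˡ (coeff ℚ.0ℚ x 0)))
    spec (suc i) = trans (expand (suc i))
      (trans (ℚ.+-identityʳ _) (trans (cong (c ℚ.*_) (higher i)) (ℚ.*-zeroʳ c)))

  *-≢0 : ∀ {x y} → x ≢ 0ℤ → y ≢ 0ℤ → x * y ≢ 0ℤ
  *-≢0 {x} x≢0 y≢0 = [ x≢0 , y≢0 ]′ ∘ ℤ.i*j≡0⇒i≡0∨j≡0 x

  -- Both rational factors are scaled to integers, so `eisenstein` applies with `D` = A * B. A
  -- factor that is constant is a unit: were its constant term zero as well, the product would
  -- vanish, while the coefficient of `P` at n is odd.
  eisenstein-irreducible : ∀ {n P} → 1 ℕ.≤ n → Eisenstein n (coeff 0ℤ P) → IrreducibleOverℚ P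
  eisenstein-irreducible {n} {P} 1≤n eis = RawSemiringDefs.mkIrred nonunit split
    where
    open Eisenstein eis
    P≢0 : coeff 0ℤ P n ≢ 0ℤ
    P≢0 Pn≡0 = leading (subst Even (sym Pn≡0) (divides 0ℤ refl))

    -- A scaled inverse `F` has a nonzero constant term, and together with the coefficient of `P` at
    -- n this forces 0 + n ≤ 0.
    nonunit : ¬ (List.map ι P ℚ[t]-Divisibility.∣ (ℚ.1ℚ ∷ []))
    nonunit record { quotient = q ; equality = qP≋1 } with clearDenominators q
    ... | A , F , A≢0 , finF , F≡ =
      contradiction (degree-bound {F} {coeff 0ℤ P} finF (coeff-finite P) beyond F₀≢0 P≢0)
      (ℕ.<⇒≱ 1≤n)
      where
      fac : ∀ k → convℤ F (coeff 0ℤ P) k ≡ (A * 1ℤ) * coeff 0ℤ (1ℤ ∷ []) k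
      fac = integerFactors {q} {List.map ι P} {A} {1ℤ} {F} {coeff 0ℤ P} (coeff 0ℤ (1ℤ ∷ [])) F≡
        (λ i → trans (sym (coeff-map-ι P i)) (sym (ℚ.*-identityˡ _)))
        (λ i → trans (sym (coeff-map-ι (1ℤ ∷ []) i)) (sym (qP≋1 i)))
      beyond : ∀ k → 0 ℕ.< k → convℤ F (coeff 0ℤ P) k ≡ 0ℤ
      beyond (suc k) _ = trans (fac (suc k)) (ℤ.*-zeroʳ (A * 1ℤ))
      F₀≢0 : F 0 ≢ 0ℤ
      F₀≢0 F₀≡0 = *-≢0 (*-≢0 A≢0 (λ ())) (λ ())
        (trans (sym (fac 0)) (trans (cong (ℤ._* coeff 0ℤ P 0) F₀≡0) refl))

    split : ∀ {x y} → List.map ι P ℚ[t].≋ (x ℚ[t].⊠ y) → x ℚ[t]-Divisibility.∣ (ℚ.1ℚ ∷ []) ⊎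
      y ℚ[t]-Divisibility.∣ (ℚ.1ℚ ∷ [])
    split {x} {y} P≋xy with clearDenominators x | clearDenominators y
    ... | A , F , A≢0 , finF , F≡ | B , G , B≢0 , finG , G≡ =
      conclude (eisenstein eis (*-≢0 A≢0 B≢0) finF finG fac)
      where
      fac : ∀ k → convℤ F G k ≡ (A * B) * coeff 0ℤ P k
      fac = integerFactors {x} {y} {A} {B} {F} {G} (coeff 0ℤ P) F≡ G≡
        (λ i → trans (sym (coeff-map-ι P i)) (P≋xy i))
      contra : (∀ k → convℤ F G k ≡ 0ℤ) → ⊥
      contra zeros = *-≢0 (*-≢0 A≢0 B≢0) P≢0 (trans (sym (fac n)) (zeros n))
      back : ∀ {A z f} → A ≢ 0ℤ → ι f ≡ ι A ℚ.* z → f ≡ 0ℤ → z ≡ ℚ.0ℚ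
      back {A} {z} A≢0 eq refl = trans (sym (ℚ.*-identityˡ z))
        (trans (cong (ℚ._* z) (sym (ℚ.*-inverseˡ (ι A)))) (trans (ℚ.*-assoc (ℚ.1/ ι A) (ι A) z)
        (trans (cong (ℚ.1/ ι A ℚ.*_) (sym eq)) (ℚ.*-zeroʳ (ℚ.1/ ι A)))))
        where
        instance
          ιA-nonZero : ℚ.NonZero (ι A)
          ιA-nonZero = ℚ.≢-nonZero (A≢0 ∘ ι-injective {A} {0ℤ})
      forth : ∀ {A z f} → ι f ≡ ι A ℚ.* z → z ≡ ℚ.0ℚ → f ≡ 0ℤ
      forth {A} eq refl = ι-injective (trans eq (ℚ.*-zeroʳ (ι A)))
      conclude : Constant F ⊎ Constant G → x ℚ[t]-Divisibility.∣ (ℚ.1ℚ ∷ []) ⊎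
        y ℚ[t]-Divisibility.∣ (ℚ.1ℚ ∷ [])
      conclude (inj₁ F-const) = inj₁ (constant-∣1 x
        (λ x₀≡0 → contra λ k → trans (convℤ-cong {F} {λ _ → 0ℤ}
          (λ { zero → forth {A} (F≡ 0) x₀≡0 ; (suc i) → F-const i }) (λ _ → refl) k) (convℤ-0ˡ G k))
        (λ i → back {A} A≢0 (F≡ (suc i)) (F-const i)))
      conclude (inj₂ G-const) = inj₂ (constant-∣1 y
        (λ y₀≡0 → contra λ k → 0∣⇒≡0 (conv-∣ F G k λ a b _ →
          subst (λ z → 0ℤ ∣ F a * z) (sym (G≡0 y₀≡0 b)) (divides 0ℤ (ℤ.*-zeroʳ (F a)))))
        (λ i → back {B} B≢0 (G≡ (suc i)) (G-const i)))
        where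
        G≡0 : coeff ℚ.0ℚ y 0 ≡ ℚ.0ℚ → ∀ b → G b ≡ 0ℤ
        G≡0 y₀≡0 zero    = forth {B} (G≡ 0) y₀≡0
        G≡0 y₀≡0 (suc b) = G-const b

  -- Polynomials vanishing at a root of an Eisenstein polynomial

  conv-+ˡ : ∀ F F′ G k → convℤ (λ i → F i + F′ i) G k ≡ convℤ F G k + convℤ F′ G k
  conv-+ˡ F F′ G zero    = ℤ.*-distribʳ-+ (G 0) (F 0) (F′ 0)
  conv-+ˡ F F′ G (suc k) = trans
    (cong₂ ℤ._+_ (ℤ.*-distribʳ-+ (G (suc k)) (F 0) (F′ 0)) (conv-+ˡ (F ∘ suc) (F′ ∘ suc) G k))
    (regroup (F 0 * G (suc k)) (F′ 0 * G (suc k)) (convℤ (F ∘ suc) G k) (convℤ (F′ ∘ suc) G k))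
    where
    regroup : ∀ a b c d → (a + b) + (c + d) ≡ (a + c) + (b + d)
    regroup = solve-∀

  shift : ℕ → ℤ[t] → ℤ[t]
  shift e p = List.replicate e 0ℤ List.++ p

  coeff-shift : ∀ e p i → coeff 0ℤ (shift e p) (e ℕ.+ i) ≡ coeff 0ℤ p i
  coeff-shift zero    p i = refl
  coeff-shift (suc e) p i = coeff-shift e p i

  conv-monomial : ∀ e c E k → convℤ (coeff 0ℤ (shift e (c ∷ []))) (coeff 0ℤ E) k ≡ c * coeff 0ℤ
    (shift e E) k
  conv-monomial zero    c E zero    = refl
  conv-monomial zero    c E (suc k) =
    trans (cong₂ ℤ._+_ (refl {x = c * coeff 0ℤ E (suc k)}) (convℤ-0ˡ (coeff 0ℤ E) k))
    (ℤ.+-identityʳ _)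
  conv-monomial (suc e) c E zero    = sym (ℤ.*-zeroʳ c)
  conv-monomial (suc e) c E (suc k) = trans (ℤ.+-identityˡ _) (conv-monomial e c E k)

  -- `Z` stands for the polynomials that vanish at one fixed real number. Only the closure
  -- properties used in a division with remainder are listed; `Z-constant` says that the ideal is
  -- proper.
  module VanishingIdeal
    (Z : Pred ℤ[t] 0ℓ)
    (Z-⊞ : ∀ p q → Z p → Z q → Z (p ⊞ℤ q))
    (Z-scale : ∀ c p → Z p → Z (List.map (c *_) p))
    (Z-shift : ∀ p → Z p → Z (0ℤ ∷ p))
    (Z-constant : ∀ p → Constant (coeff 0ℤ p) → Z p → coeff 0ℤ p 0 ≡ 0ℤ)
    where

    Z-shifts : ∀ e p → Z p → Z (shift e p)
    Z-shifts zero    p Zp = Zp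
    Z-shifts (suc e) p Zp = Z-shift (shift e p) (Z-shifts e p Zp)

    -- Division by a polynomial that need not be monic, kept inside ℤ: `scale` is a power of the
    -- leading coefficient of `E`. Membership of the remainder is recorded along the way, since `Z`
    -- is only assumed closed under sums, constant multiples and shifts.
    record PseudoDivision (d : ℕ) (E F : ℤ[t]) : Set where
      field
        scale     : ℤ
        scale≢0   : scale ≢ 0ℤ
        quot rem  : ℤ[t]
        rem-small : ∀ i → d ℕ.≤ i → coeff 0ℤ rem i ≡ 0ℤ
        rem∈Z     : Z rem
        equality  : ∀ k → scale * coeff 0ℤ F k ≡ convℤ (coeff 0ℤ quot)
          (coeff 0ℤ E) k + coeff 0ℤ rem k

    pseudoDivide : ∀ d E → Z E → coeff 0ℤ E d ≢ 0ℤ → (∀ i → d ℕ.< i → coeff 0ℤ E i ≡ 0ℤ) →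
      ∀ m F → Z F → (∀ i → m ℕ.≤ i → coeff 0ℤ F i ≡ 0ℤ) → PseudoDivision d E F
    pseudoDivide d E ZE Ed≢0 E>d = go
      where
      trivial : ∀ F → Z F → (∀ i → d ℕ.≤ i → coeff 0ℤ F i ≡ 0ℤ) → PseudoDivision d E F
      trivial F ZF small = record
        { scale = 1ℤ ; scale≢0 = λ () ; quot = [] ; rem = F ; rem-small = small ; rem∈Z = ZF
        ; equality = λ k → trans (ℤ.*-identityˡ (coeff 0ℤ F k))
          (sym (trans (cong (ℤ._+ coeff 0ℤ F k) (convℤ-0ˡ (coeff 0ℤ E) k))
          (ℤ.+-identityˡ (coeff 0ℤ F k)))) }

      go : ∀ m F → Z F → (∀ i → m ℕ.≤ i → coeff 0ℤ F i ≡ 0ℤ) → PseudoDivision d E F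
      go zero    F ZF small = trivial F ZF λ i _ → small i z≤n
      go (suc m) F ZF small with d ℕ.≤? m
      ... | no  d≰m = trivial F ZF λ i d≤i → small i (ℕ.≤-trans (ℕ.≰⇒> d≰m) d≤i)
      ... | yes d≤m = lift (go m F′ ZF′ small′)
        where
        e : ℕ
        e = m ℕ.∸ d
        e+d≡m : e ℕ.+ d ≡ m
        e+d≡m = ℕ.m∸n+n≡m d≤m
        Eᵈ Fᵐ : ℤ
        Eᵈ = coeff 0ℤ E d
        Fᵐ = coeff 0ℤ F m
        -- Cross-multiplying the leading coefficients cancels the coefficient at `m`, so the
        -- recursion continues with `m` in place of `suc m`.
        F′ : ℤ[t]
        F′ = List.map (Eᵈ *_) F ⊞ℤ List.map (- Fᵐ *_) (shift e E)
        ZF′ : Z F′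
        ZF′ = Z-⊞ _ _ (Z-scale Eᵈ F ZF) (Z-scale (- Fᵐ) (shift e E) (Z-shifts e E ZE))
        coeff-F′ : ∀ i → coeff 0ℤ F′ i ≡ Eᵈ * coeff 0ℤ F i + - Fᵐ * coeff 0ℤ (shift e E) i
        coeff-F′ i = trans (coeffℤ-⊞ (List.map (Eᵈ *_) F) _ i)
          (cong₂ ℤ._+_ (coeffℤ-scale Eᵈ F i) (coeffℤ-scale (- Fᵐ) (shift e E) i))
        small′ : ∀ i → m ℕ.≤ i → coeff 0ℤ F′ i ≡ 0ℤ
        small′ i m≤i with ℕ.m≤n⇒m<n∨m≡n m≤i
        ... | inj₂ refl = trans (coeff-F′ i) (trans (cong (λ z → Eᵈ * Fᵐ + - Fᵐ * z)
            (trans (cong (coeff 0ℤ (shift e E)) (sym e+d≡m)) (coeff-shift e E d))) (cancel Eᵈ Fᵐ))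
          where
          cancel : ∀ x y → x * y + - y * x ≡ 0ℤ
          cancel = solve-∀
        ... | inj₁ m<i = trans (coeff-F′ i)
          (trans (cong₂ (λ y z → Eᵈ * y + - Fᵐ * z) (small i m<i) shifted)
            (cong₂ ℤ._+_ (ℤ.*-zeroʳ Eᵈ) (ℤ.*-zeroʳ (- Fᵐ))))
          where
          e≤i : e ℕ.≤ i
          e≤i = ℕ.≤-trans (ℕ.m∸n≤m m d) m≤i
          shifted : coeff 0ℤ (shift e E) i ≡ 0ℤ
          shifted = trans (cong (coeff 0ℤ (shift e E)) (sym (ℕ.m+[n∸m]≡n e≤i)))
            (trans (coeff-shift e E (i ℕ.∸ e))
            (E>d _ (ℕ.+-cancelˡ-< e d (i ℕ.∸ e)
              (≡.subst₂ ℕ._<_ (sym e+d≡m) (sym (ℕ.m+[n∸m]≡n e≤i)) m<i))))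

        lift : PseudoDivision d E F′ → PseudoDivision d E F
        lift D = record
          { scale = scale * Eᵈ ; scale≢0 = *-≢0 scale≢0 Ed≢0
          ; quot = quot ⊞ℤ shift e (scale * Fᵐ ∷ []) ; rem = rem ; rem-small = rem-small ; rem∈Z =
            rem∈Z ; equality = spec }
          where
          open PseudoDivision D
          rearrange : ∀ c x f y s → c * (x * y + - f * s) + (c * f) * s ≡ c * x * y
          rearrange = solve-∀
          swap : ∀ x y z → x + y + z ≡ x + z + y
          swap = solve-∀
          open ≡.≡-Reasoning
          spec : ∀ k → scale * Eᵈ * coeff 0ℤ F k ≡ convℤ
            (coeff 0ℤ (quot ⊞ℤ shift e (scale * Fᵐ ∷ []))) (coeff 0ℤ E) k + coeff 0ℤ rem k
          spec k = begin
            scale * Eᵈ * coeff 0ℤ F k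
              ≡⟨ rearrange scale Eᵈ Fᵐ (coeff 0ℤ F k) (coeff 0ℤ (shift e E) k) ⟨
            scale * (Eᵈ * coeff 0ℤ F k + - Fᵐ * coeff 0ℤ (shift e E) k) + (scale * Fᵐ) * coeff 0ℤ
              (shift e E) k
              ≡⟨ cong₂ ℤ._+_ (cong (scale *_) (coeff-F′ k)) (conv-monomial e (scale * Fᵐ) E k) ⟨
            scale * coeff 0ℤ F′ k + convℤ (coeff 0ℤ (shift e (scale * Fᵐ ∷ []))) (coeff 0ℤ E) k
              ≡⟨ cong (ℤ._+ convℤ (coeff 0ℤ (shift e (scale * Fᵐ ∷ []))) (coeff 0ℤ E) k)
                (equality k) ⟩
            convℤ (coeff 0ℤ quot) (coeff 0ℤ E) k + coeff 0ℤ rem k + convℤ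
              (coeff 0ℤ (shift e (scale * Fᵐ ∷ []))) (coeff 0ℤ E) k
              ≡⟨ swap (convℤ (coeff 0ℤ quot) (coeff 0ℤ E) k) (coeff 0ℤ rem k)
                (convℤ (coeff 0ℤ (shift e (scale * Fᵐ ∷ []))) (coeff 0ℤ E) k) ⟩
            convℤ (coeff 0ℤ quot) (coeff 0ℤ E) k + convℤ (coeff 0ℤ (shift e (scale * Fᵐ ∷ [])))
              (coeff 0ℤ E) k + coeff 0ℤ rem k
              ≡⟨ cong (ℤ._+ coeff 0ℤ rem k) (conv-+ˡ (coeff 0ℤ quot)
                (coeff 0ℤ (shift e (scale * Fᵐ ∷ []))) (coeff 0ℤ E) k) ⟨
            convℤ (λ i → coeff 0ℤ quot i + coeff 0ℤ (shift e (scale * Fᵐ ∷ [])) i)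
              (coeff 0ℤ E) k + coeff 0ℤ rem k
              ≡⟨ cong (ℤ._+ coeff 0ℤ rem k) (convℤ-cong (coeffℤ-⊞ quot (shift e (scale * Fᵐ ∷ [])))
                (λ _ → refl) k) ⟨
            convℤ (coeff 0ℤ (quot ⊞ℤ shift e (scale * Fᵐ ∷ []))) (coeff 0ℤ E) k + coeff 0ℤ rem k ∎

    module _ {n : ℕ} {P : ℤ[t]} (eis : Eisenstein n (coeff 0ℤ P)) (ZP : Z P) where

      private
        Absent : ℕ → Set
        Absent d = ∀ E → Z E → d ℕ.< n → coeff 0ℤ E d ≢ 0ℤ → (∀ i → d ℕ.< i → coeff 0ℤ E i ≡ 0ℤ) → ⊥

        -- The minimal polynomial argument. The remainder of `P` by an element `E` of least degree d
        -- is zero by induction, so a multiple of `P` is quot * E. By `eisenstein` one factor is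
        -- constant: not `E`, whose degree d is positive here, and not the quotient, because d < n.
        step : ∀ d → (∀ {c} → c ℕ.< d → Absent c) → Absent d
        step zero     _    E ZE d<n Ed≢0 E>d = Ed≢0 (Z-constant E (λ i → E>d (suc i) (s≤s z≤n)) ZE)
        step d@(suc _) rec E ZE d<n Ed≢0 E>d = [ quot-constant , (λ c → Ed≢0 (c _)) ]′
            (eisenstein eis scale≢0 (coeff-finite quot) (coeff-finite E)
              λ k → sym (trans (equality k) (trans
                (cong₂ ℤ._+_ (refl {x = convℤ (coeff 0ℤ quot) (coeff 0ℤ E) k}) (rem≡0 k))
                (ℤ.+-identityʳ _))))
          where
          open PseudoDivision (pseudoDivide d E ZE Ed≢0 E>d (List.length P) P ZP
            (proj₂ (coeff-finite P)))
          rem≡0 : ∀ i → coeff 0ℤ rem i ≡ 0ℤ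
          rem≡0 i with coeff 0ℤ rem i ℤ.≟ 0ℤ
          ... | yes eq = eq
          ... | no neq with lastNonzero (coeff 0ℤ rem) (coeff-finite rem) i neq
          ...   | l , _ , reml≢0 , rem>l =
            ⊥-elim (rec l<d rem rem∈Z (ℕ.<-trans l<d d<n) reml≢0 rem>l)
            where
            l<d : l ℕ.< d
            l<d = ℕ.≰⇒> λ d≤l → reml≢0 (rem-small l d≤l)
          quot-constant : Constant (coeff 0ℤ quot) → ⊥
          quot-constant const = *-≢0 scale≢0 Pn≢0
            (trans (equality n) (cong₂ ℤ._+_ conv≡0 (rem≡0 n)))
            where
            Pn≢0 : coeff 0ℤ P n ≢ 0ℤ
            Pn≢0 Pn≡0 = Eisenstein.leading eis (subst Even (sym Pn≡0) (divides 0ℤ refl))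
            term : ∀ a b → a ℕ.+ b ≡ n → 0ℤ ∣ coeff 0ℤ quot a * coeff 0ℤ E b
            term zero    b refl = subst (λ z → 0ℤ ∣ coeff 0ℤ quot 0 * z) (sym (E>d n d<n))
              (divides 0ℤ (ℤ.*-zeroʳ (coeff 0ℤ quot 0)))
            term (suc a) b _      = subst (λ z → 0ℤ ∣ z * coeff 0ℤ E b) (sym (const a))
              (divides 0ℤ refl)
            conv≡0 : convℤ (coeff 0ℤ quot) (coeff 0ℤ E) n ≡ 0ℤ
            conv≡0 = 0∣⇒≡0 (conv-∣ (coeff 0ℤ quot) (coeff 0ℤ E) n term)

      small⇒zero : ∀ E → Z E → (∀ i → n ℕ.≤ i → coeff 0ℤ E i ≡ 0ℤ) → ∀ i → coeff 0ℤ E i ≡ 0ℤ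
      small⇒zero E ZE small i with coeff 0ℤ E i ℤ.≟ 0ℤ
      ... | yes eq = eq
      ... | no neq with lastNonzero (coeff 0ℤ E) (coeff-finite E) i neq
      ...   | l , _ , El≢0 , E>l = ⊥-elim
        (<-rec Absent step l E ZE (ℕ.≰⇒> λ n≤l → El≢0 (small l n≤l)) El≢0 E>l)

-- Finite coverings and cardinalities

module Counting (em : ExcludedMiddle 0ℓ) (X : Setoid 0ℓ 0ℓ) where
  open Setoid X

  -- The listed elements may repeat and may lie outside `S`. This makes coverings pass to subsets
  -- and unions freely; exact cardinalities are extracted only once, at the end.
  Covered : Pred Carrier 0ℓ → ℕ → Set
  Covered S m = Σ (Fin m → Carrier) λ f → ∀ x → S x → ∃[ i ] f i ≈ x

  -- Excluded middle decides whether the first listed element represents a member of `S`. If not, it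
  -- is dropped; if so, its class is counted once and removed from `S`.
  cover⇒cardinality : ∀ {m S} → Covered S m → ∃[ N ] N ℕ.≤ m × HasCardinality X S N
  cover⇒cardinality {zero} {S} (f , covers) = 0 , z≤n , record
    { to = λ ()
    ; cong = λ { {()} }
    ; bijective = (λ { {()} }) , λ (y , Sy) → contradiction (proj₁ (covers y Sy)) λ ()
    }
  cover⇒cardinality {suc m} {S} (f , covers) with em {∃[ x ] S x × f zero ≈ x}
  ... | no none = skip (cover⇒cardinality {m} {S} (f ∘ suc , covers′))
    where
    covers′ : ∀ x → S x → ∃[ i ] f (suc i) ≈ x
    covers′ x Sx with covers x Sx
    ... | zero  , f0≈x = contradiction (x , Sx , f0≈x) none
    ... | suc i , fi≈x = i , fi≈x
    skip : ∃[ N ] N ℕ.≤ m × HasCardinality X S N → ∃[ N ] N ℕ.≤ suc m × HasCardinality X S N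
    skip (N , N≤m , card) = N , ℕ.m≤n⇒m≤1+n N≤m , card
  ... | yes (x₀ , Sx₀ , f0≈x₀) = extend (cover⇒cardinality {m} {S′} (f ∘ suc , covers′))
    where
    S′ : Pred Carrier 0ℓ
    S′ x = S x × ¬ (x₀ ≈ x)
    covers′ : ∀ x → S′ x → ∃[ i ] f (suc i) ≈ x
    covers′ x (Sx , x₀≉x) with covers x Sx
    ... | zero  , f0≈x = contradiction (trans (sym f0≈x₀) f0≈x) x₀≉x
    ... | suc i , fi≈x = i , fi≈x
    extend : ∃[ N ] N ℕ.≤ m × HasCardinality X S′ N → ∃[ N ] N ℕ.≤ suc m × HasCardinality X S N
    extend (N , N≤m , card) = suc N , s≤s N≤m , record
      { to = to′ ; cong = λ { ≡.refl → refl } ; bijective = injective′ , surjective′ }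
      where
      open Bijection card using (to; injective; surjective)
      to′ : Fin (suc N) → Σ Carrier S
      to′ zero    = x₀ , Sx₀
      to′ (suc i) = proj₁ (to i) , proj₁ (proj₂ (to i))
      injective′ : ∀ {i j} → proj₁ (to′ i) ≈ proj₁ (to′ j) → i ≡ j
      injective′ {zero}  {zero}  _  = ≡.refl
      injective′ {zero}  {suc j} eq = contradiction eq (proj₂ (proj₂ (to j)))
      injective′ {suc i} {zero}  eq = contradiction (sym eq) (proj₂ (proj₂ (to i)))
      injective′ {suc i} {suc j} eq = cong suc (injective eq)
      surjective′ : ∀ (y : Σ Carrier S) → ∃[ i ] (∀ {z} → z ≡ i → proj₁ (to′ z) ≈ proj₁ y)
      surjective′ (y , Sy) with em {x₀ ≈ y}
      ... | yes x₀≈y = zero , λ { ≡.refl → x₀≈y }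
      ... | no  x₀≉y with surjective (y , Sy , x₀≉y)
      ...   | i , eq = suc i , λ { ≡.refl → eq ≡.refl }

  injection⇒≤ : ∀ {m N S} → HasCardinality X S N → (f : Fin m → Σ Carrier S) →
    (∀ {i j} → proj₁ (f i) ≈ proj₁ (f j) → i ≡ j) → m ℕ.≤ N
  injection⇒≤ {m} {N} card f f-injective = Fin.injective⇒≤ {f = g} λ {i} {j} gi≡gj →
    f-injective (trans (sym (spec i)) (trans (reflexive (cong (proj₁ ∘ to) gi≡gj)) (spec j)))
    where
    open Bijection card using (to; surjective)
    g : Fin m → Fin N
    g i = proj₁ (surjective (f i))
    spec : ∀ i → proj₁ (to (g i)) ≈ proj₁ (f i)
    spec i = proj₂ (surjective (f i)) ≡.refl

  cover-⊆ : ∀ {S T : Pred Carrier 0ℓ} {m} → (∀ x → S x → T x) → Covered T m → Covered S m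
  cover-⊆ S⊆T (f , covers) = f , λ x Sx → covers x (S⊆T x Sx)

  cover-⋃ : ∀ {a b} (T : Fin a → Pred Carrier 0ℓ) → (∀ i → Covered (T i) b) →
    Covered (λ x → ∃[ i ] T i x) (a ℕ.* b)
  cover-⋃ {a} {b} T each = decode , covers
    where
    select : Fin a × Fin b → Carrier
    select (i , j) = proj₁ (each i) j
    decode : Fin (a ℕ.* b) → Carrier
    decode k = select (Fin.remQuot b k)
    covers : ∀ x → ∃[ i ] T i x → ∃[ k ] decode k ≈ x
    covers x (i , Tix) = Fin.combine i (proj₁ found) ,
      trans (reflexive (cong select (Fin.remQuot-combine i (proj₁ found)))) (proj₂ found)
      where
      found : ∃[ j ] proj₁ (each i) j ≈ x
      found = proj₂ (each i) x Tix

  offset : ∀ W z z₀ → ℤ.∣ z ℤ.- z₀ ∣ ℕ.≤ W → Σ (Fin (suc (W ℕ.+ W))) λ i →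
    z ≡ z₀ ℤ.+ (+ toℕ i ℤ.- + W)
  offset W z z₀ le = fromBound (z ℤ.- z₀) ≡.refl le
    where
    rebuild : ∀ z z₀ w → z ≡ z₀ ℤ.+ ((z ℤ.- z₀ ℤ.+ w) ℤ.- w)
    rebuild = solve-∀
    at : ∀ d k → z ℤ.- z₀ ≡ d → d ℤ.+ + W ≡ + k → k ℕ.≤ W ℕ.+ W → Σ (Fin (suc (W ℕ.+ W))) λ i →
      z ≡ z₀ ℤ.+ (+ toℕ i ℤ.- + W)
    at d k eq k≡ k≤ = Fin.fromℕ< (s≤s k≤) ,
      ≡.trans (rebuild z z₀ (+ W)) (cong (λ e → z₀ ℤ.+ (e ℤ.- + W))
      (≡.trans (cong (ℤ._+ + W) eq) (≡.trans k≡ (cong +_ (≡.sym (Fin.toℕ-fromℕ< (s≤s k≤)))))))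
    fromBound : ∀ d → z ℤ.- z₀ ≡ d → ℤ.∣ d ∣ ℕ.≤ W → Σ (Fin (suc (W ℕ.+ W))) λ i →
      z ≡ z₀ ℤ.+ (+ toℕ i ℤ.- + W)
    fromBound (+ k)    eq k≤W = at (+ k) (k ℕ.+ W) eq ≡.refl (ℕ.+-monoˡ-≤ W k≤W)
    fromBound -[1+ k ] eq k<W = at -[1+ k ] (W ℕ.∸ suc k) eq (ℤ.⊖-≥ k<W)
      (ℕ.≤-trans (ℕ.m∸n≤m W (suc k)) (ℕ.m≤m+n W W))

  -- The range of the relevant z need not be known in advance: any inhabited T z gives the origin
  -- of the window.
  cover-ℤ : Carrier → ∀ {W b} (T : ℤ → Pred Carrier 0ℓ) →
    (∀ z z′ x x′ → T z x → T z′ x′ → ℤ.∣ z ℤ.- z′ ∣ ℕ.≤ W) →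
    (∀ z → Covered (T z) b) → Covered (λ x → ∃[ z ] T z x) (suc (W ℕ.+ W) ℕ.* b)
  cover-ℤ o {W} T close each with em {∃[ z ] ∃[ x ] T z x}
  -- Nothing has to be covered, but every index still needs a value; supplying it is the purpose of
  -- `o`.
  ... | no  none = (λ _ → o) , λ x (z , Tzx) → contradiction (z , x , Tzx) none
  ... | yes (z₀ , x₀ , T₀) = cover-⊆ locate
    (cover-⋃ (λ i → T (z₀ ℤ.+ (+ toℕ i ℤ.- + W))) (λ i → each _))
    where
    locate : ∀ x → ∃[ z ] T z x → ∃[ i ] T (z₀ ℤ.+ (+ toℕ i ℤ.- + W)) x
    locate x (z , Tzx) with offset W z z₀ (close z z₀ x x₀ Tzx T₀)
    ... | i , z≡ = i , subst (λ z → T z x) z≡ Tzx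

  -- The base is 1 + 4H rather than 1 + 2H because `cover-ℤ` centres its window at an unknown entry:
  -- two entries of absolute value at most H may differ by 2H, in either direction.
  cover-Vec : Carrier → ∀ {H b} m (T : Vec ℤ m → Pred Carrier 0ℓ) →
    (∀ v x → T v x → VecAll.All (λ z → ℤ.∣ z ∣ ℕ.≤ H) v) →
    (∀ v → Covered (T v) b) → Covered (λ x → ∃[ v ] T v x)
      (suc ((H ℕ.+ H) ℕ.+ (H ℕ.+ H)) ℕ.^ m ℕ.* b)
  cover-Vec o {H} {b} zero T bounded each =
    subst (Covered _) (≡.sym (ℕ.+-identityʳ b)) (cover-⊆ (λ { x ([] , Tx) → Tx }) (each []))
  cover-Vec o {H} {b} (suc m) T bounded each = subst (Covered _) (≡.sym (ℕ.*-assoc c (c ℕ.^ m) b))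
    (cover-⊆ (λ { x (z ∷ v , Tx) → z , v , Tx })
      (cover-ℤ o (λ z x → ∃[ v ] T (z ∷ v) x) close λ z →
        cover-Vec o m (λ v → T (z ∷ v)) (λ v x Tx → VecAll.tail (bounded (z ∷ v) x Tx))
        (λ v → each (z ∷ v))))
    where
    c : ℕ
    c = suc ((H ℕ.+ H) ℕ.+ (H ℕ.+ H))
    close : ∀ z z′ x x′ → ∃[ v ] T (z ∷ v) x → ∃[ v ] T (z′ ∷ v) x′ → ℤ.∣ z ℤ.- z′ ∣ ℕ.≤ H ℕ.+ H
    close z z′ x x′ (v , Tx) (v′ , Tx′) = ℕ.≤-trans (ℤ.∣i-j∣≤∣i∣+∣j∣ z z′)
      (ℕ.+-mono-≤ (VecAll.head (bounded (z ∷ v) x Tx)) (VecAll.head (bounded (z′ ∷ v′) x′ Tx′)))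

-- The integers inside the real field

module Reals (em : ExcludedMiddle 0ℓ) (R : RealField) where
  open RealField R hiding (zero)
  open Theory em R
  open RingProperties ring using (-0#≈0#; -‿distribˡ-*; -‿involutive)
  open AbelianGroupProperties +-abelianGroup using (⁻¹-∙-comm)

  private
    module MultTC = MonoidMult +-monoid
    module Mult = SemiringMult semiring
    module Exp = SemiringExp semiring
    module CExp = CommutativeSemiringExp commutativeSemiring

  private
    open module ≈-Reasoning = SetoidReasoning ℝ-setoid
  -- ⌜ 1 ⌝ is 1# by definition, whereas fromℕ 1 is 1# + 0#.
  infixr 9 ⌜_⌝
  ⌜_⌝ : ℕ → ℝ
  ⌜ n ⌝ = MultTC._×_ n 1#

  ⟦_⟧ℤ : ℤ → ℝ
  ⟦ + n ⟧ℤ      = ⌜ n ⌝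
  ⟦ -[1+ n ] ⟧ℤ = - ⌜ suc n ⌝

  ⌜suc⌝ : ∀ n → ⌜ suc n ⌝ ≈ 1# + ⌜ n ⌝
  ⌜suc⌝ n = MultTC.1+× n 1#

  ⌜+⌝ : ∀ m n → ⌜ m ℕ.+ n ⌝ ≈ ⌜ m ⌝ + ⌜ n ⌝
  ⌜+⌝ = MultTC.×-homo-+ 1#

  cancel-suc : ∀ x y → x - y ≈ (1# + x) - (1# + y)
  cancel-suc x y = sym (begin
    (1# + x) - (1# + y)       ≈⟨ +-congˡ (sym (⁻¹-∙-comm 1# y)) ⟩
    (1# + x) + (- 1# + - y)   ≈⟨ +-congʳ (+-comm 1# x) ⟩
    (x + 1#) + (- 1# + - y)   ≈⟨ +-assoc x 1# _ ⟩
    x + (1# + (- 1# + - y))   ≈⟨ +-congˡ (sym (+-assoc 1# (- 1#) (- y))) ⟩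
    x + ((1# - 1#) + - y)     ≈⟨ +-congˡ (+-congʳ (-‿inverseʳ 1#)) ⟩
    x + (0# + - y)            ≈⟨ +-congˡ (+-identityˡ (- y)) ⟩
    x - y ∎)

  ⟦⊖⟧ : ∀ m n → ⟦ m ℤ.⊖ n ⟧ℤ ≈ ⌜ m ⌝ - ⌜ n ⌝
  ⟦⊖⟧ m zero = begin
    ⟦ m ℤ.⊖ 0 ⟧ℤ  ≡⟨ cong ⟦_⟧ℤ (ℤ.⊖-≥ (z≤n {m})) ⟩
    ⌜ m ⌝         ≈⟨ +-identityʳ ⌜ m ⌝ ⟨
    ⌜ m ⌝ + 0#    ≈⟨ +-congˡ -0#≈0# ⟨
    ⌜ m ⌝ - 0#    ∎
  ⟦⊖⟧ zero (suc n) = sym (+-identityˡ _)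
  ⟦⊖⟧ (suc m) (suc n) = begin
    ⟦ suc m ℤ.⊖ suc n ⟧ℤ        ≡⟨ cong ⟦_⟧ℤ (ℤ.[1+m]⊖[1+n]≡m⊖n m n) ⟩
    ⟦ m ℤ.⊖ n ⟧ℤ                ≈⟨ ⟦⊖⟧ m n ⟩
    ⌜ m ⌝ - ⌜ n ⌝               ≈⟨ cancel-suc _ _ ⟩
    (1# + ⌜ m ⌝) - (1# + ⌜ n ⌝) ≈⟨ +-cong (⌜suc⌝ m) (-‿cong (⌜suc⌝ n)) ⟨
    ⌜ suc m ⌝ - ⌜ suc n ⌝       ∎

  ⟦+⟧ : ∀ a b → ⟦ a ℤ.+ b ⟧ℤ ≈ ⟦ a ⟧ℤ + ⟦ b ⟧ℤ
  ⟦+⟧ (+ m) (+ n) = ⌜+⌝ m n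
  ⟦+⟧ (+ m) -[1+ n ] = ⟦⊖⟧ m (suc n)
  ⟦+⟧ -[1+ m ] (+ n) = trans (⟦⊖⟧ n (suc m)) (+-comm _ _)
  ⟦+⟧ -[1+ m ] -[1+ n ] = begin
    - ⌜ suc (suc (m ℕ.+ n)) ⌝       ≡⟨ cong (λ k → - ⌜ suc k ⌝) (ℕ.+-suc m n) ⟨
    - ⌜ suc m ℕ.+ suc n ⌝           ≈⟨ -‿cong (⌜+⌝ (suc m) (suc n)) ⟩
    - (⌜ suc m ⌝ + ⌜ suc n ⌝)       ≈⟨ ⁻¹-∙-comm _ _ ⟨
    - ⌜ suc m ⌝ - ⌜ suc n ⌝         ∎

  ⟦-⟧ : ∀ a → ⟦ ℤ.- a ⟧ℤ ≈ - ⟦ a ⟧ℤ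
  ⟦-⟧ (+ zero)   = sym -0#≈0#
  ⟦-⟧ (+ suc n)  = refl
  ⟦-⟧ -[1+ n ]   = sym (-‿involutive _)

  ⟦+*⟧ : ∀ m b → ⟦ + m ℤ.* b ⟧ℤ ≈ ⌜ m ⌝ * ⟦ b ⟧ℤ
  ⟦+*⟧ zero    b = trans (reflexive (cong ⟦_⟧ℤ (ℤ.*-zeroˡ b))) (sym (zeroˡ _))
  ⟦+*⟧ (suc m) b = begin
    ⟦ + suc m ℤ.* b ⟧ℤ            ≡⟨ cong ⟦_⟧ℤ (ℤ.suc-* (+ m) b) ⟩
    ⟦ b ℤ.+ + m ℤ.* b ⟧ℤ          ≈⟨ ⟦+⟧ b (+ m ℤ.* b) ⟩
    ⟦ b ⟧ℤ + ⟦ + m ℤ.* b ⟧ℤ       ≈⟨ +-cong (sym (*-identityˡ _)) (⟦+*⟧ m b) ⟩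
    1# * ⟦ b ⟧ℤ + ⌜ m ⌝ * ⟦ b ⟧ℤ  ≈⟨ distribʳ _ _ _ ⟨
    (1# + ⌜ m ⌝) * ⟦ b ⟧ℤ         ≈⟨ *-congʳ (⌜suc⌝ m) ⟨
    ⌜ suc m ⌝ * ⟦ b ⟧ℤ            ∎

  ⟦*⟧ : ∀ a b → ⟦ a ℤ.* b ⟧ℤ ≈ ⟦ a ⟧ℤ * ⟦ b ⟧ℤ
  ⟦*⟧ (+ m) b = ⟦+*⟧ m b
  ⟦*⟧ -[1+ m ] b = begin
    ⟦ -[1+ m ] ℤ.* b ⟧ℤ        ≡⟨ cong ⟦_⟧ℤ (ℤ.neg-distribˡ-* (+ suc m) b) ⟨
    ⟦ ℤ.- (+ suc m ℤ.* b) ⟧ℤ   ≈⟨ ⟦-⟧ (+ suc m ℤ.* b) ⟩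
    - ⟦ + suc m ℤ.* b ⟧ℤ       ≈⟨ -‿cong (⟦+*⟧ (suc m) b) ⟩
    - (⌜ suc m ⌝ * ⟦ b ⟧ℤ)     ≈⟨ -‿distribˡ-* _ _ ⟩
    - ⌜ suc m ⌝ * ⟦ b ⟧ℤ       ∎

  -- With coefficients in ℤ, the numerals in a polynomial identity over ℝ are compared where
  -- equality is a computation.
  ℤ⟶ℝ : ℤ.+-*-rawRing -Raw-AlmostCommutative⟶ fromCommutativeRing commutativeRing
  ℤ⟶ℝ = record
    { ⟦_⟧ = ⟦_⟧ℤ ; +-homo = ⟦+⟧ ; *-homo = ⟦*⟧ ; -‿homo = ⟦-⟧ ; 0-homo = refl ; 1-homo = refl }

  coefficient≟ : ∀ a b → Maybe (⟦ a ⟧ℤ ≈ ⟦ b ⟧ℤ)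
  coefficient≟ a b with a ℤ.≟ b
  ... | yes a≡b = just (reflexive (cong ⟦_⟧ℤ a≡b))
  ... | no  _   = nothing

  private
    module Solver = RingSolver ℤ.+-*-rawRing (fromCommutativeRing commutativeRing) ℤ⟶ℝ coefficient≟

  open Solver using (solve; _:+_; _:*_; _:-_; :-_; _:=_)

  num : ∀ {n} → ℕ → Solver.Polynomial n
  num k = Solver.con (+ k)

  -- Order, and certificates for inequalities

  private
    module STO = IsStrictTotalOrder isStrictTotalOrder
    module ≤-Order = IsTotalOrder (StrictToNonStrict.isTotalOrder _≈_ _<_ isStrictTotalOrder)

  open STO using () renaming (irrefl to <-irrefl; trans to <-trans; <-respˡ-≈ to <-respˡ; <-respʳ-≈
    to <-respʳ)
  open ≤-Order using () renaming
    (refl to ≤-refl; trans to ≤-trans; antisym to ≤-antisym; total to ≤-total; reflexive to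
    ≤-reflexive; ≤-respˡ-≈ to ≤-respˡ; ≤-respʳ-≈ to ≤-respʳ)

  infixl 5 _⊕_ _⊞_
  infixl 7 _/_

  2# 3# 4# : ℝ
  2# = ⌜ 2 ⌝
  3# = ⌜ 3 ⌝
  4# = ⌜ 4 ⌝

  weaken : ∀ {x y} → x < y → x ≤ y
  weaken = inj₁

  <-≤-trans : ∀ {x y z} → x < y → y ≤ z → x < z
  <-≤-trans = StrictToNonStrict.<-≤-trans _≈_ _<_ <-trans <-respʳ

  ≤-<-trans : ∀ {x y z} → x ≤ y → y < z → x < z
  ≤-<-trans = StrictToNonStrict.≤-<-trans _≈_ _<_ sym <-trans <-respˡ

  <⇒≱ : ∀ {x y} → x < y → ¬ (y ≤ x)
  <⇒≱ x<y y≤x = <-irrefl refl (<-≤-trans x<y y≤x)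

  <⇒≉ : ∀ {x y} → x < y → ¬ (x ≈ y)
  <⇒≉ x<y x≈y = <-irrefl x≈y x<y

  >⇒≉ : ∀ {x y} → y < x → ¬ (x ≈ y)
  >⇒≉ y<x x≈y = <-irrefl (sym x≈y) y<x

  ≮⇒≥ : ∀ {x y} → ¬ (x < y) → y ≤ x
  ≮⇒≥ {x} {y} x≮y with compare x y
  ... | tri< x<y _ _ = contradiction x<y x≮y
  ... | tri≈ _ x≈y _ = inj₂ (sym x≈y)
  ... | tri> _ _ y<x = inj₁ y<x

  <-or-≥ : ∀ x y → x < y ⊎ y ≤ x
  <-or-≥ x y with compare x y
  ... | tri< x<y _ _ = inj₁ x<y
  ... | tri≈ _ x≈y _ = inj₂ (inj₂ (sym x≈y))
  ... | tri> _ _ y<x = inj₂ (inj₁ y<x)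

  diff< : ∀ {x y} → x < y → 0# < y - x
  diff< {x} {y} x<y = <-respˡ (-‿inverseʳ x) (+-mono-< (- x) x<y)

  diff≈ : ∀ {x y} → x ≈ y → 0# ≤ y - x
  diff≈ {x} {y} x≈y = inj₂ (sym (trans (+-congˡ (-‿cong x≈y)) (-‿inverseʳ y)))

  diff≤ : ∀ {x y} → x ≤ y → 0# ≤ y - x
  diff≤ (inj₁ x<y) = inj₁ (diff< x<y)
  diff≤ (inj₂ x≈y) = diff≈ x≈y

  -- Inequalities are proved by certificates: y - x is exhibited as a sum of terms known to be
  -- positive, and the ring solver checks the identity.
  <-by : ∀ {x y e} → 0# < e → y - x ≈ e → x < y
  <-by {x} {y} 0<e eq = <-respʳ (solve 2 (λ y x → y :- x :+ x := y) refl y x)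
    (<-respˡ (+-identityˡ x) (+-mono-< x (<-respʳ (sym eq) 0<e)))

  ≤-by : ∀ {x y e} → 0# ≤ e → y - x ≈ e → x ≤ y
  ≤-by (inj₁ 0<e) eq = inj₁ (<-by 0<e eq)
  ≤-by {x} {y} (inj₂ 0≈e) eq = inj₂ (trans (sym (+-identityˡ x))
    (trans (+-congʳ (trans 0≈e (sym eq))) (solve 2 (λ y x → y :- x :+ x := y) refl y x)))

  -- Associating to the left, a certificate of a strict inequality puts one strictly positive term
  -- first and joins nonnegative ones to it.
  _⊕_ : ∀ {x y} → 0# < x → 0# ≤ y → 0# < x + y
  _⊕_ {x} {y} 0<x (inj₁ 0<y) = <-trans 0<y (<-respˡ (+-identityˡ y) (+-mono-< y 0<x))
  _⊕_ {x} {y} 0<x (inj₂ 0≈y) = <-respʳ (trans (sym (+-identityʳ x)) (+-congˡ 0≈y)) 0<x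

  _⊞_ : ∀ {x y} → 0# ≤ x → 0# ≤ y → 0# ≤ x + y
  inj₁ 0<x ⊞ 0≤y = inj₁ (0<x ⊕ 0≤y)
  _⊞_ {x} {y} (inj₂ 0≈x) 0≤y = ≤-respʳ (trans (sym (+-identityˡ y)) (+-congʳ 0≈x)) 0≤y

  *-nonneg : ∀ {x y} → 0# ≤ x → 0# ≤ y → 0# ≤ x * y
  *-nonneg (inj₁ 0<x) (inj₁ 0<y) = inj₁ (*-pos 0<x 0<y)
  *-nonneg {x} {y} (inj₂ 0≈x) _  = inj₂ (trans (sym (zeroˡ y)) (*-congʳ 0≈x))
  *-nonneg {x} {y} (inj₁ _) (inj₂ 0≈y) = inj₂ (trans (sym (zeroʳ x)) (*-congˡ 0≈y))

  0<⌜suc⌝ : ∀ n → 0# < ⌜ suc n ⌝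
  0<⌜suc⌝ zero    = 0<1
  0<⌜suc⌝ (suc n) = 0<⌜suc⌝ n ⊕ weaken 0<1

  scale< : ∀ n {x} → 0# < x → 0# < ⌜ suc n ⌝ * x
  scale< n = *-pos (0<⌜suc⌝ n)

  scale≤ : ∀ n {x} → 0# ≤ x → 0# ≤ ⌜ suc n ⌝ * x
  scale≤ n = *-nonneg (weaken (0<⌜suc⌝ n))

  sign-cases : ∀ x → x < 0# ⊎ x ≈ 0# ⊎ 0# < x
  sign-cases x with compare x 0#
  ... | tri< x<0 _ _ = inj₁ x<0
  ... | tri≈ _ x≈0 _ = inj₂ (inj₁ x≈0)
  ... | tri> _ _ 0<x = inj₂ (inj₂ 0<x)

  pos-factor : ∀ {x y} → 0# < x → 0# < x * y → 0# < y
  pos-factor {x} {y} 0<x 0<xy with <-or-≥ 0# y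
  ... | inj₁ 0<y = 0<y
  ... | inj₂ y≤0 = contradiction
    (≤-by (*-nonneg (weaken 0<x) (diff≤ y≤0))
    (solve 2 (λ x y → num 0 :- x :* y := x :* (num 0 :- y)) refl x y)) (<⇒≱ 0<xy)

  nonneg-factor : ∀ {x y} → 0# < x → 0# ≤ x * y → 0# ≤ y
  nonneg-factor {x} {y} 0<x 0≤xy with <-or-≥ y 0#
  ... | inj₂ 0≤y = 0≤y
  ... | inj₁ y<0 = contradiction 0≤xy
    (<⇒≱ (<-by (*-pos 0<x (diff< y<0))
    (solve 2 (λ x y → num 0 :- x :* y := x :* (num 0 :- y)) refl x y)))

  -- Certificates that would need fractions are stated for the multiple by `suc n`, which keeps all
  -- their coefficients integral.
  <-by/ : ∀ n {x y e} → 0# < e → ⌜ suc n ⌝ * (y - x) ≈ e → x < y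
  <-by/ n 0<e eq = <-by (pos-factor (0<⌜suc⌝ n) (<-respʳ (sym eq) 0<e)) refl

  ≤-by/ : ∀ n {x y e} → 0# ≤ e → ⌜ suc n ⌝ * (y - x) ≈ e → x ≤ y
  ≤-by/ n 0≤e eq = ≤-by (nonneg-factor (0<⌜suc⌝ n) (≤-respʳ (sym eq) 0≤e)) refl

  ≈-diff : ∀ {x y} → x - y ≈ 0# → x ≈ y
  ≈-diff {x} {y} x-y≈0 = trans (solve 2 (λ x y → x := x :- y :+ y) refl x y)
    (trans (+-congʳ x-y≈0) (+-identityˡ y))

  *-cancel-0 : ∀ {x y} → ¬ (x ≈ 0#) → x * y ≈ 0# → y ≈ 0#
  *-cancel-0 {x} {y} x≉0 xy≈0 = trans (sym (*-identityˡ y)) (trans (*-congʳ (sym (inverseʳ x≉0)))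
    (trans (solve 3 (λ x a y → x :* a :* y := a :* (x :* y)) refl x (x ⁻¹) y)
      (trans (*-congˡ xy≈0) (zeroʳ _))))

  *-mono-≤ : ∀ {x y u v} → 0# ≤ x → 0# ≤ u → x ≤ y → u ≤ v → x * u ≤ y * v
  *-mono-≤ {x} {y} {u} {v} 0≤x 0≤u x≤y u≤v =
    (≤-by (*-nonneg (diff≤ x≤y) 0≤u ⊞ *-nonneg (≤-trans 0≤x x≤y) (diff≤ u≤v))
      (solve 4 (λ y v x u → y :* v :- x :* u := (y :- x) :* u :+ y :* (v :- u)) refl y v x u))

  *-monoˡ-≤ : ∀ {x y} z → 0# ≤ z → x ≤ y → z * x ≤ z * y
  *-monoˡ-≤ {x} {y} z 0≤z x≤y = ≤-by (*-nonneg 0≤z (diff≤ x≤y))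
    (solve 3 (λ z y x → z :* y :- z :* x := z :* (y :- x)) refl z y x)

  *-monoˡ-< : ∀ {x y} z → 0# < z → x < y → z * x < z * y
  *-monoˡ-< {x} {y} z 0<z x<y = <-by (*-pos 0<z (diff< x<y))
    (solve 3 (λ z y x → z :* y :- z :* x := z :* (y :- x)) refl z y x)

  -- Absolute values

  abs-nonneg : ∀ {x} → 0# ≤ x → ∣ x ∣ ≈ x
  abs-nonneg {x} 0≤x with compare x 0#
  ... | tri< x<0 _ _ = contradiction 0≤x (<⇒≱ x<0)
  ... | tri≈ _ _ _   = refl
  ... | tri> _ _ _   = refl

  abs-neg : ∀ {x} → x < 0# → ∣ x ∣ ≈ - x
  abs-neg {x} x<0 with compare x 0#
  ... | tri< _ _ _   = refl
  ... | tri≈ _ x≈0 _ = contradiction x≈0 (<⇒≉ x<0)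
  ... | tri> _ _ 0<x = contradiction (weaken 0<x) (<⇒≱ x<0)

  x≤∣x∣ : ∀ x → x ≤ ∣ x ∣
  x≤∣x∣ x with <-or-≥ x 0#
  ... | inj₁ x<0 = ≤-by (diff≈ (sym (abs-neg x<0)) ⊞ weaken (scale< 1 (diff< x<0)))
    (solve 2 (λ a x → a :- x := a :- :- x :+ num 2 :* (num 0 :- x)) refl (∣ x ∣) x)
  ... | inj₂ 0≤x = ≤-reflexive (sym (abs-nonneg 0≤x))

  -x≤∣x∣ : ∀ x → - x ≤ ∣ x ∣
  -x≤∣x∣ x with <-or-≥ x 0#
  ... | inj₁ x<0 = ≤-reflexive (sym (abs-neg x<0))
  ... | inj₂ 0≤x = ≤-by (diff≈ (sym (abs-nonneg 0≤x)) ⊞ scale≤ 1 (0≤x))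
    (solve 2 (λ a x → a :- :- x := a :- x :+ num 2 :* x) refl (∣ x ∣) x)

  ∣x∣≤ : ∀ {x b} → x ≤ b → - x ≤ b → ∣ x ∣ ≤ b
  ∣x∣≤ {x} x≤b -x≤b with <-or-≥ x 0#
  ... | inj₁ x<0 = ≤-respˡ (sym (abs-neg x<0)) -x≤b
  ... | inj₂ 0≤x = ≤-respˡ (sym (abs-nonneg 0≤x)) x≤b

  ∣x∣< : ∀ {x b} → x < b → - x < b → ∣ x ∣ < b
  ∣x∣< {x} x<b -x<b with <-or-≥ x 0#
  ... | inj₁ x<0 = <-respˡ (sym (abs-neg x<0)) -x<b
  ... | inj₂ 0≤x = <-respˡ (sym (abs-nonneg 0≤x)) x<b

  0≤∣x∣ : ∀ x → 0# ≤ ∣ x ∣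
  0≤∣x∣ x = ≤-by/ 1 (diff≤ (x≤∣x∣ x) ⊞ diff≤ (-x≤∣x∣ x))
    (solve 2 (λ a x → num 2 :* (a :- num 0) := a :- x :+ (a :- :- x)) refl (∣ x ∣) x)

  abs≤⇒≤ : ∀ {x b} → ∣ x ∣ ≤ b → x ≤ b
  abs≤⇒≤ {x} = ≤-trans (x≤∣x∣ x)

  abs≤⇒-≤ : ∀ {x b} → ∣ x ∣ ≤ b → - x ≤ b
  abs≤⇒-≤ {x} = ≤-trans (-x≤∣x∣ x)

  abs<⇒< : ∀ {x b} → ∣ x ∣ < b → x < b
  abs<⇒< {x} = ≤-<-trans (x≤∣x∣ x)

  abs<⇒-< : ∀ {x b} → ∣ x ∣ < b → - x < b
  abs<⇒-< {x} = ≤-<-trans (-x≤∣x∣ x)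

  abs-cong : ∀ {x y} → x ≈ y → ∣ x ∣ ≈ ∣ y ∣
  abs-cong {x} {y} x≈y = ≤-antisym
    (∣x∣≤ (≤-respˡ (sym x≈y) (x≤∣x∣ y)) (≤-respˡ (-‿cong (sym x≈y)) (-x≤∣x∣ y)))
    (∣x∣≤ (≤-respˡ x≈y (x≤∣x∣ x)) (≤-respˡ (-‿cong x≈y) (-x≤∣x∣ x)))

  abs-+-≤ : ∀ {x y a b} → ∣ x ∣ ≤ a → ∣ y ∣ ≤ b → ∣ x + y ∣ ≤ a + b
  abs-+-≤ {x} {y} {a} {b} p q = ∣x∣≤
    (≤-by (diff≤ (abs≤⇒≤ p) ⊞ diff≤ (abs≤⇒≤ q))
      (solve 4 (λ a b x y → a :+ b :- (x :+ y) := a :- x :+ (b :- y)) refl a b x y))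
    (≤-by (diff≤ (abs≤⇒-≤ p) ⊞ diff≤ (abs≤⇒-≤ q))
      (solve 4 (λ a b x y → a :+ b :- :- (x :+ y) := a :- :- x :+ (b :- :- y)) refl a b x y))

  abs-*-≤ : ∀ {x y a b} → ∣ x ∣ ≤ a → ∣ y ∣ ≤ b → ∣ x * y ∣ ≤ a * b
  abs-*-≤ {x} {y} {a} {b} p q = ∣x∣≤
    (≤-by/ 1 (*-nonneg a-x b+y ⊞ *-nonneg a+x b-y)
      (solve 4 (λ a b x y → num 2 :* (a :* b :- x :* y) := (a :- x) :* (b :- :- y) :+ (a :- :- x) :*
      (b :- y)) refl a b x y))
    (≤-by/ 1 (*-nonneg a-x b-y ⊞ *-nonneg a+x b+y)
      (solve 4 (λ a b x y → num 2 :* (a :* b :- :- (x :* y)) := (a :- x) :* (b :- y) :+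
      (a :- :- x) :* (b :- :- y)) refl a b x y))
    where
    a-x : 0# ≤ a - x
    a-x = diff≤ (abs≤⇒≤ p)
    a+x : 0# ≤ a - - x
    a+x = diff≤ (abs≤⇒-≤ p)
    b-y : 0# ≤ b - y
    b-y = diff≤ (abs≤⇒≤ q)
    b+y : 0# ≤ b - - y
    b+y = diff≤ (abs≤⇒-≤ q)

  abs-swap : ∀ x y → ∣ x - y ∣ ≈ ∣ y - x ∣
  abs-swap x y = ≤-antisym (half x y) (half y x)
    where
    half : ∀ x y → ∣ x - y ∣ ≤ ∣ y - x ∣
    half x y = ∣x∣≤ (≤-by (diff≤ (-x≤∣x∣ (y - x)))
      (solve 3 (λ a x y → a :- (x :- y) := a :- :- (y :- x)) refl (∣ y - x ∣) x y))
                    (≤-by (diff≤ (x≤∣x∣ (y - x))) (solve 3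
                      (λ a x y → a :- :- (x :- y) := a :- (y :- x)) refl (∣ y - x ∣) x y))

  ⁻¹-pos : ∀ {x} → 0# < x → 0# < x ⁻¹
  ⁻¹-pos {x} 0<x = pos-factor 0<x (<-respʳ (sym (inverseʳ (>⇒≉ 0<x))) 0<1)

  _/_ : ℝ → ℝ → ℝ
  x / y = x * y ⁻¹

  /-pos : ∀ {x y} → 0# < x → 0# < y → 0# < x / y
  /-pos 0<x 0<y = *-pos 0<x (⁻¹-pos 0<y)

  *-/-cancel : ∀ {x y} → 0# < y → y * (x / y) ≈ x
  *-/-cancel {x} {y} 0<y = trans
    (solve 3 (λ y x a → y :* (x :* a) := x :* (y :* a)) refl y x (y ⁻¹))
    (trans (*-congˡ (inverseʳ (>⇒≉ 0<y))) (*-identityʳ x))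

  fromℕ≈⌜⌝ : ∀ n → fromℕ n ≈ ⌜ n ⌝
  fromℕ≈⌜⌝ n = MultTC.×ᵤ≈× n 1#

  fromℤ≈⟦⟧ : ∀ z → fromℤ z ≈ ⟦ z ⟧ℤ
  fromℤ≈⟦⟧ (+ n)    = fromℕ≈⌜⌝ n
  fromℤ≈⟦⟧ -[1+ n ] = -‿cong (fromℕ≈⌜⌝ (suc n))

  fromℕ-+ : ∀ m n → fromℕ (m ℕ.+ n) ≈ fromℕ m + fromℕ n
  fromℕ-+ = Mult.×-homo-+ 1#

  fromℕ-* : ∀ m n → fromℕ (m ℕ.* n) ≈ fromℕ m * fromℕ n
  fromℕ-* = Mult.×1-homo-*

  fromℕ-^ : ∀ m n → fromℕ (m ℕ.^ n) ≈ fromℕ m ^ n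
  fromℕ-^ m zero    = +-identityʳ 1#
  fromℕ-^ m (suc n) = trans (fromℕ-* m (m ℕ.^ n)) (*-congˡ (fromℕ-^ m n))

  0≤fromℕ : ∀ n → 0# ≤ fromℕ n
  0≤fromℕ zero    = ≤-refl
  0≤fromℕ (suc n) = weaken 0<1 ⊞ 0≤fromℕ n

  fromℕ-mono-≤ : ∀ {m n} → m ℕ.≤ n → fromℕ m ≤ fromℕ n
  fromℕ-mono-≤ {n = n} z≤n = 0≤fromℕ n
  fromℕ-mono-≤ (s≤s {m} {n} m≤n) =
    ≤-by (diff≤ (fromℕ-mono-≤ m≤n))
    (solve 2 (λ a b → num 1 :+ a :- (num 1 :+ b) := a :- b) refl (fromℕ n) (fromℕ m))

  fromℕ-mono-< : ∀ {m n} → m ℕ.< n → fromℕ m < fromℕ n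
  fromℕ-mono-< {m} {n} m<n = <-by (0<1 ⊕ diff≤ (fromℕ-mono-≤ m<n))
    (solve 2 (λ a b → a :- b := num 1 :+ (a :- (num 1 :+ b))) refl (fromℕ n) (fromℕ m))

  fromℕ-cancel-≤ : ∀ {m n} → fromℕ m ≤ fromℕ n → m ℕ.≤ n
  fromℕ-cancel-≤ {m} {n} le with m ℕ.≤? n
  ... | yes m≤n = m≤n
  ... | no  m≰n = contradiction le (<⇒≱ (fromℕ-mono-< (ℕ.≰⇒> m≰n)))

  fromℕ-cancel-< : ∀ {m n} → fromℕ m < fromℕ n → m ℕ.< n
  fromℕ-cancel-< {m} {n} lt with m ℕ.<? n
  ... | yes m<n = m<n
  ... | no  m≮n = contradiction (fromℕ-mono-≤ (ℕ.≮⇒≥ m≮n)) (<⇒≱ lt)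

  fromℤ-+ : ∀ a b → fromℤ (a ℤ.+ b) ≈ fromℤ a + fromℤ b
  fromℤ-+ a b = trans (fromℤ≈⟦⟧ (a ℤ.+ b))
    (trans (⟦+⟧ a b) (sym (+-cong (fromℤ≈⟦⟧ a) (fromℤ≈⟦⟧ b))))

  fromℤ-* : ∀ a b → fromℤ (a ℤ.* b) ≈ fromℤ a * fromℤ b
  fromℤ-* a b = trans (fromℤ≈⟦⟧ (a ℤ.* b))
    (trans (⟦*⟧ a b) (sym (*-cong (fromℤ≈⟦⟧ a) (fromℤ≈⟦⟧ b))))

  fromℤ-neg : ∀ a → fromℤ (ℤ.- a) ≈ - fromℤ a
  fromℤ-neg a = trans (fromℤ≈⟦⟧ (ℤ.- a)) (trans (⟦-⟧ a) (sym (-‿cong (fromℤ≈⟦⟧ a))))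

  fromℤ-sub : ∀ a b → fromℤ (a ℤ.- b) ≈ fromℤ a - fromℤ b
  fromℤ-sub a b = trans (fromℤ-+ a (ℤ.- b)) (+-congˡ (fromℤ-neg b))

  fromℤ-abs≤ : ∀ z {m} → ℤ.∣ z ∣ ℕ.≤ m → ∣ fromℤ z ∣ ≤ fromℕ m
  fromℤ-abs≤ (+ n) {m} n≤m = ∣x∣≤ (fromℕ-mono-≤ n≤m)
    (≤-by (0≤fromℕ n ⊞ 0≤fromℕ m) (solve 2 (λ a b → a :- :- b := b :+ a) refl (fromℕ m) (fromℕ n)))
  fromℤ-abs≤ -[1+ n ] {m} n≤m = ∣x∣≤
    (≤-by (0≤fromℕ (suc n) ⊞ 0≤fromℕ m)
      (solve 2 (λ a b → a :- :- b := b :+ a) refl (fromℕ m) (fromℕ (suc n))))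
    (≤-by (diff≤ (fromℕ-mono-≤ n≤m))
      (solve 2 (λ a b → a :- :- (:- b) := a :- b) refl (fromℕ m) (fromℕ (suc n))))

  fromℤ-abs : ∀ z → fromℕ ℤ.∣ z ∣ ≤ ∣ fromℤ z ∣
  fromℤ-abs (+ n)    = x≤∣x∣ (fromℕ n)
  fromℤ-abs -[1+ n ] = ≤-by (diff≤ (-x≤∣x∣ (- fromℕ (suc n))))
    (solve 2 (λ a b → a :- b := a :- :- (:- b)) refl (∣ - fromℕ (suc n) ∣) (fromℕ (suc n)))

  fromℤ-cancel-0 : ∀ z → fromℤ z ≈ 0# → z ≡ + 0
  fromℤ-cancel-0 (+ zero)  _  = ≡.refl
  fromℤ-cancel-0 (+ suc n) eq = contradiction eq (>⇒≉ (0<1 ⊕ 0≤fromℕ n))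
  fromℤ-cancel-0 -[1+ n ]  eq = contradiction eq
    (<⇒≉ (<-by (0<1 ⊕ 0≤fromℕ n) (solve 1 (λ a → num 0 :- :- a := a) refl (fromℕ (suc n)))))

  -- Archimedean property and integer parts


  sup-approx : ∀ {S : Pred ℝ 0ℓ} {s b} → IsSupremum _≤_ S s → b < s → ∃[ x ] S x × b < x
  sup-approx {S} {s} {b} isSup b<s with em {∃[ x ] S x × b < x}
  ... | yes found = found
  ... | no  none  = contradiction
    (IsSupremum.least isSup b (λ {x} Sx → ≮⇒≥ λ b<x → none (x , Sx , b<x))) (<⇒≱ b<s)

  opaque
    archimedean : ∀ x → ∃[ n ] x < fromℕ n
    archimedean x with em {∃[ n ] x < fromℕ n}
    ... | yes found = found
    ... | no  none  = fromSupremum (complete IsNatural (0# , 0 , refl)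
        (x , λ { (n , y≈n) → ≮⇒≥ λ x<y → none (n , <-respʳ y≈n x<y) }))
      where
      IsNatural : Pred ℝ 0ℓ
      IsNatural y = ∃[ n ] y ≈ fromℕ n
      fromSupremum : ∃ (IsSupremum _≤_ IsNatural) → ∃[ n ] x < fromℕ n
      fromSupremum (s , isSup) = fromElement
        (sup-approx isSup (<-by 0<1 (solve 1 (λ s → s :- (s :- num 1) := num 1) refl s)))
        where
        fromElement : ∃[ y ] IsNatural y × s - 1# < y → ∃[ n ] x < fromℕ n
        fromElement (y , (n , y≈n) , s-1<y) =
          contradiction (IsSupremum.upperBound isSup (suc n , refl))
          (<⇒≱ (<-by (diff< s-1<y ⊕ diff≈ y≈n)
            (solve 3 (λ a s y → num 1 :+ a :- s := y :- (s :- num 1) :+ (a :- y)) refl (fromℕ n) s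
            y)))

  opaque
    ⌊_⌋ℕ : ∀ {x} → 0# ≤ x → ∃[ n ] fromℕ n ≤ x × x < fromℕ (suc n)
    ⌊_⌋ℕ {x} 0≤x = search (proj₁ (archimedean x)) (proj₂ (archimedean x))
      where
      search : ∀ n → x < fromℕ n → ∃[ n ] fromℕ n ≤ x × x < fromℕ (suc n)
      search zero    x<0 = contradiction 0≤x (<⇒≱ x<0)
      search (suc n) x<1+n with <-or-≥ x (fromℕ n)
      ... | inj₁ x<n = search n x<n
      ... | inj₂ n≤x = n , n≤x , x<1+n

  opaque
    integerPart : ∀ x → ∃[ z ] fromℤ z ≤ x × x < fromℤ z + 1#
    integerPart x = shift (archimedean (- x))
      where
      shift : ∃[ N ] - x < fromℕ N → ∃[ z ] fromℤ z ≤ x × x < fromℤ z + 1#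
      shift (N , -x<N) = unshift (⌊_⌋ℕ {x + fromℕ N}
        (≤-by (weaken (diff< -x<N)) (solve 2 (λ x a → x :+ a :- num 0 := a :- :- x) refl x
        (fromℕ N))))
        where
        unshift : ∃[ n ] fromℕ n ≤ x + fromℕ N × x + fromℕ N < fromℕ (suc n) → ∃[ z ] fromℤ z ≤ x ×
          x < fromℤ z + 1#
        unshift (n , n≤ , <1+n) = + n ℤ.- + N ,
          (≤-by (diff≈ (fromℤ-sub (+ n) (+ N)) ⊞ diff≤ n≤)
            (solve 4 (λ x a b c → x :- a := b :- c :- a :+ (x :+ c :- b)) refl x
            (fromℤ (+ n ℤ.- + N)) (fromℕ n) (fromℕ N))) ,
          (<-by (diff< <1+n ⊕ diff≈ (sym (fromℤ-sub (+ n) (+ N))))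
            (solve 4 (λ a x b c → a :+ num 1 :- x := num 1 :+ b :- (x :+ c) :+ (a :- (b :- c)))
            refl (fromℤ (+ n ℤ.- + N)) x (fromℕ n) (fromℕ N)))

  -- Natural powers

  ^-pos : ∀ {x} n → 0# < x → 0# < x ^ n
  ^-pos zero    0<x = 0<1
  ^-pos (suc n) 0<x = *-pos 0<x (^-pos n 0<x)

  ^-nonneg : ∀ {x} n → 0# ≤ x → 0# ≤ x ^ n
  ^-nonneg zero    0≤x = weaken 0<1
  ^-nonneg (suc n) 0≤x = *-nonneg 0≤x (^-nonneg n 0≤x)

  ^-mono-≤ : ∀ {x y} n → 0# ≤ x → x ≤ y → x ^ n ≤ y ^ n
  ^-mono-≤ zero    0≤x x≤y = ≤-refl
  ^-mono-≤ (suc n) 0≤x x≤y = *-mono-≤ 0≤x (^-nonneg n 0≤x) x≤y (^-mono-≤ n 0≤x x≤y)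

  ^-mono-< : ∀ {x y} n → 0# ≤ x → x < y → x ^ suc n < y ^ suc n
  ^-mono-< {x} {y} n 0≤x x<y = <-by
    (*-pos (diff< x<y) (^-pos n (≤-<-trans 0≤x x<y)) ⊕ *-nonneg 0≤x
    (diff≤ (^-mono-≤ n 0≤x (weaken x<y))))
    (solve 4 (λ y a x b → y :* a :- x :* b := (y :- x) :* a :+ x :* (a :- b)) refl y (y ^ n) x
    (x ^ n))

  ^-cancel-≤ : ∀ {x y} n → 0# ≤ y → x ^ suc n ≤ y ^ suc n → x ≤ y
  ^-cancel-≤ {x} {y} n 0≤y le with <-or-≥ y x
  ... | inj₁ y<x = contradiction le (<⇒≱ (^-mono-< n 0≤y y<x))
  ... | inj₂ x≤y = x≤y

  1≤^ : ∀ {x} n → 1# ≤ x → 1# ≤ x ^ n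
  1≤^ zero    1≤x = ≤-refl
  1≤^ {x} (suc n) 1≤x = ≤-respˡ (*-identityˡ 1#)
    (*-mono-≤ (weaken 0<1) (weaken 0<1) 1≤x (1≤^ n 1≤x))

  ^-monoʳ-≤ : ∀ {x m n} → 1# ≤ x → m ℕ.≤ n → x ^ m ≤ x ^ n
  ^-monoʳ-≤ {n = n} 1≤x z≤n = 1≤^ n 1≤x
  ^-monoʳ-≤ 1≤x (s≤s m≤n) = *-monoˡ-≤ _ (≤-trans (weaken 0<1) 1≤x) (^-monoʳ-≤ 1≤x m≤n)

  -- Induction along an interval, and intermediate values

  opaque
    -- At the supremum s of the points of [x , y] where `P` holds, some such point t lies within δ
    -- below s, and the hypothesis carries `P` across s: either to y itself, or to s + δ/2, which is
    -- beyond the supremum. Nothing is asked of `P` at s, so open conditions are admissible.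
    realInduction : ∀ {x y} (P : Pred ℝ 0ℓ) → x ≤ y → P x →
      (∀ s → x ≤ s → s ≤ y → ∃[ δ ] 0# < δ ×
        (∀ t u → x ≤ t → t ≤ s → s ≤ u → u ≤ y → s < t + δ → u < s + δ → P t → P u)) →
      P y
    realInduction {x} {y} P x≤y Px step
      with complete S (x , ≤-refl , x≤y , Px) (y , λ (_ , s≤y , _) → s≤y)
      where
      S : Pred ℝ 0ℓ
      S s = x ≤ s × s ≤ y × P s
    ... | s , isSup = conclude (step s x≤s (IsSupremum.least isSup y λ (_ , s≤y , _) → s≤y))
      where
      x≤s : x ≤ s
      x≤s = IsSupremum.upperBound isSup (≤-refl , x≤y , Px)
      conclude : ∃[ δ ] 0# < δ × (∀ t u → x ≤ t → t ≤ s → s ≤ u → u ≤ y → s < t + δ → u < s + δ →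
        P t → P u) → P y
      conclude (δ , 0<δ , local)
        with sup-approx isSup (<-by 0<δ (solve 2 (λ s δ → s :- (s :- δ) := δ) refl s δ)) | <-or-≥ y
          (s + δ)
      ... | t , t∈S@(x≤t , t≤y , Pt) , s-δ<t | inj₁ y<s+δ =
        local t y x≤t (IsSupremum.upperBound isSup t∈S)
          (IsSupremum.least isSup y λ (_ , s≤y , _) → s≤y) ≤-refl
          (<-by (diff< s-δ<t) (solve 3 (λ t δ s → t :+ δ :- s := t :- (s :- δ)) refl t δ s)) y<s+δ
            Pt
      ... | t , t∈S@(x≤t , t≤y , Pt) , s-δ<t | inj₂ s+δ≤y =
        contradiction (IsSupremum.upperBound isSup (x≤u , u≤y ,
          local t u x≤t (IsSupremum.upperBound isSup t∈S) (weaken s<u) u≤y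
            (<-by (diff< s-δ<t) (solve 3 (λ t δ s → t :+ δ :- s := t :- (s :- δ)) refl t δ s))
            (<-by/ 1 (0<δ ⊕ diff≈ 2h ⊕ scale≤ 1 (diff≈ refl))
              (solve 4 (λ s δ a b → num 2 :* (s :+ δ :- a) := δ :+ (δ :- num 2 :* b) :+ num 2 :*
              (s :+ b :- a)) refl s δ (s + δ / 2#) (δ / 2#))) Pt)) (<⇒≱ s<u)
        where
        u : ℝ
        u = s + δ / 2#
        0<2 : 0# < 2#
        0<2 = 0<⌜suc⌝ 1
        2h : 2# * (δ / 2#) ≈ δ
        2h = *-/-cancel 0<2
        s<u : s < u
        s<u = <-by (/-pos 0<δ 0<2) (solve 2 (λ s a → s :+ a :- s := a) refl s (δ / 2#))
        x≤u : x ≤ u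
        x≤u = ≤-trans x≤s (weaken s<u)
        u≤y : u ≤ y
        u≤y = ≤-by/ 1 (diff≈ 2h ⊞ weaken 0<δ ⊞ scale≤ 1 (diff≤ s+δ≤y))
          (solve 4 (λ y s a δ → num 2 :* (y :- (s :+ a)) := δ :- num 2 :* a :+ δ :+ num 2 :*
          (y :- (s :+ δ))) refl y s (δ / 2#) δ)

  opaque
    -- Without a zero, the Lipschitz bound forbids a change of sign within |f s| / C of any s, so by
    -- `realInduction` negativity would spread from x to y.
    intermediateValue : ∀ {x y} (f : ℝ → ℝ) → x ≤ y → (C : ℝ) → 0# < C →
      (∀ s t → x ≤ s → s ≤ y → x ≤ t → t ≤ y → ∣ f s - f t ∣ ≤ C * ∣ s - t ∣) →
      f x < 0# → 0# < f y → ∃[ z ] x ≤ z × z ≤ y × f z ≈ 0#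
    intermediateValue {x} {y} f x≤y C 0<C lipschitz fx<0 0<fy
      with em {∃[ z ] x ≤ z × z ≤ y × f z ≈ 0#}
    ... | yes found = found
    ... | no  none  = contradiction (weaken 0<fy)
      (<⇒≱ (realInduction (λ s → f s < 0#) x≤y fx<0 step))
      where
      step : ∀ s → x ≤ s → s ≤ y → ∃[ δ ] 0# < δ ×
        (∀ t u → x ≤ t → t ≤ s → s ≤ u → u ≤ y → s < t + δ → u < s + δ → f t < 0# → f u < 0#)
      step s x≤s s≤y = δ , /-pos 0<∣fs∣ 0<C , local
        where
        0<∣fs∣ : 0# < ∣ f s ∣
        0<∣fs∣ with compare (f s) 0#
        ... | tri< fs<0 _ _ = <-by (diff< fs<0)
          (solve 1 (λ a → :- a :- num 0 := num 0 :- a) refl (f s))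
        ... | tri≈ _ fs≈0 _ = contradiction (s , x≤s , s≤y , fs≈0) none
        ... | tri> _ _ 0<fs = 0<fs
        δ : ℝ
        δ = ∣ f s ∣ / C
        near : ∀ t → x ≤ t → t ≤ y → ∣ s - t ∣ < δ → ∣ f s - f t ∣ < ∣ f s ∣
        near t x≤t t≤y close = ≤-<-trans (lipschitz s t x≤s s≤y x≤t t≤y)
          (<-respʳ (*-/-cancel 0<C) (*-monoˡ-< C 0<C close))
        local : ∀ t u → x ≤ t → t ≤ s → s ≤ u → u ≤ y → s < t + δ → u < s + δ → f t < 0# → f u < 0#
        local t u x≤t t≤s s≤u u≤y s<t+δ u<s+δ ft<0 with sign-cases (f s)
        ... | inj₂ (inj₁ fs≈0) = contradiction (s , x≤s , s≤y , fs≈0) none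
        ... | inj₁ fs<0 = <-by (diff< (abs<⇒-< nearu))
          (solve 2 (λ a b → num 0 :- a := :- b :- :- (b :- a)) refl (f u) (f s))
          where
          nearu : ∣ f s - f u ∣ < - f s
          nearu = <-respʳ (abs-neg fs<0) (near u (≤-trans x≤s s≤u) u≤y (∣x∣<
            (<-by (/-pos 0<∣fs∣ 0<C ⊕ diff≤ s≤u)
              (solve 3 (λ δ s u → δ :- (s :- u) := δ :+ (u :- s)) refl δ s u))
              (<-by (diff< u<s+δ) (solve 3 (λ δ s u → δ :- :- (s :- u) := s :+ δ :- u) refl δ s
              u))))
        ... | inj₂ (inj₂ 0<fs) = contradiction (weaken ft<0)
          (<⇒≱ (<-by (diff< (abs<⇒< neart))
          (solve 2 (λ a b → a :- num 0 := b :- (b :- a)) refl (f t) (f s))))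
          where
          neart : ∣ f s - f t ∣ < f s
          neart = <-respʳ (abs-nonneg (weaken 0<fs)) (near t x≤t (≤-trans t≤s s≤y) (∣x∣<
            (<-by (diff< s<t+δ) (solve 3 (λ δ s t → δ :- (s :- t) := t :+ δ :- s) refl δ s t))
              (<-by (/-pos 0<∣fs∣ 0<C ⊕ diff≤ t≤s)
              (solve 3 (λ δ s t → δ :- :- (s :- t) := δ :+ (s :- t)) refl δ s t))))

  -- Divided differences of real polynomials

  evalʳ : List ℝ → ℝ → ℝ
  evalʳ p x = List.foldr (λ a v → a + x * v) 0# p

  eval≡evalʳ : ∀ P x → eval P x ≡ evalʳ (List.map fromℤ P) x
  eval≡evalʳ []      x = ≡.refl
  eval≡evalʳ (a ∷ P) x = cong (λ v → fromℤ a + x * v) (eval≡evalʳ P x)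

  -- Divided differences by Horner recursion: `Δ p x t` is (p(t) - p(x)) / (t - x), and `Δ²` is the
  -- second divided difference. As polynomials they involve no division and stay meaningful when
  -- arguments coincide.
  Δ : List ℝ → ℝ → ℝ → ℝ
  Δ []      x t = 0#
  Δ (a ∷ p) x t = evalʳ p t + x * Δ p x t

  Δ² : List ℝ → ℝ → ℝ → ℝ → ℝ
  Δ² []      x y t = 0#
  Δ² (a ∷ p) x y t = Δ p y t + x * Δ² p x y t

  Δ-spec : ∀ p x t → evalʳ p t ≈ evalʳ p x + (t - x) * Δ p x t
  Δ-spec []      x t = solve 2 (λ t x → num 0 := num 0 :+ (t :- x) :* num 0) refl t x
  Δ-spec (a ∷ p) x t = trans
    (+-congˡ (trans (solve 3 (λ t a x → t :* a := (t :- x) :* a :+ x :* a) refl t (evalʳ p t) x)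
      (+-congˡ (*-congˡ (Δ-spec p x t)))))
    (solve 6 (λ a t x b c d → a :+ ((t :- x) :* b :+ x :* (c :+ (t :- x) :* d)) := a :+ x :* c :+
      (t :- x) :* (b :+ x :* d)) refl a t x (evalʳ p t) (evalʳ p x) (Δ p x t))

  Δ²-spec : ∀ p x y t → Δ p x t ≈ Δ p x y + (t - y) * Δ² p x y t
  Δ²-spec []      x y t = solve 2 (λ t y → num 0 := num 0 :+ (t :- y) :* num 0) refl t y
  Δ²-spec (a ∷ p) x y t = trans (+-cong (Δ-spec p y t) (*-congˡ (Δ²-spec p x y t)))
    (solve 7 (λ a t y b x c d → a :+ (t :- y) :* b :+ x :* (c :+ (t :- y) :* d) := a :+ x :* c :+
      (t :- y) :* (b :+ x :* d)) refl (evalʳ p y) t y (Δ p y t) x (Δ p x y) (Δ² p x y t))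

  Δ-sym : ∀ p x t → Δ p x t ≈ Δ p t x
  Δ-sym []      x t = refl
  Δ-sym (a ∷ p) x t = trans (+-cong (Δ-spec p x t) (*-congˡ (Δ-sym p x t)))
    (trans (+-congʳ (+-congˡ (*-congˡ (Δ-sym p x t))))
    (solve 4 (λ a t x b → a :+ (t :- x) :* b :+ x :* b := a :+ t :* b) refl (evalʳ p x) t x
      (Δ p t x)))

  module Bounds {M : ℝ} (0≤M : 0# ≤ M) where

    -- For polynomials with l coefficients bounded by H and arguments bounded by M, `H * B l` bounds
    -- values and both divided differences. A Horner step for values adds H, one for differences
    -- adds the previous bound; the summands 1 and `B l` allow for either.
    B : ℕ → ℝ
    B zero    = 1#
    B (suc l) = 1# + B l + M * B l

    1≤B : ∀ l → 1# ≤ B l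
    0≤B : ∀ l → 0# ≤ B l
    0≤B l = ≤-trans (weaken 0<1) (1≤B l)
    1≤B zero    = ≤-refl
    1≤B (suc l) = ≤-by (0≤B l ⊞ *-nonneg 0≤M (0≤B l))
      (solve 2 (λ a M → num 1 :+ a :+ M :* a :- num 1 := a :+ M :* a) refl (B l) M)

    module _ {H : ℝ} (0≤H : 0# ≤ H) where

      BoundedBy : Pred (List ℝ) 0ℓ
      BoundedBy = All (λ a → ∣ a ∣ ≤ H)

      horner-bound : ∀ l {a x v} → ∣ a ∣ ≤ H * B l ⊎ ∣ a ∣ ≤ H → ∣ x ∣ ≤ M → ∣ v ∣ ≤ H * B l →
        ∣ a + x * v ∣ ≤ H * B (suc l)
      horner-bound l {a} {x} {v} a≤ x≤M v≤ = ≤-trans (abs-+-≤ (bound a≤) (abs-*-≤ x≤M v≤))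
        (≤-by ≤-refl (solve 3 (λ H a M →
          H :* (num 1 :+ a :+ M :* a) :- (H :+ H :* a :+ M :* (H :* a)) := num 0) refl H (B l) M))
        where
        bound : ∣ a ∣ ≤ H * B l ⊎ ∣ a ∣ ≤ H → ∣ a ∣ ≤ H + H * B l
        bound (inj₁ le) = ≤-by (diff≤ le ⊞ 0≤H)
          (solve 3 (λ H a b → H :+ H :* a :- b := H :* a :- b :+ H) refl H (B l) (∣ a ∣))
        bound (inj₂ le) = ≤-by (diff≤ le ⊞ *-nonneg 0≤H (0≤B l))
          (solve 3 (λ H a b → H :+ H :* a :- b := H :- b :+ H :* a) refl H (B l) (∣ a ∣))

      zero-bound : ∣ 0# ∣ ≤ H * B 0
      zero-bound = ≤-respˡ (sym (abs-nonneg ≤-refl))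
        (≤-by 0≤H (solve 1 (λ H → H :* num 1 :- num 0 := H) refl H))

      evalʳ-bound : ∀ {p x} → BoundedBy p → ∣ x ∣ ≤ M → ∣ evalʳ p x ∣ ≤ H * B (List.length p)
      evalʳ-bound []        x≤M = zero-bound
      evalʳ-bound {a ∷ p} (a≤ ∷ p≤) x≤M =
        horner-bound (List.length p) (inj₂ a≤) x≤M (evalʳ-bound p≤ x≤M)

      Δ-bound : ∀ {p x t} → BoundedBy p → ∣ x ∣ ≤ M → ∣ t ∣ ≤ M →
        ∣ Δ p x t ∣ ≤ H * B (List.length p)
      Δ-bound []       x≤M t≤M = zero-bound
      Δ-bound {_ ∷ p} (_ ∷ p≤) x≤M t≤M =
        horner-bound (List.length p) (inj₁ (evalʳ-bound p≤ t≤M)) x≤M (Δ-bound p≤ x≤M t≤M)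

      Δ²-bound : ∀ {p x y t} → BoundedBy p → ∣ x ∣ ≤ M → ∣ y ∣ ≤ M → ∣ t ∣ ≤ M →
        ∣ Δ² p x y t ∣ ≤ H * B (List.length p)
      Δ²-bound []       x≤M y≤M t≤M = zero-bound
      Δ²-bound {_ ∷ p} (_ ∷ p≤) x≤M y≤M t≤M =
        horner-bound (List.length p) (inj₁ (Δ-bound p≤ y≤M t≤M)) x≤M (Δ²-bound p≤ x≤M y≤M t≤M)

      evalʳ-lipschitz : ∀ {p x y d} → BoundedBy p → ∣ x ∣ ≤ M → ∣ y ∣ ≤ M → ∣ x - y ∣ ≤ d →
        ∣ evalʳ p x - evalʳ p y ∣ ≤ d * (H * B (List.length p))
      evalʳ-lipschitz {p} {x} {y} p≤ x≤M y≤M x-y≤d =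
        ≤-respˡ (abs-cong eq) (abs-*-≤ x-y≤d (Δ-bound p≤ y≤M x≤M))
        where
        eq : (x - y) * Δ p y x ≈ evalʳ p x - evalʳ p y
        eq = trans (solve 4 (λ x y a b → (x :- y) :* a := b :+ (x :- y) :* a :- b) refl x y
          (Δ p y x) (evalʳ p y)) (+-congʳ (sym (Δ-spec p y x)))

      -- One argument moves at a time, each at the rate of a second divided difference; the symmetry
      -- of `Δ` brings the first argument into the place that `Δ²-spec` varies.
      Δ-lipschitz : ∀ {p x t x′ t′ d e} → BoundedBy p → ∣ x ∣ ≤ M → ∣ t ∣ ≤ M → ∣ x′ ∣ ≤ M →
        ∣ t′ ∣ ≤ M →
        ∣ x - x′ ∣ ≤ d → ∣ t - t′ ∣ ≤ e →
          ∣ Δ p x t - Δ p x′ t′ ∣ ≤ (d + e) * (H * B (List.length p))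
      Δ-lipschitz {p} {x} {t} {x′} {t′} {d} {e} p≤ x≤M t≤M x′≤M t′≤M dx dt =
        ≤-trans (≤-respˡ (abs-cong eq)
          (abs-+-≤ (abs-*-≤ dt (Δ²-bound p≤ x≤M t′≤M t≤M))
          (abs-*-≤ dx (Δ²-bound p≤ t′≤M x′≤M x≤M))))
          (≤-by ≤-refl (solve 3 (λ d e a → (d :+ e) :* a :- (e :* a :+ d :* a) := num 0) refl d e
            (H * B (List.length p))))
        where
        eq : (t - t′) * Δ² p x t′ t + (x - x′) * Δ² p t′ x′ x ≈ Δ p x t - Δ p x′ t′
        eq = sym (trans (+-cong (trans (Δ²-spec p x t′ t)
          (+-congʳ (trans (Δ-sym p x t′) (Δ²-spec p t′ x′ x)))) (-‿cong (Δ-sym p x′ t′)))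
          (solve 7 (λ a x b c t d e → a :+ (x :- b) :* c :+ (t :- d) :* e :- a := (t :- d) :* e :+
            (x :- b) :* c) refl (Δ p t′ x′) x x′ (Δ² p t′ x′ x) t t′ (Δ² p x t′ t)))

  opaque
    largest : ∀ (p : List ℝ) → ∃[ H ] 0# < H × All (λ a → ∣ a ∣ ≤ H) p
    largest []      = 1# , 0<1 , []
    largest (a ∷ p) with largest p
    ... | H , 0<H , p≤ = ∣ a ∣ + H ,
      (<-by (0<H ⊕ 0≤∣x∣ a) (solve 2 (λ a H → a :+ H :- num 0 := H :+ a) refl (∣ a ∣) H)) ,
      (≤-by (weaken 0<H) (solve 2 (λ a H → a :+ H :- a := H) refl (∣ a ∣) H)) ∷
      All.map (λ {b} b≤H → (≤-by (diff≤ b≤H ⊞ 0≤∣x∣ a)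
        (solve 3 (λ a H b → a :+ H :- b := H :- b :+ a) refl (∣ a ∣) H (∣ b ∣)))) p≤

  opaque
    polynomialRoot : ∀ p {x y} → x ≤ y → evalʳ p x < 0# → 0# < evalʳ p y → ∃[ z ] x ≤ z × z ≤ y ×
      evalʳ p z ≈ 0#
    polynomialRoot p {x} {y} x≤y px<0 0<py with largest p
    ... | H , 0<H , p≤ = intermediateValue (evalʳ p) x≤y C
      (*-pos 0<H (<-≤-trans 0<1 (1≤B (List.length p))))
      (λ s t x≤s s≤y x≤t t≤y → ≤-respʳ (*-comm _ _)
        (evalʳ-lipschitz (weaken 0<H) p≤ (inside x≤s s≤y) (inside x≤t t≤y) ≤-refl))
      px<0 0<py
      where
      M : ℝ
      M = ∣ x ∣ + ∣ y ∣
      open Bounds {M} (0≤∣x∣ x ⊞ 0≤∣x∣ y)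
      C : ℝ
      C = H * B (List.length p)
      inside : ∀ {s} → x ≤ s → s ≤ y → ∣ s ∣ ≤ M
      inside {s} x≤s s≤y = ∣x∣≤
        (≤-by (diff≤ s≤y ⊞ diff≤ (x≤∣x∣ y) ⊞ 0≤∣x∣ x)
          (solve 4 (λ a b s y → a :+ b :- s := y :- s :+ (b :- y) :+ a) refl (∣ x ∣) (∣ y ∣) s y))
        (≤-by (diff≤ x≤s ⊞ diff≤ (-x≤∣x∣ x) ⊞ 0≤∣x∣ y)
          (solve 4 (λ a b s x → a :+ b :- :- s := s :- x :+ (a :- :- x) :+ b) refl (∣ x ∣)
          (∣ y ∣) s x))

  -- A vector c of length n stands for the monic polynomial of degree n with lower coefficients c.


  evalᵐ : ∀ {n} → Vec ℝ n → ℝ → ℝ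
  evalᵐ []      x = 1#
  evalᵐ (a ∷ c) x = a + x * evalᵐ c x

  -- Synthetic division by t - r. The quotient of a monic polynomial is monic, so the encoding by
  -- lower coefficients persists.
  quotient : ∀ {n} → Vec ℝ (suc n) → ℝ → Vec ℝ n
  quotient {zero}  _       r = []
  quotient {suc n} (a ∷ c) r = evalᵐ c r ∷ quotient c r

  quotient-spec : ∀ {n} (c : Vec ℝ (suc n)) r t →
    evalᵐ c t ≈ evalᵐ c r + (t - r) * evalᵐ (quotient c r) t
  quotient-spec (a ∷ []) r t = solve 3
    (λ a t r → a :+ t :* num 1 := a :+ r :* num 1 :+ (t :- r) :* num 1) refl a t r
  quotient-spec (a ∷ c@(_ ∷ _)) r t = trans
    (+-congˡ (trans (*-congˡ (quotient-spec c r t))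
      (solve 4 (λ t a r q → t :* (a :+ (t :- r) :* q) := r :* a :+ (t :- r) :* (a :+ t :* q)) refl t
      (evalᵐ c r) r q)))
    (sym (+-assoc _ _ _))
    where
    q : ℝ
    q = evalᵐ (quotient c r) t

  opaque
    -- Any root is split off and the quotient is treated in the same way. When there is no root
    -- left, the remaining places are filled with 0, as a covering may list too much.
    evalᵐ-roots : ∀ {n} (c : Vec ℝ n) → Σ (Fin n → ℝ) λ f → ∀ x → evalᵐ c x ≈ 0# → ∃[ i ] f i ≈ x
    evalᵐ-roots [] = (λ ()) , λ x 1≈0 → contradiction 1≈0 (>⇒≉ 0<1)
    evalᵐ-roots {suc n} c with em {∃[ r ] evalᵐ c r ≈ 0#}
    ... | no  none = (λ _ → 0#) , λ x root → contradiction (x , root) none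
    ... | yes (r , root) = f , covers
      where
      rest : Σ (Fin n → ℝ) λ f → ∀ x → evalᵐ (quotient c r) x ≈ 0# → ∃[ i ] f i ≈ x
      rest = evalᵐ-roots (quotient c r)
      f : Fin (suc n) → ℝ
      f zero    = r
      f (suc i) = proj₁ rest i
      covers : ∀ x → evalᵐ c x ≈ 0# → ∃[ i ] f i ≈ x
      covers x cx≈0 with em {r ≈ x}
      ... | yes r≈x = zero , r≈x
      ... | no  r≉x with proj₂ rest x (*-cancel-0 (λ x-r≈0 → r≉x (sym (≈-diff x-r≈0)))
                           (trans (sym (+-identityˡ _)) (trans (+-congʳ (sym root))
                             (trans (sym (quotient-spec c r x)) cx≈0))))
      ... | i , fi≈x = suc i , fi≈x

  -- Real powers

  *-cancelʳ-≤ : ∀ {x y z} → 0# < z → x * z ≤ y * z → x ≤ y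
  *-cancelʳ-≤ {x} {y} {z} 0<z le = ≤-by (nonneg-factor 0<z
    (≤-by (diff≤ le) (solve 3 (λ z y x → z :* (y :- x) :- num 0 := y :* z :- x :* z) refl z y x)))
      refl

  evalʳ-monomial : ∀ k t → evalʳ (List.replicate k 0# List.++ 1# ∷ []) t ≈ t ^ k
  evalʳ-monomial zero    t = solve 1 (λ t → num 1 :+ t :* num 0 := num 1) refl t
  evalʳ-monomial (suc k) t = trans (+-identityˡ _) (*-congˡ (evalʳ-monomial k t))

  opaque
    -- The polynomial t^(k+1) - x is negative at 0 and positive at 1 + x.
    kthRoot : ∀ {x} k → 1# < x → ∃[ w ] 0# < w × w ^ suc k ≈ x
    kthRoot {x} k 1<x = fromRoot (polynomialRoot p (weaken 0<1+x) p0<0 0<p[1+x])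
      where
      p′ p : List ℝ
      p′ = List.replicate k 0# List.++ 1# ∷ []
      p = - x ∷ p′
      0<1+x : 0# < 1# + x
      0<1+x = <-by (diff< 1<x ⊕ weaken (0<⌜suc⌝ 1))
        (solve 1 (λ x → num 1 :+ x :- num 0 := x :- num 1 :+ num 2) refl x)
      p0<0 : evalʳ p 0# < 0#
      p0<0 = <-respˡ (solve 2 (λ x a → :- x := :- x :+ num 0 :* a) refl x (evalʳ p′ 0#))
        (<-by (diff< 1<x ⊕ weaken 0<1)
          (solve 1 (λ x → num 0 :- :- x := x :- num 1 :+ num 1) refl x))
      0<p[1+x] : 0# < evalʳ p (1# + x)
      0<p[1+x] = <-by (0<1 ⊕ diff≈ (sym (*-congˡ (evalʳ-monomial k (1# + x)))) ⊕ *-nonneg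
        (weaken 0<1+x) (diff≤ (1≤^ {1# + x} k
        (≤-by (weaken (diff< 1<x) ⊞ weaken 0<1)
        (solve 1 (λ x → num 1 :+ x :- num 1 := x :- num 1 :+ num 1) refl x)))))
        (solve 3 (λ x a b → :- x :+ a :- num 0 := num 1 :+ (a :- (num 1 :+ x) :* b) :+
        (num 1 :+ x) :* (b :- num 1)) refl x ((1# + x) * evalʳ p′ (1# + x)) ((1# + x) ^ k))
      fromRoot : ∃[ w ] 0# ≤ w × w ≤ 1# + x × evalʳ p w ≈ 0# → ∃[ w ] 0# < w × w ^ suc k ≈ x
      fromRoot (w , 0≤w , _ , pw≈0) = w , positive 0≤w , w^k≈x
        where
        w^k≈x : w ^ suc k ≈ x
        w^k≈x = trans (solve 3 (λ w a x → w :* a := :- x :+ w :* a :+ x) refl w (w ^ k) x)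
          (trans (+-congʳ (trans (+-congˡ (*-congˡ (sym (evalʳ-monomial k w)))) pw≈0))
            (+-identityˡ x))
        positive : 0# ≤ w → 0# < w
        positive (inj₁ 0<w) = 0<w
        positive (inj₂ 0≈w) = contradiction
          (trans (sym w^k≈x) (trans (*-congʳ (sym 0≈w)) (zeroˡ _))) (>⇒≉ (<-trans 0<1 1<x))

  module _ {x : ℝ} (1<x : 1# < x) where

    private
      1≤x : 1# ≤ x
      1≤x = weaken 1<x

      0<x : 0# < x
      0<x = <-trans 0<1 1<x

    -- This is the upper bound from which completeness gives the supremum defining `rpow`: the
    -- exponent (a - b) / k is at most m, and taking k-th powers reduces the claim to natural
    -- powers.
    member-bound : ∀ {y w} m → y ≤ fromℕ m → RationalPowersBelow x y w → w ≤ x ^ m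
    member-bound {y} {w} m y≤m (a , b , k@(suc k-1) , _ , a≤ky+b , 0<w , w^k*x^b≈x^a) =
      ^-cancel-≤ k-1 (weaken (^-pos m 0<x))
        (*-cancelʳ-≤ (^-pos b 0<x) (≤-trans (≤-reflexive w^k*x^b≈x^a)
        (≤-trans (^-monoʳ-≤ 1≤x a≤) (≤-reflexive
          (trans (Exp.^-homo-* x (m ℕ.* k) b) (*-congʳ (sym (Exp.^-assocʳ x m k))))))))
      where
      a≤ : a ℕ.≤ m ℕ.* k ℕ.+ b
      a≤ = fromℕ-cancel-≤ (≤-by (diff≈ (sym (fromℕ-+ (m ℕ.* k) b)) ⊞ diff≈
        (sym (fromℕ-* m k)) ⊞ diff≤ a≤ky+b ⊞ *-nonneg (0≤fromℕ k) (diff≤ y≤m))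
        (solve 7 (λ a b c d e f y → a :- b := a :- (c :+ d) :+ (c :- e :* f) :+
        (f :* y :+ d :- b) :+ f :* (e :- y)) refl (fromℕ (m ℕ.* k ℕ.+ b)) (fromℕ a)
        (fromℕ (m ℕ.* k)) (fromℕ b) (fromℕ m) (fromℕ k) y))

    opaque
      some-member : ∀ y → ∃ (RationalPowersBelow x y)
      some-member y with archimedean (- y)
      ... | b , -y<b = (x ^ b) ⁻¹ , 0 , b , 1 , s≤s z≤n ,
        (≤-by (weaken (diff< -y<b)) (solve 2
          (λ y a → (num 1 :+ num 0) :* y :+ a :- num 0 := a :- :- y) refl y (fromℕ b))) ,
        ⁻¹-pos (^-pos b 0<x) ,
        trans (solve 2 (λ a b → a :* num 1 :* b := b :* a) refl ((x ^ b) ⁻¹) (x ^ b))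
          (inverseʳ (>⇒≉ (^-pos b 0<x)))

    rpow-supremum : ∀ y → IsSupremum _≤_ (RationalPowersBelow x y) (rpow x y)
    rpow-supremum y with em {∃ (IsSupremum _≤_ (RationalPowersBelow x y))}
    ... | yes (s , isSup) = isSup
    ... | no  none = contradiction (complete _ (some-member y)
      (x ^ proj₁ (archimedean y) , member-bound (proj₁ (archimedean y))
        (weaken (proj₂ (archimedean y))))) none

    rpow-pos : ∀ y → 0# < rpow x y
    rpow-pos y with some-member y
    ... | w , w∈@(_ , _ , _ , _ , _ , 0<w , _) =
      <-≤-trans 0<w (IsSupremum.upperBound (rpow-supremum y) w∈)

    module _ (n : ℕ) (y : ℝ) where

      private
        z : ℝ
        z = x ^ n

        0<z : 0# < z
        0<z = ^-pos n 0<x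

        z*z⁻¹ : z * z ⁻¹ ≈ 1#
        z*z⁻¹ = inverseʳ (>⇒≉ 0<z)

        1^k≈1 : ∀ k → 1# ^ k ≈ 1#
        1^k≈1 zero    = refl
        1^k≈1 (suc k) = trans (*-identityˡ _) (1^k≈1 k)

      member-up : ∀ {w} → RationalPowersBelow x y w → RationalPowersBelow x (fromℕ n + y) (w * z)
      member-up {w} (a , b , k , 1≤k , a≤ky+b , 0<w , w^k*x^b≈x^a) = a ℕ.+ n ℕ.* k , b , k , 1≤k ,
        (≤-by (diff≈ (fromℕ-+ a (n ℕ.* k)) ⊞ diff≈ (fromℕ-* n k) ⊞ diff≤ a≤ky+b)
          (solve 7 (λ a b y c d e f → a :* (b :+ y) :+ c :- d := e :+ f :- d :+ (b :* a :- f) :+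
          (a :* y :+ c :- e)) refl (fromℕ k) (fromℕ n) y (fromℕ b) (fromℕ (a ℕ.+ n ℕ.* k)) (fromℕ a)
          (fromℕ (n ℕ.* k)))) ,
        *-pos 0<w 0<z ,
        trans (*-congʳ (CExp.^-distrib-* w z k))
          (trans (solve 3 (λ a b c → a :* b :* c := a :* c :* b) refl (w ^ k) (z ^ k) (x ^ b))
          (trans (*-cong w^k*x^b≈x^a (Exp.^-assocʳ x n k)) (sym (Exp.^-homo-* x a (n ℕ.* k)))))

      member-down : ∀ {w} → RationalPowersBelow x (fromℕ n + y) w →
        RationalPowersBelow x y (w * z ⁻¹)
      member-down {w} (a , b , k , 1≤k , a≤ky+b , 0<w , w^k*x^b≈x^a) = a , n ℕ.* k ℕ.+ b , k , 1≤k ,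
        (≤-by (diff≈ (sym (fromℕ-+ (n ℕ.* k) b)) ⊞ diff≈ (sym (fromℕ-* n k)) ⊞ diff≤ a≤ky+b)
          (solve 7 (λ a y b c d e f → a :* y :+ b :- c := b :- (d :+ e) :+ (d :- f :* a) :+
          (a :* (f :+ y) :+ e :- c)) refl (fromℕ k) y (fromℕ (n ℕ.* k ℕ.+ b)) (fromℕ a)
          (fromℕ (n ℕ.* k)) (fromℕ b) (fromℕ n))) ,
        *-pos 0<w (⁻¹-pos 0<z) ,
        trans (*-cong (CExp.^-distrib-* w (z ⁻¹) k)
          (trans (Exp.^-homo-* x (n ℕ.* k) b) (*-congʳ (sym (Exp.^-assocʳ x n k)))))
          (trans (solve 4 (λ a b c d → a :* b :* (c :* d) := c :* b :* (a :* d)) refl (w ^ k)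
            ((z ⁻¹) ^ k) (z ^ k) (x ^ b))
          (trans (*-cong (trans (sym (CExp.^-distrib-* z (z ⁻¹) k))
            (trans (Exp.^-congˡ k z*z⁻¹) (1^k≈1 k))) w^k*x^b≈x^a) (*-identityˡ _)))

      -- The only case of the addition law for exponents that the count needs: it rewrites Q^(n-γ)
      -- as Qⁿ q. Multiplication by x^n matches the rational powers below y with those below n + y,
      -- hence also their suprema.
      rpow-shift : rpow x (fromℕ n + y) ≈ x ^ n * rpow x y
      rpow-shift = ≤-antisym
        (IsSupremum.least (rpow-supremum (fromℕ n + y)) _ λ {w} w∈ → ≤-respˡ
          (trans (solve 3 (λ z w a → z :* (w :* a) := z :* a :* w) refl z w (z ⁻¹))
            (trans (*-congʳ z*z⁻¹) (*-identityˡ w)))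
          (*-monoˡ-≤ z (weaken 0<z) (IsSupremum.upperBound (rpow-supremum y) (member-down w∈))))
        (≤-respʳ (*-/-cancel 0<z) (*-monoˡ-≤ z (weaken 0<z)
          (IsSupremum.least (rpow-supremum y) _ λ {w} w∈ →
          *-cancelʳ-≤ 0<z (≤-respʳ (sym (trans (*-comm _ _) (*-/-cancel 0<z)))
            (IsSupremum.upperBound (rpow-supremum (fromℕ n + y)) (member-up w∈))))))

  module _ {γ : ℝ} (0<γ : 0# < γ) where

    private
      exponent : ∃[ n ] 1# / γ < fromℕ n
      exponent = archimedean (1# / γ)
      m-1 m : ℕ
      m-1 = proj₁ exponent
      m = suc m-1

      1≤mγ : 1# ≤ fromℕ m * γ
      1≤mγ = ≤-by (diff≈ (sym (*-/-cancel 0<γ)) ⊞ weaken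
        (*-pos 0<γ (diff< (proj₂ exponent))) ⊞ weaken 0<γ)
        (solve 3 (λ a γ b → (num 1 :+ a) :* γ :- num 1 := γ :* b :- num 1 :+ γ :* (a :- b) :+ γ)
        refl (fromℕ m-1) γ (1# / γ))

    -- With m γ ≥ 1, every rational power w below Q^(-γ) satisfies w^m Q ≤ 1; but w > τ and Q >
    -- τ^(-m) would give w^m Q > 1.
    rpow-small : ∀ {τ} → 0# < τ → ∃[ Q₀ ] (∀ Q → 1# < Q → Q₀ < Q → rpow Q (- γ) ≤ τ)
    rpow-small {τ} 0<τ = (τ ⁻¹) ^ m , λ Q 1<Q Q₀<Q →
      IsSupremum.least (rpow-supremum 1<Q (- γ)) τ (bound Q 1<Q Q₀<Q)
      where
      bound : ∀ Q → 1# < Q → (τ ⁻¹) ^ m < Q → ∀ {w} → RationalPowersBelow Q (- γ) w → w ≤ τ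
      bound Q 1<Q Q₀<Q {w} (a , b , k@(suc k-1) , _ , a≤kγ+b , 0<w , w^k*Q^b≈Q^a) with <-or-≥ τ w
      ... | inj₂ w≤τ = w≤τ
      ... | inj₁ τ<w = contradiction w^m*Q≤1 (<⇒≱ 1<w^m*Q)
        where
        0<Q : 0# < Q
        0<Q = <-trans 0<1 1<Q
        am+k≤bm : a ℕ.* m ℕ.+ k ℕ.≤ b ℕ.* m
        am+k≤bm = fromℕ-cancel-≤ (≤-by
          (diff≈ (fromℕ-+ (a ℕ.* m) k) ⊞ diff≈ (fromℕ-* a m) ⊞ diff≈ (sym (fromℕ-* b m)) ⊞ *-nonneg
          (0≤fromℕ m) (diff≤ a≤kγ+b) ⊞ *-nonneg (0≤fromℕ k) (diff≤ 1≤mγ))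
          (solve 8 (λ a b c d e f g γ → a :- b := c :+ d :- b :+ (e :* f :- c) :+
          (a :- g :* f) :+ f :* (d :* :- γ :+ g :- e) :+ d :* (f :* γ :- num 1))
          refl (fromℕ (b ℕ.* m)) (fromℕ (a ℕ.* m ℕ.+ k)) (fromℕ (a ℕ.* m)) (fromℕ k) (fromℕ a)
          (fromℕ m) (fromℕ b) γ))
        -- (w ^ m * Q) ^ k * Q ^ (a * m) ≤ w ^ (m * k) * Q ^ (b * m) = (w ^ k * Q ^ b) ^ m = Q ^ (a * m).
        w^m*Q≤1 : w ^ m * Q ≤ 1#
        w^m*Q≤1 = ^-cancel-≤ k-1 (weaken 0<1) (≤-trans (*-cancelʳ-≤ (^-pos (a ℕ.* m) 0<Q) (≤-trans
          (≤-reflexive (trans (*-congʳ (CExp.^-distrib-* (w ^ m) Q k))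
            (trans (solve 3 (λ a b c → a :* b :* c := a :* (c :* b)) refl ((w ^ m) ^ k) (Q ^ k)
            (Q ^ (a ℕ.* m)))
            (*-congˡ (sym (Exp.^-homo-* Q (a ℕ.* m) k))))))
          (≤-trans (*-monoˡ-≤ ((w ^ m) ^ k) (^-nonneg k (^-nonneg m (weaken 0<w)))
            (^-monoʳ-≤ (weaken 1<Q) am+k≤bm))
          (≤-reflexive (trans (*-cong (trans (Exp.^-assocʳ w m k)
            (trans (Exp.^-congʳ w (ℕ.*-comm m k)) (sym (Exp.^-assocʳ w k m))))
            (sym (Exp.^-assocʳ Q b m)))
            (trans (sym (CExp.^-distrib-* (w ^ k) (Q ^ b) m)) (trans (Exp.^-congˡ m w^k*Q^b≈Q^a)
            (trans (Exp.^-assocʳ Q a m) (sym (*-identityˡ _)))))))))) (1≤^ k ≤-refl))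
        1<w^m*Q : 1# < w ^ m * Q
        1<w^m*Q = <-by (*-pos (^-pos m 0<τ) (diff< Q₀<Q) ⊕ diff≤ τ^m*Q₀ ⊕ weaken
          (*-pos (diff< (^-mono-< m-1 (weaken 0<τ) τ<w)) 0<Q))
          (solve 4 (λ a Q b c → a :* Q :- num 1 := b :* (Q :- c) :+ (b :* c :- num 1) :+
          (a :- b) :* Q) refl (w ^ m) Q (τ ^ m) ((τ ⁻¹) ^ m))
          where
          τ^m*Q₀ : 1# ≤ τ ^ m * (τ ⁻¹) ^ m
          τ^m*Q₀ = ≤-respʳ (trans (Exp.^-congˡ m (sym (inverseʳ (>⇒≉ 0<τ))))
            (CExp.^-distrib-* τ (τ ⁻¹) m)) (1≤^ m ≤-refl)

  -- If 1/k ≤ 1 - γ, then Q^(1/k) / Q is one of the rational powers below Q^(-γ), so Q * Q^(-γ) is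
  -- at least Q^(1/k), which exceeds T once Q > |T|^k.
  rpow-large : ∀ {γ} → γ < 1# → ∀ T → ∃[ Q₀ ] (∀ Q → 1# < Q → Q₀ < Q → T ≤ Q * rpow Q (- γ))
  rpow-large {γ} γ<1 T = (∣ T ∣) ^ k , bound
    where
    exponent : ∃[ n ] 1# / (1# - γ) < fromℕ n
    exponent = archimedean (1# / (1# - γ))
    k-1 k : ℕ
    k-1 = proj₁ exponent
    k = suc k-1
    1≤k[1-γ] : 1# ≤ fromℕ k * (1# - γ)
    1≤k[1-γ] = ≤-by (diff≈ (sym (*-/-cancel (diff< γ<1))) ⊞ weaken
      (*-pos (diff< γ<1) (diff< (proj₂ exponent))) ⊞ weaken (diff< γ<1))
      (solve 3 (λ a γ b → (num 1 :+ a) :* (num 1 :- γ) :- num 1 := (num 1 :- γ) :* b :- num 1 :+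
      (num 1 :- γ) :* (a :- b) :+ (num 1 :- γ)) refl (fromℕ k-1) γ (1# / (1# - γ)))
    bound : ∀ Q → 1# < Q → ∣ T ∣ ^ k < Q → T ≤ Q * rpow Q (- γ)
    bound Q 1<Q Q₀<Q with kthRoot k-1 1<Q
    ... | w , 0<w , w^k≈Q = ≤-trans (x≤∣x∣ T)
      (≤-trans (^-cancel-≤ k-1 (weaken 0<w) (weaken (<-respʳ (sym w^k≈Q) Q₀<Q)))
      (≤-respˡ (*-/-cancel 0<Q) (*-monoˡ-≤ Q (weaken 0<Q)
        (IsSupremum.upperBound (rpow-supremum 1<Q (- γ)) u∈))))
      where
      0<Q : 0# < Q
      0<Q = <-trans 0<1 1<Q
      u∈ : RationalPowersBelow Q (- γ) (w / Q)
      -- The exponent is (1 - k) / k.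
      u∈ = 1 , k , k , s≤s z≤n ,
        (≤-by (diff≤ 1≤k[1-γ]) (solve 2
          (λ a γ → a :* :- γ :+ a :- (num 1 :+ num 0) := a :* (num 1 :- γ) :- num 1) refl (fromℕ k)
          γ)) , /-pos 0<w 0<Q ,
        trans (sym (CExp.^-distrib-* (w / Q) Q k))
          (trans (Exp.^-congˡ k (trans (*-comm _ _) (*-/-cancel 0<Q)))
          (trans w^k≈Q (sym (*-identityʳ Q))))

  -- Functions with bounded derivative on an open interval

  module _ {a b : ℝ} where

    private
      J₀ : Interval
      J₀ = openInterval a b

    inside : ∀ {x y s} → x ∈ J₀ → y ∈ J₀ → x ≤ s → s ≤ y → s ∈ J₀
    inside (between a<x _) (between _ y<b) x≤s s≤y = between (<-≤-trans a<x x≤s) (≤-<-trans s≤y y<b)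

    module _ (f f′ : RealFunction J₀) (derivative : IsDerivativeOf f′ f) {K : ℝ}
             (bounded : ∀ x (x∈ : x ∈ J₀) → ∣ f′ ⟨ x , x∈ ⟩ ∣ ≤ K) where

      private
        L : ℝ
        L = K + 1#

      -- Tolerance 1 in the definition of the derivative bounds the slopes at s by K + 1. Any
      -- Lipschitz constant serves the count, so the sharp K is not pursued.
      locallyLipschitz : ∀ s (s∈ : s ∈ J₀) → ∃[ δ ] 0# < δ ×
        (∀ y (y∈ : y ∈ J₀) → ∣ y - s ∣ < δ → ∣ f ⟨ y , y∈ ⟩ - f ⟨ s , s∈ ⟩ ∣ ≤ L * ∣ y - s ∣)
      locallyLipschitz s s∈ = conclude (derivative s s∈ 1# 0<1)
        where
        conclude : ∃[ δ ] 0# < δ × (∀ y (y∈ : y ∈ J₀) → ¬ (y ≈ s) → ∣ y - s ∣ < δ →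
            ∣ (f ⟨ y , y∈ ⟩ - f ⟨ s , s∈ ⟩) * (y - s) ⁻¹ - f′ ⟨ s , s∈ ⟩ ∣ < 1#) →
          ∃[ δ ] 0# < δ × (∀ y (y∈ : y ∈ J₀) → ∣ y - s ∣ < δ → ∣ f ⟨ y , y∈ ⟩ - f ⟨ s ,
            s∈ ⟩ ∣ ≤ L * ∣ y - s ∣)
        conclude (δ , 0<δ , slope) = δ , 0<δ , bound
          where
          bound : ∀ y (y∈ : y ∈ J₀) → ∣ y - s ∣ < δ → ∣ f ⟨ y , y∈ ⟩ - f ⟨ s ,
            s∈ ⟩ ∣ ≤ L * ∣ y - s ∣
          bound y y∈ close with em {y ≈ s}
          ... | yes y≈s = ≤-respˡ (trans (sym (abs-nonneg ≤-refl))
            (abs-cong (sym (trans (+-congʳ (Func.cong f y≈s)) (-‿inverseʳ _)))))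
            (*-nonneg (≤-trans (0≤∣x∣ (f′ ⟨ s , s∈ ⟩))
              (≤-by (diff≤ (bounded s s∈) ⊞ weaken 0<1)
              (solve 2 (λ K a → K :+ num 1 :- a := K :- a :+ num 1) refl K (∣ f′ ⟨ s , s∈ ⟩ ∣))))
              (0≤∣x∣ (y - s)))
          ... | no  y≉s = ≤-respˡ (abs-cong undo) (abs-*-≤ r≤L ≤-refl)
            where
            r g : ℝ
            r = (f ⟨ y , y∈ ⟩ - f ⟨ s , s∈ ⟩) * (y - s) ⁻¹
            g = f′ ⟨ s , s∈ ⟩
            r≤L : ∣ r ∣ ≤ L
            r≤L = ∣x∣≤
              (≤-by (weaken (diff< (abs<⇒< (slope y y∈ y≉s close))) ⊞ diff≤ (abs≤⇒≤ (bounded s s∈)))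
                (solve 3 (λ K r g → K :+ num 1 :- r := num 1 :- (r :- g) :+ (K :- g)) refl K r g))
              (≤-by (weaken (diff< (abs<⇒-< (slope y y∈ y≉s close))) ⊞ diff≤
                (abs≤⇒-≤ (bounded s s∈))) (solve 3
                (λ K r g → K :+ num 1 :- :- r := num 1 :- :- (r :- g) :+ (K :- :- g)) refl K r g))
            undo : r * (y - s) ≈ f ⟨ y , y∈ ⟩ - f ⟨ s , s∈ ⟩
            undo = trans (solve 3 (λ a b c → a :* b :* c := a :* (c :* b))
              refl (f ⟨ y , y∈ ⟩ - f ⟨ s , s∈ ⟩) ((y - s) ⁻¹) (y - s))
              (trans (*-congˡ (inverseʳ (y≉s ∘ ≈-diff))) (*-identityʳ _))

      -- The local bounds on both sides of s add up along t ≤ s ≤ u, so `realInduction` makes them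
      -- global.
      lipschitz-≤ : ∀ {x y} (x∈ : x ∈ J₀) (y∈ : y ∈ J₀) → x ≤ y → ∣ f ⟨ y , y∈ ⟩ - f ⟨ x ,
        x∈ ⟩ ∣ ≤ L * (y - x)
      lipschitz-≤ {x} {y} x∈ y∈ x≤y = realInduction P x≤y base step y∈
        where
        -- Membership is quantified inside `P`, because `realInduction` takes a predicate on all
        -- reals while `f` takes a proof.
        P : Pred ℝ 0ℓ
        P s = (s∈ : s ∈ J₀) → ∣ f ⟨ s , s∈ ⟩ - f ⟨ x , x∈ ⟩ ∣ ≤ L * (s - x)
        base : P x
        base x∈′ = ≤-reflexive (trans (abs-cong (trans (+-congʳ (Func.cong f refl)) (-‿inverseʳ _)))
          (trans (abs-nonneg ≤-refl) (solve 2 (λ L x → num 0 := L :* (x :- x)) refl L x)))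
        step : ∀ s → x ≤ s → s ≤ y → ∃[ δ ] 0# < δ ×
          (∀ t u → x ≤ t → t ≤ s → s ≤ u → u ≤ y → s < t + δ → u < s + δ → P t → P u)
        step s x≤s s≤y = propagate (locallyLipschitz s s∈)
          where
          s∈ : s ∈ J₀
          s∈ = inside x∈ y∈ x≤s s≤y
          propagate : ∃[ δ ] 0# < δ × (∀ y (y∈ : y ∈ J₀) → ∣ y - s ∣ < δ → ∣ f ⟨ y , y∈ ⟩ - f ⟨ s ,
            s∈ ⟩ ∣ ≤ L * ∣ y - s ∣) →
            ∃[ δ ] 0# < δ × (∀ t u → x ≤ t → t ≤ s → s ≤ u → u ≤ y → s < t + δ → u < s + δ → P t →
              P u)
          propagate (δ , 0<δ , local) = δ , 0<δ , move
            where
            move : ∀ t u → x ≤ t → t ≤ s → s ≤ u → u ≤ y → s < t + δ → u < s + δ → P t → P u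
            move t u x≤t t≤s s≤u u≤y s<t+δ u<s+δ Pt u∈ = ∣x∣≤
              (≤-by (diff≤ (abs≤⇒≤ su) ⊞ diff≤ (abs≤⇒-≤ ts) ⊞ diff≤ (abs≤⇒≤ (Pt t∈)))
                (solve 9 (λ L u x a b s c t d →
                L :* (u :- x) :- (a :- b) := L :* (u :- s) :- (a :- c) :+
                (L :* (s :- t) :- :- (d :- c)) :+ (L :* (t :- x) :- (d :- b))) refl L u x
                (f ⟨ u , u∈ ⟩) (f ⟨ x , x∈ ⟩) s (f ⟨ s , s∈ ⟩) t (f ⟨ t , t∈ ⟩)))
              (≤-by (diff≤ (abs≤⇒-≤ su) ⊞ diff≤ (abs≤⇒≤ ts) ⊞ diff≤ (abs≤⇒-≤ (Pt t∈)))
                (solve 9 (λ L u x a b s c t d →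
                L :* (u :- x) :- :- (a :- b) := L :* (u :- s) :- :- (a :- c) :+
                (L :* (s :- t) :- (d :- c)) :+ (L :* (t :- x) :- :- (d :- b))) refl L u x
                (f ⟨ u , u∈ ⟩) (f ⟨ x , x∈ ⟩) s (f ⟨ s , s∈ ⟩) t (f ⟨ t , t∈ ⟩)))
              where
              t∈ : t ∈ J₀
              t∈ = inside x∈ y∈ x≤t (≤-trans t≤s s≤y)
              su : ∣ f ⟨ u , u∈ ⟩ - f ⟨ s , s∈ ⟩ ∣ ≤ L * (u - s)
              su = ≤-respʳ (*-congˡ (abs-nonneg (diff≤ s≤u)))
                (local u u∈ (<-respˡ (sym (abs-nonneg (diff≤ s≤u)))
                (<-by (diff< u<s+δ) (solve 3 (λ δ u s → δ :- (u :- s) := s :+ δ :- u) refl δ u s))))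
              ∣t-s∣ : ∣ t - s ∣ ≈ s - t
              ∣t-s∣ = trans (abs-swap t s) (abs-nonneg (diff≤ t≤s))
              ts : ∣ f ⟨ t , t∈ ⟩ - f ⟨ s , s∈ ⟩ ∣ ≤ L * (s - t)
              ts = ≤-respʳ (*-congˡ ∣t-s∣) (local t t∈
                (<-respˡ (sym ∣t-s∣) (<-by (diff< s<t+δ)
                (solve 3 (λ δ s t → δ :- (s :- t) := t :+ δ :- s) refl δ s t))))

      lipschitz : ∀ {x y} (x∈ : x ∈ J₀) (y∈ : y ∈ J₀) → ∣ f ⟨ x , x∈ ⟩ - f ⟨ y ,
        y∈ ⟩ ∣ ≤ L * ∣ x - y ∣
      lipschitz {x} {y} x∈ y∈ with ≤-total x y
      ... | inj₁ x≤y = ≤-respˡ (abs-swap _ _)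
        (≤-respʳ (*-congˡ (trans (sym (abs-nonneg (diff≤ x≤y))) (abs-swap y x)))
        (lipschitz-≤ x∈ y∈ x≤y))
      ... | inj₂ y≤x = ≤-respʳ (*-congˡ (sym (abs-nonneg (diff≤ y≤x)))) (lipschitz-≤ y∈ x∈ y≤x)

  open Counting em ℝ²
  open IntegerPolynomials

  -- Monic integer polynomials given by their lower coefficients

  monicPolynomial : ∀ {n} → Vec ℤ n → ℤ[t]
  monicPolynomial w = Vec.toList w List.++ ℤ.1ℤ ∷ []

  lowerCoefficients : ∀ n → ℤ[t] → Vec ℤ n
  lowerCoefficients zero    P       = []
  lowerCoefficients (suc n) []      = ℤ.0ℤ ∷ lowerCoefficients n []
  lowerCoefficients (suc n) (a ∷ P) = a ∷ lowerCoefficients n P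

  evalᵐ≈evalʳ : ∀ {n} (w : Vec ℤ n) x →
    evalᵐ (Vec.map fromℤ w) x ≈ evalʳ (List.map fromℤ (monicPolynomial w)) x
  evalᵐ≈evalʳ []      x = solve 1 (λ x → num 1 := num 1 :+ num 0 :+ x :* num 0) refl x
  evalᵐ≈evalʳ (a ∷ w) x = +-congˡ (*-congˡ (evalᵐ≈evalʳ w x))

  eval-zero : ∀ P x → (∀ i → coeff ℤ.0ℤ P i ≡ ℤ.0ℤ) → eval P x ≈ 0#
  eval-zero []      x zeros = refl
  eval-zero (a ∷ P) x zeros = trans
    (+-cong (reflexive (cong fromℤ (zeros 0))) (*-congˡ (eval-zero P x (zeros ∘ suc))))
    (solve 1 (λ x → num 0 :+ x :* num 0 := num 0) refl x)

  eval-monic : ∀ n P x → MonicOfDegree n P →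
    eval P x ≈ evalʳ (List.map fromℤ (monicPolynomial (lowerCoefficients n P))) x
  eval-monic zero    []      x monic = contradiction (MonicOfDegree.leading monic) λ ()
  eval-monic (suc n) []      x monic = contradiction (MonicOfDegree.leading monic) λ ()
  eval-monic zero    (a ∷ P) x monic = +-cong (reflexive (cong fromℤ (MonicOfDegree.leading monic)))
    (*-congˡ (eval-zero P x λ i → MonicOfDegree.above monic (s≤s z≤n)))
  eval-monic (suc n) (a ∷ P) x monic = +-congˡ (*-congˡ (eval-monic n P x record
    { leading = MonicOfDegree.leading monic ; above = λ n<i →
      MonicOfDegree.above monic (s≤s n<i) }))

  lowerCoefficients-bound : ∀ n P {H} → height P ℕ.≤ H →
    VecAll.All (λ z → ℤ.∣ z ∣ ℕ.≤ H) (lowerCoefficients n P)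
  lowerCoefficients-bound zero    P       _ = []
  lowerCoefficients-bound (suc n) []      _ = z≤n ∷ lowerCoefficients-bound n [] z≤n
  lowerCoefficients-bound (suc n) (a ∷ P) h = ℕ.m⊔n≤o⇒m≤o ℤ.∣ a ∣ (height P) h ∷
    lowerCoefficients-bound n P (ℕ.m⊔n≤o⇒n≤o ℤ.∣ a ∣ (height P) h)

  monic-bounded : ∀ {n} {w : Vec ℤ n} {H} → 1# ≤ H → VecAll.All (λ z → ∣ fromℤ z ∣ ≤ H) w →
    All (λ a → ∣ a ∣ ≤ H) (List.map fromℤ (monicPolynomial w))
  monic-bounded {H = H} 1≤H [] =
    ≤-respˡ (sym (abs-nonneg (weaken (0<1 ⊕ ≤-refl))))
    (≤-by (diff≤ 1≤H) (solve 1 (λ H → H :- (num 1 :+ num 0) := H :- num 1) refl H)) ∷ []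
  monic-bounded 1≤H (z≤ ∷ w≤) = z≤ ∷ monic-bounded 1≤H w≤

  monic-length : ∀ {n} (w : Vec ℤ n) → List.length (List.map fromℤ (monicPolynomial w)) ≡ suc n
  monic-length []      = ≡.refl
  monic-length (a ∷ w) = cong suc (monic-length w)

  -- The upper bound

  abs-neg-diff : ∀ {x x′ u u′} → x ≈ - u → x′ ≈ - u′ → ∣ u - u′ ∣ ≈ ∣ x - x′ ∣
  abs-neg-diff {x} {x′} {u} {u′} x≈ x′≈ =
    trans (abs-swap u u′) (abs-cong
    (sym (trans (+-cong x≈ (-‿cong x′≈)) (solve 2 (λ u a → :- u :- :- a := a :- u) refl u u′))))

  close-integers : ∀ z z′ W {D} → ∣ fromℤ z - fromℤ z′ ∣ ≤ D → D < fromℕ (suc W) →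
    ℤ.∣ z ℤ.- z′ ∣ ℕ.≤ W
  close-integers z z′ W z-z′≤D D<1+W =
    ℕ.s≤s⁻¹ (fromℕ-cancel-< (≤-<-trans
    (≤-trans (fromℤ-abs (z ℤ.- z′)) (≤-respˡ (abs-cong (sym (fromℤ-sub z z′))) z-z′≤D)) D<1+W))

  module UpperBound {a b : ℝ} (a<b : a < b) (φ : RealFunction (openInterval a b))
    {L : ℝ} (0≤L : 0# ≤ L)
    (φ-lipschitz : ∀ {x y} (x∈ : x ∈ openInterval a b) (y∈ : y ∈ openInterval a b) → ∣ φ ⟨ x ,
      x∈ ⟩ - φ ⟨ y , y∈ ⟩ ∣ ≤ L * ∣ x - y ∣)
    {M₀ : ℝ} (x-bound : ∀ x → x ∈ openInterval a b → ∣ x ∣ ≤ M₀)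
      (φ-bound : ∀ x (x∈ : x ∈ openInterval a b) → ∣ φ ⟨ x , x∈ ⟩ ∣ ≤ M₀)
    {c₁ : ℝ} (0<c₁ : 0# < c₁) (m : ℕ) where

    J₀ : Interval
    J₀ = openInterval a b
    n : ℕ
    n = suc (suc m)

    M : ℝ
    M = M₀ + c₁

    0≤M₀ : 0# ≤ M₀
    0≤M₀ = ≤-trans (0≤∣x∣ midpoint) (x-bound midpoint (between
      (<-by/ 1 (diff< a<b ⊕ diff≈ (sym 2c))
        (solve 3 (λ c a b → num 2 :* (c :- a) := b :- a :+ (num 2 :* c :- (a :+ b))) refl midpoint a
        b)) (<-by/ 1 (diff< a<b ⊕ diff≈ 2c)
        (solve 3 (λ b c a → num 2 :* (b :- c) := b :- a :+ (a :+ b :- num 2 :* c)) refl b midpoint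
        a))))
      where
      midpoint : ℝ
      midpoint = (a + b) / 2#
      2c : 2# * midpoint ≈ a + b
      2c = *-/-cancel (0<⌜suc⌝ 1)

    0≤M : 0# ≤ M
    0≤M = 0≤M₀ ⊞ weaken 0<c₁

    open Bounds 0≤M

    -- Two points of one cell differ by at most q in the first coordinate and by at most (c₁ + c₁ +
    -- L) q in the second; `E` is the total in units of q.
    E B′ : ℝ
    E = 1# + (c₁ + c₁ + L)
    B′ = B (suc n)

    0≤E : 0# ≤ E
    0≤E = weaken 0<1 ⊞ (weaken 0<c₁ ⊞ weaken 0<c₁ ⊞ 0≤L)

    -- The sizes of the successive choices, normalised: at most `C₁` / q cells, `C₂` Q q values of
    -- a₁, `C₃` Q q values of a₀ and `C₄` pairs of roots. Each of the other m coefficients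
    -- contributes 1 + 4H ≤ 5Q.
    C₁ C₂ C₃ C₄ : ℝ
    C₁ = (b - a) + (b - a) + 3#
    C₂ = 1# + (E * B′ + E * B′)
    C₃ = 1# + (B′ + B′)
    C₄ = fromℕ (n ℕ.* n)

    0≤C₃ : 0# ≤ C₃
    0≤C₃ = weaken 0<1 ⊞ (0≤B (suc n) ⊞ 0≤B (suc n))

    0≤C₂ : 0# ≤ C₂
    0≤C₂ = weaken 0<1 ⊞ (*-nonneg 0≤E (0≤B (suc n)) ⊞ *-nonneg 0≤E (0≤B (suc n)))

    C : ℝ
    C = C₁ * (⌜ 5 ⌝ ^ m * (C₂ * (C₃ * C₄)))

    0≤C : 0# ≤ C
    0≤C = *-nonneg (≤-by (weaken (scale< 1 (diff< a<b)) ⊞ weaken (0<⌜suc⌝ 2))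
      (solve 2 (λ b a → b :- a :+ (b :- a) :+ num 3 :- num 0 := num 2 :* (b :- a) :+ num 3) refl b
      a)) (*-nonneg (^-nonneg m (weaken (0<⌜suc⌝ 4)))
      (*-nonneg 0≤C₂ (*-nonneg 0≤C₃ (0≤fromℕ (n ℕ.* n)))))

    -- `q≤1` keeps α₂ within c₁ of the curve and absorbs the rounding in the number of cells; `1≤Qq`
    -- absorbs the additional 1 in the windows for a₁ and a₀.
    module _ {Q q : ℝ} (1<Q : 1# < Q) (0<q : 0# < q) (q≤1 : q ≤ 1#) (1≤Qq : 1# ≤ Q * q) where

      NearCurve : Pred (ℝ × ℝ) 0ℓ
      NearCurve (α₁ , α₂) = AlgebraicIntegerPoint n Q (α₁ , α₂) ×
        Σ (α₁ ∈ J₀) λ α₁∈ → ∣ φ ⟨ α₁ , α₁∈ ⟩ - α₂ ∣ < c₁ * q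

      0≤Q : 0# ≤ Q
      0≤Q = weaken (<-trans 0<1 1<Q)

      integerBelow : ∀ {x} → 0# ≤ x → ℕ
      integerBelow 0≤x = proj₁ ⌊ 0≤x ⌋ℕ

      D₁ D₂ D₃ : ℝ
      D₁ = (b - a) / q + 1#
      D₂ = (q + (c₁ + c₁ + L) * q) * (Q * B′)
      D₃ = q * (Q * B′)

      0≤QB : 0# ≤ Q * B′
      0≤QB = *-nonneg 0≤Q (0≤B (suc n))
      0≤D₁ : 0# ≤ D₁
      0≤D₁ = weaken (/-pos (diff< a<b) 0<q) ⊞ weaken 0<1
      0≤D₂ : 0# ≤ D₂
      0≤D₂ = *-nonneg (weaken 0<q ⊞ *-nonneg (weaken 0<c₁ ⊞ weaken 0<c₁ ⊞ 0≤L) (weaken 0<q)) 0≤QB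
      0≤D₃ : 0# ≤ D₃
      0≤D₃ = *-nonneg (weaken 0<q) 0≤QB

      H W₁ W₂ W₃ : ℕ
      H  = integerBelow 0≤Q
      W₁ = integerBelow 0≤D₁
      W₂ = integerBelow 0≤D₂
      W₃ = integerBelow 0≤D₃

      -- The minimal polynomial is tⁿ + … + v₀ t² + a₁ t + a₀, and k numbers the cell of length q that
      -- contains α₁.
      record Fibre (k : ℤ) (v : Vec ℤ m) (a₁ a₀ : ℤ) (α : ℝ × ℝ) : Set where
        field
          α₁∈J₀    : proj₁ α ∈ J₀
          near     : ∣ φ ⟨ proj₁ α , α₁∈J₀ ⟩ - proj₂ α ∣ < c₁ * q
          distinct : ¬ (proj₁ α ≈ proj₂ α)
          cell≤    : fromℤ k * q ≤ proj₁ α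
          cell>    : proj₁ α < (fromℤ k + 1#) * q
          bounded  : VecAll.All (λ z → ℤ.∣ z ∣ ℕ.≤ H) (a₀ ∷ a₁ ∷ v)
          root₁    : evalʳ (List.map fromℤ (monicPolynomial (a₀ ∷ a₁ ∷ v))) (proj₁ α) ≈ 0#
          root₂    : evalʳ (List.map fromℤ (monicPolynomial (a₀ ∷ a₁ ∷ v))) (proj₂ α) ≈ 0#

        α₁≤M : ∣ proj₁ α ∣ ≤ M
        α₁≤M = ≤-by (diff≤ (x-bound (proj₁ α) α₁∈J₀) ⊞ weaken 0<c₁)
          (solve 3 (λ a b c → a :+ b :- c := a :- c :+ b) refl M₀ c₁ (∣ proj₁ α ∣))

        α₂≤M : ∣ proj₂ α ∣ ≤ M
        α₂≤M = ∣x∣≤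
          (≤-by (weaken (diff< (abs<⇒-< near)) ⊞ diff≤ c₁q≤c₁ ⊞ diff≤
            (abs≤⇒≤ (φ-bound (proj₁ α) α₁∈J₀)))
            (solve 5 (λ a b c q y → a :+ b :- c := b :* q :- :- (y :- c) :+
            (b :* num 1 :- b :* q) :+ (a :- y)) refl M₀ c₁ (proj₂ α) q y))
          (≤-by (weaken (diff< (abs<⇒< near)) ⊞ diff≤ c₁q≤c₁ ⊞ diff≤
            (abs≤⇒-≤ (φ-bound (proj₁ α) α₁∈J₀)))
            (solve 5 (λ a b c q y → a :+ b :- :- c := b :* q :- (y :- c) :+
            (b :* num 1 :- b :* q) :+ (a :- :- y)) refl M₀ c₁ (proj₂ α) q y))
          where
          y : ℝ
          y = φ ⟨ proj₁ α , α₁∈J₀ ⟩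
          c₁q≤c₁ : c₁ * q ≤ c₁ * 1#
          c₁q≤c₁ = *-monoˡ-≤ c₁ (weaken 0<c₁) q≤1

        r : List ℝ
        r = List.map fromℤ (monicPolynomial v)

        coefficient₁ : fromℤ a₁ ≈ - Δ (0# ∷ 0# ∷ r) (proj₁ α) (proj₂ α)
        coefficient₁ = ≈-diff (trans (solve 5
          (λ a t b s c → a :- :- (num 0 :+ t :* b :+ s :* (b :+ s :* c)) := a :+ t :* b :+ s :*
          (b :+ s :* c)) refl (fromℤ a₁) t (evalʳ r t) s (Δ r s t))
          (*-cancel-0 (λ t-s≈0 → distinct (sym (≈-diff t-s≈0)))
            (trans (sym (+-identityˡ _)) (trans (+-congʳ (sym root₁))
              (trans (sym (Δ-spec P s t)) root₂)))))
          where
          s t : ℝ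
          s = proj₁ α
          t = proj₂ α
          P : List ℝ
          P = List.map fromℤ (monicPolynomial (a₀ ∷ a₁ ∷ v))

        coefficient₀ : fromℤ a₀ ≈ - evalʳ (0# ∷ fromℤ a₁ ∷ r) (proj₁ α)
        coefficient₀ = ≈-diff (trans (solve 3
          (λ a b c → a :- :- (num 0 :+ b :* c) := a :+ b :* c) refl (fromℤ a₀) (proj₁ α)
          (evalʳ (fromℤ a₁ ∷ r) (proj₁ α))) root₁)

      height-bound : ∀ z → ℤ.∣ z ∣ ℕ.≤ H → ∣ fromℤ z ∣ ≤ Q
      height-bound z z≤H = ≤-trans (fromℤ-abs≤ z z≤H) (proj₁ (proj₂ ⌊ 0≤Q ⌋ℕ))

      0≤Q-abs : ∣ 0# ∣ ≤ Q
      0≤Q-abs = ≤-respˡ (sym (abs-nonneg ≤-refl)) 0≤Q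

      module _ {k v a₁ a₀ a₁′ a₀′ α α′} (F : Fibre k v a₁ a₀ α) (F′ : Fibre k v a₁′ a₀′ α′) where
        private
          module F = Fibre F
          module F′ = Fibre F′

        close₁ : ∣ proj₁ α - proj₁ α′ ∣ ≤ q
        close₁ = ∣x∣≤
          (≤-by (weaken (diff< (F.cell>)) ⊞ diff≤ (F′.cell≤))
            (solve 4 (λ q a b c → q :- (a :- b) := (c :+ num 1) :* q :- a :+ (b :- c :* q)) refl q
            (proj₁ α) (proj₁ α′) (fromℤ k)))
          (≤-by (weaken (diff< (F′.cell>)) ⊞ diff≤ (F.cell≤))
            (solve 4 (λ q a b c → q :- :- (a :- b) := (c :+ num 1) :* q :- b :+ (a :- c :* q))
            refl q (proj₁ α) (proj₁ α′) (fromℤ k)))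

        close₂ : ∣ proj₂ α - proj₂ α′ ∣ ≤ (c₁ + c₁ + L) * q
        close₂ = ∣x∣≤
          (≤-by (weaken (diff< (abs<⇒-< F.near)) ⊞ weaken (diff< (abs<⇒< F′.near)) ⊞ diff≤
            (abs≤⇒≤ φφ)) (solve 7 (λ a L q b c y d →
            (a :+ a :+ L) :* q :- (b :- c) := a :* q :- :- (y :- b) :+ (a :* q :- (d :- c)) :+
            (L :* q :- (y :- d))) refl c₁ L q (proj₂ α) (proj₂ α′) y y′))
          (≤-by (weaken (diff< (abs<⇒< F.near)) ⊞ weaken (diff< (abs<⇒-< F′.near)) ⊞ diff≤
            (abs≤⇒-≤ φφ)) (solve 7 (λ a L q b c y d →
            (a :+ a :+ L) :* q :- :- (b :- c) := a :* q :- (y :- b) :+ (a :* q :- :- (d :- c)) :+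
            (L :* q :- :- (y :- d))) refl c₁ L q (proj₂ α) (proj₂ α′) y y′))
          where
          y y′ : ℝ
          y = φ ⟨ proj₁ α , F.α₁∈J₀ ⟩
          y′ = φ ⟨ proj₁ α′ , F′.α₁∈J₀ ⟩
          φφ : ∣ y - y′ ∣ ≤ L * q
          φφ = ≤-trans (φ-lipschitz F.α₁∈J₀ F′.α₁∈J₀) (*-monoˡ-≤ L 0≤L close₁)

        close-a₁ : ∣ fromℤ a₁ - fromℤ a₁′ ∣ ≤ D₂
        close-a₁ = ≤-respˡ (abs-neg-diff F.coefficient₁ F′.coefficient₁)
          (subst (λ l → ∣ Δ p (proj₁ α) (proj₂ α) - Δ p (proj₁ α′) (proj₂ α′) ∣ ≤
            (q + (c₁ + c₁ + L) * q) * (Q * B l)) (cong (2 ℕ.+_) (monic-length v))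
            (Δ-lipschitz 0≤Q {p} (0≤Q-abs ∷ 0≤Q-abs ∷
              monic-bounded (weaken 1<Q) (VecAll.map (λ {z} → height-bound z)
              (VecAll.tail (VecAll.tail F.bounded)))) F.α₁≤M F.α₂≤M F′.α₁≤M F′.α₂≤M close₁ close₂))
          where
          p : List ℝ
          p = 0# ∷ 0# ∷ List.map fromℤ (monicPolynomial v)

      close-a₀ : ∀ {k v a₁ a₀ a₀′ α α′} → Fibre k v a₁ a₀ α → Fibre k v a₁ a₀′ α′ →
        ∣ fromℤ a₀ - fromℤ a₀′ ∣ ≤ D₃
      close-a₀ {k} {v} {a₁} {a₀} {a₀′} {α} {α′} F F′ =
        ≤-respˡ (abs-neg-diff F.coefficient₀ F′.coefficient₀)
          (subst (λ l → ∣ evalʳ p (proj₁ α) - evalʳ p (proj₁ α′) ∣ ≤ q * (Q * B l))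
            (cong (2 ℕ.+_) (monic-length v))
            (evalʳ-lipschitz 0≤Q {p} (0≤Q-abs ∷
              height-bound a₁ (VecAll.head (VecAll.tail F.bounded)) ∷
              monic-bounded (weaken 1<Q) (VecAll.map (λ {z} → height-bound z)
              (VecAll.tail (VecAll.tail F.bounded)))) F.α₁≤M F′.α₁≤M (close₁ F F′)))
          where
          module F = Fibre F
          module F′ = Fibre F′
          p : List ℝ
          p = 0# ∷ fromℤ a₁ ∷ List.map fromℤ (monicPolynomial v)

      close-k : ∀ {k v a₁ a₀ k′ v′ a₁′ a₀′ α α′} → Fibre k v a₁ a₀ α → Fibre k′ v′ a₁′ a₀′ α′ →
        ∣ fromℤ k - fromℤ k′ ∣ ≤ D₁
      close-k {k} {k′ = k′} {α = α} {α′} F F′ =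
        ∣x∣≤ (half F F′) (≤-respˡ (solve 2 (λ a b → a :- b := :- (b :- a)) refl (fromℤ k′)
        (fromℤ k)) (half F′ F))
        where
        half : ∀ {k v a₁ a₀ k′ v′ a₁′ a₀′ α α′} → Fibre k v a₁ a₀ α → Fibre k′ v′ a₁′ a₀′ α′ →
          fromℤ k - fromℤ k′ ≤ D₁
        half {k} {k′ = k′} {α = α} {α′} F F′ = ≤-by (nonneg-factor 0<q
          (≤-by (diff≈ (sym (*-/-cancel 0<q)) ⊞ diff≤ (Fibre.cell≤ F) ⊞ weaken
            (diff< (Fibre.cell> F′)) ⊞ weaken (diff< (_∈_.upper (Fibre.α₁∈J₀ F))) ⊞ weaken
            (diff< (_∈_.lower (Fibre.α₁∈J₀ F′))))
            (solve 8 (λ q c d e b a f g → q :* (c :+ num 1 :- (d :- e)) :- num 0 := q :* c :-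
            (b :- a) :+ (f :- d :* q) :+ ((e :+ num 1) :* q :- g) :+ (b :- f) :+ (g :- a)) refl q
            ((b - a) / q) (fromℤ k) (fromℤ k′) b a (proj₁ α) (proj₁ α′)))) refl

      cover-roots : ∀ k v a₁ a₀ → Covered (Fibre k v a₁ a₀) (n ℕ.* n)
      cover-roots k v a₁ a₀ = cover-⊆ locate (cover-⋃ (λ i (x , y) → f i ≈ x × ∃[ j ] f j ≈ y)
          λ i → (λ j → f i , f j) , λ (x , y) (fi≈x , j , fj≈y) → j , fi≈x , fj≈y)
        where
        w : Vec ℤ n
        w = a₀ ∷ a₁ ∷ v
        f : Fin n → ℝ
        f = proj₁ (evalᵐ-roots (Vec.map fromℤ w))
        root : ∀ x → evalʳ (List.map fromℤ (monicPolynomial w)) x ≈ 0# → ∃[ i ] f i ≈ x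
        root x rx = proj₂ (evalᵐ-roots (Vec.map fromℤ w)) x (trans (evalᵐ≈evalʳ w x) rx)
        locate : ∀ α → Fibre k v a₁ a₀ α → ∃[ i ] f i ≈ proj₁ α × ∃[ j ] f j ≈ proj₂ α
        locate α F = proj₁ r₁ , proj₂ r₁ , root (proj₂ α) (Fibre.root₂ F)
          where
          r₁ : ∃[ i ] f i ≈ proj₁ α
          r₁ = root (proj₁ α) (Fibre.root₁ F)

      origin : ℝ × ℝ
      origin = 0# , 0#

      N N₁ N₂ N₃ : ℕ
      N₃ = suc (W₃ ℕ.+ W₃) ℕ.* (n ℕ.* n)
      N₂ = suc (W₂ ℕ.+ W₂) ℕ.* N₃
      N₁ = suc ((H ℕ.+ H) ℕ.+ (H ℕ.+ H)) ℕ.^ m ℕ.* N₂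
      N  = suc (W₁ ℕ.+ W₁) ℕ.* N₁

      -- The order of nesting matters: two values of a₁ are known to be close only over a common
      -- cell and a common `v`, and two values of a₀ only if a₁ is common as well.
      cover-fibres : Covered (λ α → ∃[ k ] ∃[ v ] ∃[ a₁ ] ∃[ a₀ ] Fibre k v a₁ a₀ α) N
      cover-fibres = cover-ℤ origin {W₁} (λ k α → ∃[ v ] ∃[ a₁ ] ∃[ a₀ ] Fibre k v a₁ a₀ α)
        (λ k k′ _ _ (_ , _ , _ , F) (_ , _ , _ , F′) →
          close-integers k k′ W₁ (close-k F F′) (proj₂ (proj₂ ⌊ 0≤D₁ ⌋ℕ)))
        λ k → cover-Vec origin {H} m (λ v α → ∃[ a₁ ] ∃[ a₀ ] Fibre k v a₁ a₀ α)
          (λ v _ (_ , _ , F) → VecAll.tail (VecAll.tail (Fibre.bounded F)))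
        λ v → cover-ℤ origin {W₂} (λ a₁ α → ∃[ a₀ ] Fibre k v a₁ a₀ α)
          (λ a₁ a₁′ _ _ (_ , F) (_ , F′) →
            close-integers a₁ a₁′ W₂ (close-a₁ F F′) (proj₂ (proj₂ ⌊ 0≤D₂ ⌋ℕ)))
        λ a₁ → cover-ℤ origin {W₃} (λ a₀ α → Fibre k v a₁ a₀ α)
          (λ a₀ a₀′ _ _ F F′ → close-integers a₀ a₀′ W₃ (close-a₀ F F′) (proj₂ (proj₂ ⌊ 0≤D₃ ⌋ℕ)))
        λ a₀ → cover-roots k v a₁ a₀

      fibre : ∀ α → NearCurve α → ∃[ k ] ∃[ v ] ∃[ a₁ ] ∃[ a₀ ] Fibre k v a₁ a₀ α
      fibre (α₁ , α₂) ((P , minimal , P≤Q) , α₁∈ , near) =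
        fromCoefficients (lowerCoefficients n P) (lowerCoefficients-bound n P P≤H)
          (trans (sym (eval-monic n P α₁ monic)) root₁)
            (trans (sym (eval-monic n P α₂ monic)) root₂)
        where
        open IsMinimalPolynomial minimal using (monic; root₁; root₂; distinct)
        P≤H : height P ℕ.≤ H
        P≤H = ℕ.s≤s⁻¹ (fromℕ-cancel-< (≤-<-trans P≤Q (proj₂ (proj₂ ⌊ 0≤Q ⌋ℕ))))
        cell : ∃[ z ] fromℤ z ≤ α₁ / q × α₁ / q < fromℤ z + 1#
        cell = integerPart (α₁ / q)
        k : ℤ
        k = proj₁ cell
        qk : q * (α₁ / q) ≈ α₁
        qk = *-/-cancel 0<q
        fromCoefficients : (w : Vec ℤ n) → VecAll.All (λ z → ℤ.∣ z ∣ ℕ.≤ H) w →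
          evalʳ (List.map fromℤ (monicPolynomial w)) α₁ ≈ 0# →
          evalʳ (List.map fromℤ (monicPolynomial w)) α₂ ≈ 0# →
            ∃[ k ] ∃[ v ] ∃[ a₁ ] ∃[ a₀ ] Fibre k v a₁ a₀ (α₁ , α₂)
        fromCoefficients (a₀ ∷ a₁ ∷ v) bounded r₁ r₂ = k , v , a₁ , a₀ , record
          { α₁∈J₀ = α₁∈ ; near = near ; distinct = distinct
          ; cell≤ = ≤-by (diff≈ qk ⊞ *-nonneg (weaken 0<q) (diff≤ (proj₁ (proj₂ cell))))
            (solve 4 (λ a b q c → a :- b :* q := a :- q :* c :+ q :* (c :- b)) refl α₁ (fromℤ k) q
            (α₁ / q))
          ; cell> = <-by (*-pos 0<q (diff< (proj₂ (proj₂ cell))) ⊕ diff≈ (sym qk))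
            (solve 4 (λ a q b c → (a :+ num 1) :* q :- b := q :* (a :+ num 1 :- c) :+ (q :* c :- b))
            refl (fromℤ k) q α₁ (α₁ / q))
          ; bounded = bounded ; root₁ = r₁ ; root₂ = r₂ }

      X₁ X₂ X₃ Y : ℝ
      X₁ = fromℕ (suc (W₁ ℕ.+ W₁))
      X₂ = fromℕ (suc (W₂ ℕ.+ W₂))
      X₃ = fromℕ (suc (W₃ ℕ.+ W₃))
      Y  = fromℕ (suc ((H ℕ.+ H) ℕ.+ (H ℕ.+ H)))

      X₁q≤C₁ : X₁ * q ≤ C₁
      X₁q≤C₁ = ≤-by (diff≈ (*-congʳ (fromℕ-+ W₁ W₁)) ⊞ scale≤ 1
        (*-nonneg (weaken 0<q) (diff≤ (proj₁ (proj₂ ⌊ 0≤D₁ ⌋ℕ)))) ⊞ scale≤ 1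
        (diff≈ (*-/-cancel 0<q)) ⊞ scale≤ 2 (diff≤ q≤1))
        (solve 6 (λ b a c q d e → b :- a :+ (b :- a) :+ num 3 :- (num 1 :+ c) :* q :=
        (d :+ d) :* q :- c :* q :+ num 2 :* (q :* (e :+ num 1 :- d)) :+ num 2 :*
        (b :- a :- q :* e) :+ num 3 :* (num 1 :- q)) refl b a (fromℕ (W₁ ℕ.+ W₁)) q (fromℕ W₁)
        ((b - a) / q))

      X₂≤ : X₂ ≤ C₂ * (Q * q)
      X₂≤ = ≤-by (diff≈ (fromℕ-+ W₂ W₂) ⊞ scale≤ 1 (diff≤ (proj₁ (proj₂ ⌊ 0≤D₂ ⌋ℕ))) ⊞ diff≤ 1≤Qq)
        (solve 7 (λ a L b Q q c d → (num 1 :+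
        ((num 1 :+ (a :+ a :+ L)) :* b :+ (num 1 :+ (a :+ a :+ L)) :* b)) :* (Q :* q) :-
        (num 1 :+ c) := d :+ d :- c :+ num 2 :* ((q :+ (a :+ a :+ L) :* q) :* (Q :* b) :- d) :+
        (Q :* q :- num 1)) refl c₁ L B′ Q q (fromℕ (W₂ ℕ.+ W₂)) (fromℕ W₂))

      X₃≤ : X₃ ≤ C₃ * (Q * q)
      X₃≤ = ≤-by (diff≈ (fromℕ-+ W₃ W₃) ⊞ scale≤ 1 (diff≤ (proj₁ (proj₂ ⌊ 0≤D₃ ⌋ℕ))) ⊞ diff≤ 1≤Qq)
        (solve 5 (λ a Q q b c → (num 1 :+ (a :+ a)) :* (Q :* q) :-
        (num 1 :+ b) := c :+ c :- b :+ num 2 :* (q :* (Q :* a) :- c) :+ (Q :* q :- num 1)) refl B′ Q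
        q (fromℕ (W₃ ℕ.+ W₃)) (fromℕ W₃))

      Y≤ : Y ≤ ⌜ 5 ⌝ * Q
      Y≤ = ≤-by (diff≈ (fromℕ-+ (H ℕ.+ H) (H ℕ.+ H)) ⊞ scale≤ 1 (diff≈ (fromℕ-+ H H)) ⊞ scale≤ 3
        (diff≤ (proj₁ (proj₂ ⌊ 0≤Q ⌋ℕ))) ⊞ weaken (diff< 1<Q))
        (solve 4 (λ Q a b c → num 5 :* Q :- (num 1 :+ a) := b :+ b :- a :+ num 2 :*
        (c :+ c :- b) :+ num 4 :* (Q :- c) :+ (Q :- num 1)) refl Q (fromℕ ((H ℕ.+ H) ℕ.+ (H ℕ.+ H)))
        (fromℕ (H ℕ.+ H)) (fromℕ H))

      N≤ : fromℕ N ≤ C * (Q ^ n * q)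
      N≤ = ≤-respˡ (sym N≈) (≤-trans
        (*-monoˡ-≤ X₁ (0≤fromℕ (suc (W₁ ℕ.+ W₁)))
          (*-mono-≤ (^-nonneg m (0≤fromℕ (suc ((H ℕ.+ H) ℕ.+ (H ℕ.+ H)))))
          (*-nonneg (0≤fromℕ (suc (W₂ ℕ.+ W₂)))
            (*-nonneg (0≤fromℕ (suc (W₃ ℕ.+ W₃))) (0≤fromℕ (n ℕ.* n))))
          (≤-respʳ (CExp.^-distrib-* ⌜ 5 ⌝ Q m)
            (^-mono-≤ m (0≤fromℕ (suc ((H ℕ.+ H) ℕ.+ (H ℕ.+ H)))) Y≤))
          (*-mono-≤ (0≤fromℕ (suc (W₂ ℕ.+ W₂)))
            (*-nonneg (0≤fromℕ (suc (W₃ ℕ.+ W₃))) (0≤fromℕ (n ℕ.* n))) X₂≤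
            (*-mono-≤ (0≤fromℕ (suc (W₃ ℕ.+ W₃))) (0≤fromℕ (n ℕ.* n)) X₃≤ ≤-refl))))
        -- Of the two factors q coming from a₁ and a₀, one is used up by the number of cells.
        (≤-by (*-nonneg (diff≤ X₁q≤C₁) 0≤rest)
          (solve 9 (λ a F b c d Q G q e →
          a :* (F :* (b :* (c :* d))) :* (Q :* (Q :* G) :* q) :- e :*
          (F :* G :* (b :* (Q :* q) :* (c :* (Q :* q) :* d))) := (a :- e :* q) :*
          (F :* (b :* (c :* d)) :* (Q :* (Q :* G) :* q))) refl C₁ F C₂ C₃ C₄ Q G q X₁)))
        where
        F G : ℝ
        F = ⌜ 5 ⌝ ^ m
        G = Q ^ m
        0≤rest : 0# ≤ F * (C₂ * (C₃ * C₄)) * ((Q * (Q * G)) * q)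
        0≤rest = *-nonneg (*-nonneg (^-nonneg m (weaken (0<⌜suc⌝ 4)))
          (*-nonneg 0≤C₂ (*-nonneg 0≤C₃ (0≤fromℕ (n ℕ.* n)))))
          (*-nonneg (^-nonneg n 0≤Q) (weaken 0<q))
        N≈ : fromℕ N ≈ X₁ * (Y ^ m * (X₂ * (X₃ * C₄)))
        N≈ = trans (fromℕ-* (suc (W₁ ℕ.+ W₁)) N₁)
          (*-congˡ (trans (fromℕ-* (suc ((H ℕ.+ H) ℕ.+ (H ℕ.+ H)) ℕ.^ m) N₂)
          (*-cong (fromℕ-^ (suc ((H ℕ.+ H) ℕ.+ (H ℕ.+ H))) m)
            (trans (fromℕ-* (suc (W₂ ℕ.+ W₂)) N₃)
            (*-congˡ (fromℕ-* (suc (W₃ ℕ.+ W₃)) (n ℕ.* n)))))))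

      upper : ∃[ N ] Covered NearCurve N × fromℕ N ≤ C * (Q ^ n * q)
      upper = N , cover-⊆ fibre cover-fibres , N≤

  -- Evaluation is a ring homomorphism

  eval-cong : ∀ P {x y} → x ≈ y → eval P x ≈ eval P y
  eval-cong []      x≈y = refl
  eval-cong (a ∷ P) x≈y = +-congˡ (*-cong x≈y (eval-cong P x≈y))

  eval-⊞ : ∀ P P′ x → eval (P ⊞ℤ P′) x ≈ eval P x + eval P′ x
  eval-⊞ []      P′       x = sym (+-identityˡ _)
  eval-⊞ (a ∷ P) []       x = sym (+-identityʳ _)
  eval-⊞ (a ∷ P) (a′ ∷ P′) x = trans (+-cong (fromℤ-+ a a′) (*-congˡ (eval-⊞ P P′ x)))
    (solve 5 (λ a b x c d → a :+ b :+ x :* (c :+ d) := a :+ x :* c :+ (b :+ x :* d)) refl (fromℤ a)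
      (fromℤ a′) x (eval P x) (eval P′ x))

  eval-scale : ∀ c P x → eval (List.map (c ℤ.*_) P) x ≈ fromℤ c * eval P x
  eval-scale c []      x = sym (zeroʳ _)
  eval-scale c (a ∷ P) x = trans (+-cong (fromℤ-* c a) (*-congˡ (eval-scale c P x)))
    (solve 4 (λ a b x c → a :* b :+ x :* (a :* c) := a :* (b :+ x :* c)) refl (fromℤ c) (fromℤ a) x
      (eval P x))

  eval-constant : ∀ P x → Constant (coeff 0ℤ P) → eval P x ≈ 0# → coeff 0ℤ P 0 ≡ 0ℤ
  eval-constant []      x _        _    = ≡.refl
  eval-constant (a ∷ P) x constant root =
    fromℤ-cancel-0 a (trans (solve 2 (λ a x → a := a :+ x :* num 0) refl (fromℤ a) x)
    (trans (+-congˡ (*-congˡ (sym (eval-zero P x constant)))) root))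

  coeff-leading : ∀ {n} (w : Vec ℤ n) → coeff 0ℤ (monicPolynomial w) n ≡ 1ℤ
  coeff-leading []      = ≡.refl
  coeff-leading (a ∷ w) = coeff-leading w

  coeff-above : ∀ {n} (w : Vec ℤ n) i → n ℕ.< i → coeff 0ℤ (monicPolynomial w) i ≡ 0ℤ
  coeff-above []      (suc i) _           = ≡.refl
  coeff-above (a ∷ w) (suc i) (s≤s n<i) = coeff-above w i n<i

  coeff-lower : ∀ {n} {P : Pred ℤ 0ℓ} {w : Vec ℤ n} → VecAll.All P w → ∀ i → i ℕ.< n →
    P (coeff 0ℤ (monicPolynomial w) i)
  coeff-lower (Pa ∷ Pw) zero    _           = Pa
  coeff-lower (Pa ∷ Pw) (suc i) (s≤s i<n) = coeff-lower Pw i i<n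

  monicPolynomial-injective : ∀ {n} (w w′ : Vec ℤ n) →
    (∀ i → coeff 0ℤ (monicPolynomial w) i ≡ coeff 0ℤ (monicPolynomial w′) i) → w ≡ w′
  monicPolynomial-injective []      []        _  = ≡.refl
  monicPolynomial-injective (a ∷ w) (a′ ∷ w′) eq =
    cong₂ _∷_ (eq 0) (monicPolynomial-injective w w′ (eq ∘ suc))

  monicPolynomial-height : ∀ {n H} {w : Vec ℤ n} → 1 ℕ.≤ H → VecAll.All (λ z → ℤ.∣ z ∣ ℕ.≤ H) w →
    height (monicPolynomial w) ℕ.≤ H
  monicPolynomial-height 1≤H []        = 1≤H
  monicPolynomial-height 1≤H (z≤ ∷ w≤) = ℕ.⊔-lub z≤ (monicPolynomial-height 1≤H w≤)

  -- The difference of the two polynomials has smaller degree and the same root, hence is zero.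
  common-root : ∀ {n} (w w′ : Vec ℤ n) {x x′} → Eisenstein n (coeff 0ℤ (monicPolynomial w)) →
    eval (monicPolynomial w) x ≈ 0# → eval (monicPolynomial w′) x′ ≈ 0# → x ≈ x′ → w ≡ w′
  common-root {n} w w′ {x} {x′} eis root root′ x≈x′ = monicPolynomial-injective w w′ λ i →
    ℤ.i-j≡0⇒i≡j _ _ (≡.trans (≡.sym (coeff-E i)) (small⇒zero {n} {P} eis root E ZE small i))
    where
    P P′ E : ℤ[t]
    P  = monicPolynomial w
    P′ = monicPolynomial w′
    E  = P ⊞ℤ List.map (ℤ.-1ℤ ℤ.*_) P′
    Z : Pred ℤ[t] 0ℓ
    Z p = eval p x ≈ 0#
    Z-⊞ : ∀ p q → Z p → Z q → Z (p ⊞ℤ q)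
    Z-⊞ p q Zp Zq = trans (eval-⊞ p q x) (trans (+-cong Zp Zq) (+-identityˡ 0#))
    Z-scale : ∀ c p → Z p → Z (List.map (c ℤ.*_) p)
    Z-scale c p Zp = trans (eval-scale c p x) (trans (*-congˡ Zp) (zeroʳ _))
    Z-shift : ∀ p → Z p → Z (0ℤ ∷ p)
    Z-shift p Zp = trans (+-congˡ (*-congˡ Zp))
      (solve 1 (λ x → num 0 :+ x :* num 0 := num 0) refl x)
    open VanishingIdeal Z Z-⊞ Z-scale Z-shift (λ p → eval-constant p x) using (small⇒zero)
    ZE : Z E
    ZE = Z-⊞ P _ root (Z-scale ℤ.-1ℤ P′ (trans (eval-cong P′ x≈x′) root′))
    coeff-E : ∀ i → coeff 0ℤ E i ≡ coeff 0ℤ P i ℤ.- coeff 0ℤ P′ i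
    coeff-E i = ≡.trans (coeffℤ-⊞ P _ i)
      (cong₂ ℤ._+_ (≡.refl {x = coeff 0ℤ P i}) (≡.trans (coeffℤ-scale ℤ.-1ℤ P′ i) (ℤ.-1*i≡-i _)))
    small : ∀ i → n ℕ.≤ i → coeff 0ℤ E i ≡ 0ℤ
    small i n≤i = ≡.trans (coeff-E i)
      (ℤ.i≡j⇒i-j≡0 {coeff 0ℤ P i} {coeff 0ℤ P′ i} (agree (ℕ.m≤n⇒m<n∨m≡n n≤i)))
      where
      agree : n ℕ.< i ⊎ n ≡ i → coeff 0ℤ P i ≡ coeff 0ℤ P′ i
      agree (inj₁ n<i)    = ≡.trans (coeff-above w i n<i) (≡.sym (coeff-above w′ i n<i))
      agree (inj₂ ≡.refl) = ≡.trans (coeff-leading w) (≡.sym (coeff-leading w′))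

  -- Roots forced by sign changes

  evalʳ-neg : ∀ p x → evalʳ (List.map -_ p) x ≈ - evalʳ p x
  evalʳ-neg []      x = solve 1 (λ _ → num 0 := :- (num 0)) refl 0#
  evalʳ-neg (a ∷ p) x = trans (+-congˡ (*-congˡ (evalʳ-neg p x)))
    (solve 3 (λ a x b → :- a :+ x :* :- b := :- (a :+ x :* b)) refl a x (evalʳ p x))

  polynomialRoot-decreasing : ∀ p {x y} → x ≤ y → 0# < evalʳ p x → evalʳ p y < 0# → ∃[ z ] x ≤ z ×
    z ≤ y × evalʳ p z ≈ 0#
  polynomialRoot-decreasing p {x} {y} x≤y 0<px py<0 = negate (polynomialRoot (List.map -_ p) x≤y
      (<-respˡ (sym (evalʳ-neg p x))
        (<-by 0<px (solve 1 (λ a → num 0 :- :- a := a) refl (evalʳ p x))))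
      (<-respʳ (sym (evalʳ-neg p y))
        (<-by (diff< py<0) (solve 1 (λ a → :- a :- num 0 := num 0 :- a) refl (evalʳ p y)))))
    where
    negate : ∃[ z ] x ≤ z × z ≤ y × evalʳ (List.map -_ p) z ≈ 0# → ∃[ z ] x ≤ z × z ≤ y ×
      evalʳ p z ≈ 0#
    negate (z , x≤z , z≤y , root) = z , x≤z , z≤y ,
      trans (solve 1 (λ a → a := :- (:- a)) refl (evalʳ p z))
        (trans (-‿cong (trans (sym (evalʳ-neg p z)) root))
        (solve 1 (λ _ → :- (num 0) := num 0) refl 0#))

  -- For t = x - q and t = x + q the factor t - y has the same sign and size at least ε/2, so the
  -- main term has opposite signs at the two ends and size at least q (ε/2) A, which exceeds the
  -- error E. Whether y lies to the left or to the right of x decides the direction of the sign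
  -- change.
  root-near : ∀ p {x y q ε A E} → 0# < q → 2# * q ≤ ε → ε ≤ ∣ x - y ∣ → 0# ≤ A →
    2# * E < q * (ε * A) →
    (∀ t → ∣ t - x ∣ ≤ q → ∃[ s ] ∃[ e ] A ≤ s × ∣ e ∣ ≤ E ×
      evalʳ p t ≈ (t - x) * ((t - y) * s) + e) →
    ∃[ z ] ∣ z - x ∣ ≤ q × evalʳ p z ≈ 0#
  root-near p {x} {y} {q} {ε} {A} {E} 0<q 2q≤ε gap 0≤A small factor = recentre (split (<-or-≥ x y))
    where
    l r : ℝ
    l = x - q
    r = x + q
    l≤r : l ≤ r
    l≤r = ≤-by (weaken (scale< 1 (0<q)))
      (solve 2 (λ x q → x :+ q :- (x :- q) := num 2 :* q) refl x q)
    recentre : ∃[ z ] l ≤ z × z ≤ r × evalʳ p z ≈ 0# → ∃[ z ] ∣ z - x ∣ ≤ q × evalʳ p z ≈ 0#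
    recentre (z , l≤z , z≤r , root) = z ,
      ∣x∣≤ (≤-by (diff≤ z≤r) (solve 3 (λ q z x → q :- (z :- x) := x :+ q :- z) refl q z x))
      (≤-by (diff≤ l≤z) (solve 3 (λ q z x → q :- :- (z :- x) := z :- (x :- q)) refl q z x)) , root
    Factored : ℝ → Set
    Factored t = ∃[ s ] ∃[ e ] A ≤ s × ∣ e ∣ ≤ E × evalʳ p t ≈ (t - x) * ((t - y) * s) + e
    at-l : Factored l
    at-l = factor l (∣x∣≤ (≤-by (weaken (scale< 1 (0<q)))
      (solve 2 (λ q x → q :- (x :- q :- x) := num 2 :* q) refl q x))
      (≤-by ≤-refl (solve 2 (λ q x → q :- :- (x :- q :- x) := num 0) refl q x)))
    at-r : Factored r
    at-r = factor r (∣x∣≤ (≤-by ≤-refl (solve 2 (λ q x → q :- (x :+ q :- x) := num 0) refl q x))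
      (≤-by (weaken (scale< 1 (0<q)))
      (solve 2 (λ q x → q :- :- (x :+ q :- x) := num 2 :* q) refl q x)))
    0≤ε : 0# ≤ ε
    0≤ε = ≤-by (diff≤ 2q≤ε ⊞ weaken (scale< 1 (0<q)))
      (solve 2 (λ ε q → ε :- num 0 := ε :- num 2 :* q :+ num 2 :* q) refl ε q)
    far : ∀ {d s} → ε ≤ 2# * d → A ≤ s → q * (ε * A) ≤ q * ((2# * d) * s)
    far {d} ε≤2d A≤s = *-monoˡ-≤ q (weaken 0<q) (*-mono-≤ 0≤ε 0≤A ε≤2d A≤s)
    split : x < y ⊎ y ≤ x → ∃[ z ] l ≤ z × z ≤ r × evalʳ p z ≈ 0#
    split (inj₂ y≤x) = polynomialRoot p l≤r (negative at-l) (positive at-r)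
      where
      ε≤x-y : ε ≤ x - y
      ε≤x-y = ≤-respʳ (abs-nonneg (diff≤ y≤x)) gap
      negative : Factored l → evalʳ p l < 0#
      negative (s , e , A≤s , e≤E , eq) =
        <-by/ 1 (diff< small ⊕ scale≤ 1 (diff≈ eq) ⊕ scale≤ 1 (diff≤ (abs≤⇒≤ e≤E)) ⊕ diff≤
        (far {x - q - y} (≤-by (scale≤ 1 (diff≤ ε≤x-y) ⊞ diff≤ 2q≤ε)
        (solve 4 (λ x q y ε → num 2 :* (x :- q :- y) :- ε := num 2 :* (x :- y :- ε) :+
        (ε :- num 2 :* q)) refl x q y ε)) A≤s))
        (solve 9 (λ a q ε A E x y s e →
        num 2 :* (num 0 :- a) := q :* (ε :* A) :- num 2 :* E :+ num 2 :*
        ((x :- q :- x) :* ((x :- q :- y) :* s) :+ e :- a) :+ num 2 :* (E :- e) :+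
        (q :* (num 2 :* (x :- q :- y) :* s) :- q :* (ε :* A))) refl (evalʳ p l) q ε A E x y s e)
      positive : Factored r → 0# < evalʳ p r
      positive (s , e , A≤s , e≤E , eq) =
        <-by/ 1 (diff< small ⊕ scale≤ 1 (diff≈ (sym eq)) ⊕ scale≤ 1 (diff≤ (abs≤⇒-≤ e≤E)) ⊕ diff≤
        (far {x + q - y} (≤-by (scale≤ 1 (diff≤ ε≤x-y) ⊞ 0≤ε ⊞ weaken (scale< 1 (0<q)))
        (solve 4 (λ x q y ε → num 2 :* (x :+ q :- y) :- ε := num 2 :*
        (x :- y :- ε) :+ ε :+ num 2 :* q) refl x q y ε)) A≤s))
        (solve 9 (λ a q ε A E x y s e →
        num 2 :* (a :- num 0) := q :* (ε :* A) :- num 2 :* E :+ num 2 :*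
        (a :- ((x :+ q :- x) :* ((x :+ q :- y) :* s) :+ e)) :+ num 2 :* (E :- :- e) :+
        (q :* (num 2 :* (x :+ q :- y) :* s) :- q :* (ε :* A))) refl (evalʳ p r) q ε A E x y s e)
    split (inj₁ x<y) = polynomialRoot-decreasing p l≤r (positive at-l) (negative at-r)
      where
      ε≤y-x : ε ≤ y - x
      ε≤y-x = ≤-respʳ (trans (abs-swap x y) (abs-nonneg (weaken (diff< x<y)))) gap
      positive : Factored l → 0# < evalʳ p l
      positive (s , e , A≤s , e≤E , eq) =
        <-by/ 1 (diff< small ⊕ scale≤ 1 (diff≈ (sym eq)) ⊕ scale≤ 1 (diff≤ (abs≤⇒-≤ e≤E)) ⊕ diff≤
        (far {y - x + q} (≤-by (scale≤ 1 (diff≤ ε≤y-x) ⊞ 0≤ε ⊞ weaken (scale< 1 (0<q)))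
        (solve 4 (λ y x q ε → num 2 :* (y :- x :+ q) :- ε := num 2 :*
        (y :- x :- ε) :+ ε :+ num 2 :* q) refl y x q ε)) A≤s))
        (solve 9 (λ a q ε A E x y s e →
        num 2 :* (a :- num 0) := q :* (ε :* A) :- num 2 :* E :+ num 2 :*
        (a :- ((x :- q :- x) :* ((x :- q :- y) :* s) :+ e)) :+ num 2 :* (E :- :- e) :+
        (q :* (num 2 :* (y :- x :+ q) :* s) :- q :* (ε :* A))) refl (evalʳ p l) q ε A E x y s e)
      negative : Factored r → evalʳ p r < 0#
      negative (s , e , A≤s , e≤E , eq) =
        <-by/ 1 (diff< small ⊕ scale≤ 1 (diff≈ eq) ⊕ scale≤ 1 (diff≤ (abs≤⇒≤ e≤E)) ⊕ diff≤
        (far {y - x - q} (≤-by (scale≤ 1 (diff≤ ε≤y-x) ⊞ diff≤ 2q≤ε)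
        (solve 4 (λ y x q ε → num 2 :* (y :- x :- q) :- ε := num 2 :* (y :- x :- ε) :+
        (ε :- num 2 :* q)) refl y x q ε)) A≤s))
        (solve 9 (λ a q ε A E x y s e →
        num 2 :* (num 0 :- a) := q :* (ε :* A) :- num 2 :* E :+ num 2 :*
        ((x :+ q :- x) :* ((x :+ q :- y) :* s) :+ e :- a) :+ num 2 :* (E :- e) :+
        (q :* (num 2 :* (y :- x :- q) :* s) :- q :* (ε :* A))) refl (evalʳ p r) q ε A E x y s e)

  -- The lower bound

  open AbelianGroupProperties ℤ.+-0-abelianGroup using () renaming
    (∙-cancelˡ to ℤ-cancelˡ; ∙-cancelʳ to ℤ-cancelʳ)

  remQuot-injective : ∀ {m} k {i j : Fin (m ℕ.* k)} → Fin.remQuot {m} k i ≡ Fin.remQuot k j → i ≡ j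
  remQuot-injective {m} k {i} {j} eq = ≡.trans (≡.sym (Fin.combine-remQuot {m} k i))
    (≡.trans (cong (λ (a , b) → Fin.combine a b) eq) (Fin.combine-remQuot {m} k j))

  digits : ∀ {A} m → Fin (A ℕ.^ m) → Vec (Fin A) m
  digits     zero    _ = []
  digits {A} (suc m) e = proj₁ (Fin.remQuot (A ℕ.^ m) e) ∷
    digits m (proj₂ (Fin.remQuot {A} (A ℕ.^ m) e))

  digits-injective : ∀ {A} m {e e′ : Fin (A ℕ.^ m)} → digits m e ≡ digits m e′ → e ≡ e′
  digits-injective     zero    {zero} {zero} _ = ≡.refl
  digits-injective {A} (suc m) {e} {e′} eq = remQuot-injective {A} (A ℕ.^ m)
    (cong₂ _,_ (cong Vec.head eq) (digits-injective m (cong Vec.tail eq)))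

  fromℤ-double : ∀ z → fromℤ (+ 2 ℤ.* z) ≈ 2# * fromℤ z
  fromℤ-double z = trans (fromℤ-* (+ 2) z) (*-congʳ (fromℕ≈⌜⌝ 2))

  -- Above 1, rounding down costs at most a factor of 2.
  floor-half : ∀ {x} (0≤x : 0# ≤ x) → 1# ≤ x → 1# ≤ fromℕ (proj₁ ⌊ 0≤x ⌋ℕ) ×
    x ≤ 2# * fromℕ (proj₁ ⌊ 0≤x ⌋ℕ)
  floor-half {x} 0≤x 1≤x = 1≤F ,
    (≤-by (weaken (diff< (proj₂ (proj₂ ⌊ 0≤x ⌋ℕ))) ⊞ diff≤ 1≤F)
    (solve 2 (λ a x → num 2 :* a :- x := num 1 :+ a :- x :+ (a :- num 1)) refl (fromℕ F) x))
    where
    F : ℕ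
    F = proj₁ ⌊ 0≤x ⌋ℕ
    1≤F : 1# ≤ fromℕ F
    1≤F = ≤-respˡ (+-identityʳ 1#)
      (fromℕ-mono-≤ (fromℕ-cancel-< {0} {F}
      (<-by (diff< (proj₂ (proj₂ ⌊ 0≤x ⌋ℕ)) ⊕ diff≤ 1≤x)
      (solve 2 (λ a x → a :- num 0 := num 1 :+ a :- x :+ (x :- num 1)) refl (fromℕ F) x))))

  module LowerBound {a b : ℝ} (φ : RealFunction (openInterval a b))
    {L : ℝ} (0≤L : 0# ≤ L)
    (φ-lipschitz : ∀ {x y} (x∈ : x ∈ openInterval a b) (y∈ : y ∈ openInterval a b) → ∣ φ ⟨ x ,
      x∈ ⟩ - φ ⟨ y , y∈ ⟩ ∣ ≤ L * ∣ x - y ∣)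
    {M₀ : ℝ} (x-bound : ∀ x → x ∈ openInterval a b → ∣ x ∣ ≤ M₀)
      (φ-bound : ∀ x (x∈ : x ∈ openInterval a b) → ∣ φ ⟨ x , x∈ ⟩ ∣ ≤ M₀)
    {J : Interval} (J⊆J₀ : J ⊆ openInterval a b)
    {x₀ ρ ε : ℝ} (0<ρ : 0# < ρ) (0<ε : 0# < ε) (ε≤1 : ε ≤ 1#)
    (window : ∀ x → ∣ x - x₀ ∣ ≤ ρ → x ∈ J)
    (gap : ∀ x (x∈ : ∣ x - x₀ ∣ ≤ ρ) → ε ≤ ∣ x - φ ⟨ x , J⊆J₀ (window x x∈) ⟩ ∣)
    {c₁ : ℝ} (L+2≤c₁ : L + 2# ≤ c₁) (m : ℕ) where

    n : ℕ
    n = suc (suc (suc m))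

    M : ℝ
    M = M₀ + 1#

    0≤M₀ : 0# ≤ M₀
    0≤M₀ = ≤-trans (0≤∣x∣ x₀) (x-bound x₀
      (J⊆J₀ (window x₀ (≤-respˡ (trans (sym (abs-nonneg ≤-refl)) (abs-cong (sym (-‿inverseʳ x₀))))
      (weaken 0<ρ)))))

    0≤M : 0# ≤ M
    0≤M = 0≤M₀ ⊞ weaken 0<1

    open Bounds 0≤M

    B′ : ℝ
    B′ = B (suc n)

    1≤B′ : 1# ≤ B′
    1≤B′ = 1≤B (suc n)

    -- The ratio that makes a₂ dominate. The coefficients above it, at most 2A′, contribute at most
    -- 2A′ B′ to a second divided difference; with A = 2 β A′ and β > B′ this is at most A, whereas
    -- a₂ ≥ 2A.
    β : ℕ
    β = proj₁ (archimedean B′)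

    Γ : ℝ
    Γ = fromℕ β

    B′<Γ : B′ < Γ
    B′<Γ = proj₂ (archimedean B′)

    1≤Γ : 1# ≤ Γ
    1≤Γ = weaken (≤-<-trans 1≤B′ B′<Γ)

    0<Γ : 0# < Γ
    0<Γ = <-≤-trans 0<1 1≤Γ

    -- The 32 is 2 · 4 · 2 · 2, from 2V (1 + M) with V = 4A B′, A = 2Γ A′ and A′ ≤ 2c′ Q. Thus c′ =
    -- 1/D yields 2V (1 + M) ≤ Q, which keeps the interpolated a₁ and a₀ within the height.
    D : ℝ
    D = ⌜ 32 ⌝ * (Γ * (B′ * (1# + M)))

    0<1+M : 0# < 1# + M
    0<1+M = 0<1 ⊕ 0≤M

    0<D : 0# < D
    0<D = *-pos (0<⌜suc⌝ 31) (*-pos 0<Γ (*-pos (<-≤-trans 0<1 1≤B′) 0<1+M))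

    -- a₃ , … , aₙ₋₁ range over about c′ Q values each, a₀ and a₁ over about δ′ Q q values.
    c′ δ′ : ℝ
    c′ = 1# / D
    δ′ = ε * (Γ * c′) / (⌜ 16 ⌝ * (1# + M))

    0<c′ : 0# < c′
    0<c′ = /-pos 0<1 0<D

    0<δ′ : 0# < δ′
    0<δ′ = /-pos (*-pos 0<ε (*-pos 0<Γ 0<c′)) (*-pos (0<⌜suc⌝ 15) 0<1+M)

    c′-spec : ⌜ 32 ⌝ * (Γ * (B′ * (1# + M))) * c′ ≈ 1#
    c′-spec = *-/-cancel 0<D

    δ′-spec : ⌜ 16 ⌝ * (1# + M) * δ′ ≈ ε * (Γ * c′)
    δ′-spec = *-/-cancel (*-pos (0<⌜suc⌝ 15) 0<1+M)

    Γc′≤1 : Γ * c′ ≤ 1#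
    Γc′≤1 = ≤-by (diff≈ c′-spec ⊞ scale≤ 31
      (*-nonneg (weaken (*-pos 0<Γ 0<c′)) (diff≤ 1≤B′ ⊞ *-nonneg 0≤M (≤-trans (weaken 0<1) 1≤B′))) ⊞
      weaken (scale< 30 (*-pos 0<Γ 0<c′)))
      (solve 4 (λ Γ a b M → num 1 :- Γ :* a := num 1 :- num 32 :*
      (Γ :* (b :* (num 1 :+ M))) :* a :+ num 32 :* (Γ :* a :* (b :- num 1 :+ M :* b)) :+ num 31 :*
      (Γ :* a)) refl Γ c′ B′ M)

    16δ′≤1 : ⌜ 16 ⌝ * δ′ ≤ 1#
    16δ′≤1 = ≤-by (diff≈ δ′-spec ⊞ scale≤ 15 (*-nonneg 0≤M (weaken 0<δ′)) ⊞ *-nonneg (diff≤ ε≤1)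
      (weaken (*-pos 0<Γ 0<c′)) ⊞ diff≤ Γc′≤1)
      (solve 5 (λ a ε Γ b M → num 1 :- num 16 :* a := ε :* (Γ :* b) :- num 16 :*
      (num 1 :+ M) :* a :+ num 16 :* (M :* a) :+ (num 1 :- ε) :* (Γ :* b) :+ (num 1 :- Γ :* b))
      refl δ′ ε Γ c′ M)

    -- The factor ρ/12 comes from the number of grid points, which is at least ρ / (12 q); the
    -- others come from a₂, the m coefficients above it, and the pair a₁, a₀.
    c₂ : ℝ
    c₂ = (ρ / ⌜ 12 ⌝) * (c′ * (c′ ^ m * (δ′ * δ′)))

    0<c₂ : 0# < c₂
    0<c₂ = *-pos (/-pos 0<ρ (0<⌜suc⌝ 11)) (*-pos 0<c′ (*-pos (^-pos m 0<c′) (*-pos 0<δ′ 0<δ′)))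

    -- Beyond this value both c′ Q q and δ′ Q q are at least 1, so no range of choices is empty.
    threshold : ℝ
    threshold = 1# / c′ + 1# / δ′

    -- A single number below both ε/16 and ρ/16, as ε ≤ 1: it separates the two roots and leaves
    -- room for the grid.
    smallness : ℝ
    smallness = (ε * ρ) / (⌜ 16 ⌝ * (1# + ρ))

    0<smallness : 0# < smallness
    0<smallness = /-pos (*-pos 0<ε 0<ρ) (*-pos (0<⌜suc⌝ 15) (0<1 ⊕ weaken 0<ρ))

    module _ {Q q : ℝ} (1<Q : 1# < Q) (0<q : 0# < q) (q≤smallness : q ≤ smallness)
      (threshold≤Qq : threshold ≤ Q * q) where

      Target : Pred (ℝ × ℝ) 0ℓ
      Target (α₁ , α₂) = AlgebraicIntegerPoint n Q (α₁ , α₂) ×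
        Σ (α₁ ∈ J) λ α₁∈J → ∣ φ ⟨ α₁ , J⊆J₀ α₁∈J ⟩ - α₂ ∣ < c₁ * q

      smallness-spec : ⌜ 16 ⌝ * (1# + ρ) * smallness ≈ ε * ρ
      smallness-spec = *-/-cancel (*-pos (0<⌜suc⌝ 15) (0<1 ⊕ weaken 0<ρ))

      16q≤ : ⌜ 16 ⌝ * (1# + ρ) * q ≤ ε * ρ
      16q≤ = ≤-respʳ smallness-spec (*-monoˡ-≤ _
        (weaken (*-pos (0<⌜suc⌝ 15) (0<1 ⊕ weaken 0<ρ))) q≤smallness)

      4q≤ε : 4# * q ≤ ε
      4q≤ε = ≤-by (nonneg-factor 0<ρ
        (≤-by (diff≤ 16q≤ ⊞ weaken (scale< 11 (*-pos 0<ρ 0<q)) ⊞ weaken (scale< 15 (0<q)))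
        (solve 3 (λ ρ ε q → ρ :* (ε :- num 4 :* q) :- num 0 := ε :* ρ :- num 16 :*
        (num 1 :+ ρ) :* q :+ num 12 :* (ρ :* q) :+ num 16 :* q) refl ρ ε q))) refl

      6q≤ρ : ⌜ 6 ⌝ * q ≤ ρ
      6q≤ρ = ≤-by (diff≤ 16q≤ ⊞ weaken (scale< 15 (*-pos 0<ρ 0<q)) ⊞ *-nonneg (diff≤ ε≤1)
        (weaken 0<ρ) ⊞ weaken (scale< 9 (0<q)))
        (solve 3 (λ ρ q ε → ρ :- num 6 :* q := ε :* ρ :- num 16 :* (num 1 :+ ρ) :* q :+ num 16 :*
        (ρ :* q) :+ (num 1 :- ε) :* ρ :+ num 10 :* q) refl ρ q ε)

      q≤1 : q ≤ 1#
      q≤1 = ≤-by (diff≤ 4q≤ε ⊞ diff≤ ε≤1 ⊞ weaken (scale< 2 (0<q)))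
        (solve 2 (λ q ε → num 1 :- q := ε :- num 4 :* q :+ (num 1 :- ε) :+ num 3 :* q) refl q ε)

      0<Q : 0# < Q
      0<Q = <-trans 0<1 1<Q

      Qq≤Q : Q * q ≤ Q
      Qq≤Q = ≤-by (*-nonneg (weaken 0<Q) (diff≤ q≤1))
        (solve 2 (λ Q q → Q :- Q :* q := Q :* (num 1 :- q)) refl Q q)

      1≤c′Qq : 1# ≤ c′ * (Q * q)
      1≤c′Qq = ≤-by (diff≈ (sym (*-/-cancel 0<c′)) ⊞ weaken (*-pos 0<c′ (/-pos 0<1 0<δ′)) ⊞ *-nonneg
        (weaken 0<c′) (diff≤ threshold≤Qq))
        (solve 5 (λ a Q q b c → a :* (Q :* q) :- num 1 := a :* b :- num 1 :+ a :* c :+ a :*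
        (Q :* q :- (b :+ c))) refl c′ Q q (1# / c′) (1# / δ′))

      1≤δ′Qq : 1# ≤ δ′ * (Q * q)
      1≤δ′Qq = ≤-by (diff≈ (sym (*-/-cancel 0<δ′)) ⊞ weaken (*-pos 0<δ′ (/-pos 0<1 0<c′)) ⊞ *-nonneg
        (weaken 0<δ′) (diff≤ threshold≤Qq))
        (solve 5 (λ a Q q b c → a :* (Q :* q) :- num 1 := a :* b :- num 1 :+ a :* c :+ a :*
        (Q :* q :- (c :+ b))) refl δ′ Q q (1# / δ′) (1# / c′))

      1≤c′Q : 1# ≤ c′ * Q
      1≤c′Q = ≤-by (diff≤ 1≤c′Qq ⊞ *-nonneg (weaken 0<c′) (diff≤ Qq≤Q))
        (solve 3 (λ a Q q → a :* Q :- num 1 := a :* (Q :* q) :- num 1 :+ a :* (Q :- Q :* q)) refl c′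
        Q q)

      -- Twice the wanted size, so that the integer parts are still at least the wanted size.
      sizeA sizeU sizeK : ℝ
      sizeA = 2# * (c′ * Q)
      sizeU = 2# * (δ′ * (Q * q))
      sizeK = ρ / (⌜ 6 ⌝ * q)

      0≤sizeA : 0# ≤ sizeA
      0≤sizeA = ≤-by (scale≤ 1 (diff≤ 1≤c′Q) ⊞ weaken (0<⌜suc⌝ 1))
        (solve 2 (λ a Q → num 2 :* (a :* Q) :- num 0 := num 2 :* (a :* Q :- num 1) :+ num 2) refl c′
        Q)
      0≤sizeU : 0# ≤ sizeU
      0≤sizeU = ≤-by (scale≤ 1 (diff≤ 1≤δ′Qq) ⊞ weaken (0<⌜suc⌝ 1))
        (solve 3 (λ a Q q → num 2 :* (a :* (Q :* q)) :- num 0 := num 2 :*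
        (a :* (Q :* q) :- num 1) :+ num 2) refl δ′ Q q)
      0≤sizeK : 0# ≤ sizeK
      0≤sizeK = weaken (/-pos 0<ρ (*-pos (0<⌜suc⌝ 5) 0<q))

      sizeK-spec : ⌜ 6 ⌝ * q * sizeK ≈ ρ
      sizeK-spec = *-/-cancel (*-pos (0<⌜suc⌝ 5) 0<q)

      1≤sizeK : 1# ≤ sizeK
      1≤sizeK = ≤-by (nonneg-factor (*-pos (0<⌜suc⌝ 5) 0<q)
        (≤-by (diff≈ (sym sizeK-spec) ⊞ diff≤ 6q≤ρ)
        (solve 3 (λ q a ρ → num 6 :* q :* (a :- num 1) :- num 0 := num 6 :* q :* a :- ρ :+
        (ρ :- num 6 :* q)) refl q sizeK ρ))) refl

      A′ A U K : ℕ
      A′ = proj₁ ⌊ 0≤sizeA ⌋ℕ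
      A  = 2 ℕ.* β ℕ.* A′
      U  = proj₁ ⌊ 0≤sizeU ⌋ℕ
      K  = proj₁ ⌊ 0≤sizeK ⌋ℕ

      Aʳ A′ʳ Uʳ Kʳ : ℝ
      Aʳ  = fromℕ A
      A′ʳ = fromℕ A′
      Uʳ  = fromℕ U
      Kʳ  = fromℕ K

      A≈ : Aʳ ≈ 2# * Γ * A′ʳ
      A≈ = trans (fromℕ-* (2 ℕ.* β) A′) (*-congʳ (trans (fromℕ-* 2 β) (*-congʳ (fromℕ≈⌜⌝ 2))))

      A′≤ : A′ʳ ≤ 2# * (c′ * Q)
      A′≤ = proj₁ (proj₂ ⌊ 0≤sizeA ⌋ℕ)

      A′-large : 1# ≤ A′ʳ × 2# * (c′ * Q) ≤ 2# * A′ʳ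
      A′-large = floor-half 0≤sizeA (≤-by (scale≤ 1 (diff≤ 1≤c′Q) ⊞ weaken 0<1)
        (solve 2 (λ a Q → num 2 :* (a :* Q) :- num 1 := num 2 :* (a :* Q :- num 1) :+ num 1) refl c′
        Q))

      1≤A′ : 1# ≤ A′ʳ
      1≤A′ = proj₁ A′-large

      c′Q≤A′ : c′ * Q ≤ A′ʳ
      c′Q≤A′ = ≤-by/ 1 (diff≤ (proj₂ A′-large))
        (solve 3 (λ a b Q → num 2 :* (a :- b :* Q) := num 2 :* a :- num 2 :* (b :* Q)) refl A′ʳ c′
        Q)

      U≤ : Uʳ ≤ 2# * (δ′ * (Q * q))
      U≤ = proj₁ (proj₂ ⌊ 0≤sizeU ⌋ℕ)

      U-large : 1# ≤ Uʳ × 2# * (δ′ * (Q * q)) ≤ 2# * Uʳ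
      U-large = floor-half 0≤sizeU (≤-by (scale≤ 1 (diff≤ 1≤δ′Qq) ⊞ weaken 0<1)
        (solve 3 (λ a Q q → num 2 :* (a :* (Q :* q)) :- num 1 := num 2 :*
        (a :* (Q :* q) :- num 1) :+ num 1) refl δ′ Q q))

      1≤U : 1# ≤ Uʳ
      1≤U = proj₁ U-large

      δ′Qq≤U : δ′ * (Q * q) ≤ Uʳ
      δ′Qq≤U = ≤-by/ 1 (diff≤ (proj₂ U-large))
        (solve 4 (λ a b Q q → num 2 :* (a :- b :* (Q :* q)) := num 2 :* a :- num 2 :*
        (b :* (Q :* q))) refl Uʳ δ′ Q q)

      6qK≤ρ : ⌜ 6 ⌝ * q * Kʳ ≤ ρ
      6qK≤ρ = ≤-respʳ sizeK-spec (*-monoˡ-≤ (⌜ 6 ⌝ * q) (weaken (*-pos (0<⌜suc⌝ 5) 0<q))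
        (proj₁ (proj₂ ⌊ 0≤sizeK ⌋ℕ)))

      ρ≤12qK : ρ ≤ ⌜ 12 ⌝ * (q * Kʳ)
      ρ≤12qK = ≤-by (diff≈ (sym sizeK-spec) ⊞ scale≤ 5
        (*-nonneg (weaken 0<q) (diff≤ (proj₂ (floor-half 0≤sizeK 1≤sizeK)))))
        (solve 4 (λ q a ρ b → num 12 :* (q :* a) :- ρ := num 6 :* q :* b :- ρ :+ num 6 :*
        (q :* (num 2 :* a :- b))) refl q Kʳ ρ sizeK)

      A′≤A : 2# * A′ʳ ≤ Aʳ
      A′≤A = ≤-by (diff≈ (sym A≈) ⊞ scale≤ 1 (*-nonneg (diff≤ 1≤Γ) (≤-trans (weaken 0<1) 1≤A′)))
        (solve 3 (λ a b Γ → a :- num 2 :* b := a :- num 2 :* Γ :* b :+ num 2 :* ((Γ :- num 1) :* b))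
        refl Aʳ A′ʳ Γ)

      0≤A : 0# ≤ Aʳ
      0≤A = 0≤fromℕ A

      0≤4A : 0# ≤ 4# * Aʳ
      0≤4A = ≤-by (scale≤ 3 (0≤A)) (solve 1 (λ a → num 4 :* a :- num 0 := num 4 :* a) refl Aʳ)

      V : ℝ
      V = 4# * Aʳ * B′

      0≤V : 0# ≤ V
      0≤V = *-nonneg 0≤4A (0≤B (suc n))

      2V[1+M]≤Q : 2# * (V * (1# + M)) ≤ Q
      2V[1+M]≤Q = ≤-by (scale≤ 7 (diff≈ (*-congʳ A≈)) ⊞ scale≤ 15
        (*-nonneg (*-nonneg (weaken 0<Γ) (*-nonneg (0≤B (suc n)) (weaken 0<1+M))) (diff≤ A′≤)) ⊞
        diff≈ (*-congʳ c′-spec)) (solve 7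
        (λ Q a b M Γ c d → Q :- num 2 :* (num 4 :* a :* b :* (num 1 :+ M)) := num 8 :*
        (num 2 :* Γ :* c :* (b :* (num 1 :+ M)) :- a :* (b :* (num 1 :+ M))) :+ num 16 :*
        (Γ :* (b :* (num 1 :+ M)) :* (num 2 :* (d :* Q) :- c)) :+
        (num 1 :* Q :- num 32 :* (Γ :* (b :* (num 1 :+ M))) :* d :* Q)) refl Q Aʳ B′ M Γ A′ʳ c′)

      8U≤Q : ⌜ 8 ⌝ * Uʳ ≤ Q
      8U≤Q = ≤-by (scale≤ 7 (diff≤ U≤) ⊞ scale≤ 15 (*-nonneg (weaken 0<δ′) (diff≤ Qq≤Q)) ⊞ *-nonneg
        (weaken 0<Q) (diff≤ 16δ′≤1)) (solve 4
        (λ Q a b q → Q :- num 8 :* a := num 8 :* (num 2 :* (b :* (Q :* q)) :- a) :+ num 16 :*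
        (b :* (Q :- Q :* q)) :+ Q :* (num 1 :- num 16 :* b)) refl Q Uʳ δ′ q)

      E : ℝ
      E = 4# * Uʳ * (1# + M)

      -- This inequality dictates δ′: 2E is at most 16 (1 + M) δ′ Q q = ε Γ c′ Q q, while q ε A is
      -- at least twice that.
      E-small : 2# * E < q * (ε * Aʳ)
      E-small = <-by (*-pos (*-pos (*-pos 0<q 0<ε) 0<Γ) (*-pos 0<c′ 0<Q) ⊕ scale≤ 7
        (*-nonneg (weaken 0<1+M) (diff≤ U≤)) ⊕ diff≈ (*-congʳ δ′-spec) ⊕ diff≈
        (sym (*-congˡ A≈)) ⊕ scale≤ 1 (*-nonneg (weaken (*-pos (*-pos 0<q 0<ε) 0<Γ))
        (diff≤ c′Q≤A′))) (solve 10 (λ q ε a b M Γ c Q d e →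
        q :* (ε :* a) :- num 2 :* (num 4 :* b :* (num 1 :+ M)) := q :* ε :* Γ :*
        (c :* Q) :+ num 8 :* ((num 1 :+ M) :* (num 2 :* (d :* (Q :* q)) :- b)) :+
        (ε :* (Γ :* c) :* (Q :* q) :- num 16 :* (num 1 :+ M) :* d :* (Q :* q)) :+
        (q :* ε :* a :- q :* ε :* (num 2 :* Γ :* e)) :+ num 2 :* (q :* ε :* Γ :* (e :- c :* Q)))
        refl q ε Aʳ Uʳ M Γ c′ Q δ′ A′ʳ)

      -- Steps of 3q exceed 2q, so a root within q of a grid point determines it. The grid covers at
      -- most half of the window to the right of `x₀`, and the roots stay inside.
      x : Fin K → ℝ
      x k = x₀ + 3# * q * fromℕ (toℕ k)

      6qk≤ρ : ∀ (k : Fin K) → ⌜ 6 ⌝ * q * fromℕ (toℕ k) ≤ ρ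
      6qk≤ρ k = ≤-trans (*-monoˡ-≤ (⌜ 6 ⌝ * q) (weaken (*-pos (0<⌜suc⌝ 5) 0<q))
        (fromℕ-mono-≤ (ℕ.<⇒≤ (Fin.toℕ<n k)))) 6qK≤ρ

      near-x⇒window : ∀ k {t} → ∣ t - x k ∣ ≤ q → ∣ t - x₀ ∣ ≤ ρ
      near-x⇒window k {t} close = ∣x∣≤
        (≤-by/ 1 (scale≤ 1 (diff≤ (abs≤⇒≤ close)) ⊞ diff≤ (6qk≤ρ k) ⊞ diff≤ 6q≤ρ ⊞ weaken
          (scale< 3 (0<q))) (solve 5 (λ ρ t a q j →
          num 2 :* (ρ :- (t :- a)) := num 2 :* (q :- (t :- (a :+ num 3 :* q :* j))) :+
          (ρ :- num 6 :* q :* j) :+ (ρ :- num 6 :* q) :+ num 4 :* q) refl ρ t x₀ q j))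
        (≤-by (diff≤ (abs≤⇒-≤ close) ⊞ scale≤ 2
          (*-nonneg (weaken 0<q) (0≤fromℕ (toℕ k))) ⊞ diff≤ 6q≤ρ ⊞ weaken (scale< 4 (0<q)))
          (solve 5 (λ ρ t a q j → ρ :- :- (t :- a) := q :- :-
          (t :- (a :+ num 3 :* q :* j)) :+ num 3 :* (q :* j) :+ (ρ :- num 6 :* q) :+ num 5 :* q)
          refl ρ t x₀ q j))
        where
        j : ℝ
        j = fromℕ (toℕ k)

      x∈window : ∀ k → ∣ x k - x₀ ∣ ≤ ρ
      x∈window k = near-x⇒window k (≤-respˡ
        (trans (sym (abs-nonneg ≤-refl)) (abs-cong (sym (-‿inverseʳ (x k))))) (weaken 0<q))

      x∈J₀ : ∀ k → x k ∈ openInterval a b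
      x∈J₀ k = J⊆J₀ (window (x k) (x∈window k))

      y : Fin K → ℝ
      y k = φ ⟨ x k , x∈J₀ k ⟩

      x≤M₀ : ∀ k → ∣ x k ∣ ≤ M₀
      x≤M₀ k = x-bound (x k) (x∈J₀ k)

      y≤M₀ : ∀ k → ∣ y k ∣ ≤ M₀
      y≤M₀ k = φ-bound (x k) (x∈J₀ k)

      near⇒≤M : ∀ {t s} → ∣ s ∣ ≤ M₀ → ∣ t - s ∣ ≤ q → ∣ t ∣ ≤ M
      near⇒≤M {t} {s} s≤M₀ close = ∣x∣≤
        (≤-by (diff≤ (abs≤⇒≤ s≤M₀) ⊞ diff≤ (abs≤⇒≤ close) ⊞ diff≤ q≤1)
          (solve 4 (λ a t s q → a :+ num 1 :- t := a :- s :+ (q :- (t :- s)) :+ (num 1 :- q))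
          refl M₀ t s q))
        (≤-by (diff≤ (abs≤⇒-≤ s≤M₀) ⊞ diff≤ (abs≤⇒-≤ close) ⊞ diff≤ q≤1)
          (solve 4 (λ a t s q → a :+ num 1 :- :- t := a :- :- s :+ (q :- :- (t :- s)) :+
          (num 1 :- q)) refl M₀ t s q))

      ≤M₀⇒≤M : ∀ {t} → ∣ t ∣ ≤ M₀ → ∣ t ∣ ≤ M
      ≤M₀⇒≤M {t} le = ≤-by (diff≤ le ⊞ weaken 0<1)
        (solve 2 (λ a b → a :+ num 1 :- b := a :- b :+ num 1) refl M₀ (∣ t ∣))

      evenDigits : Vec (Fin A′) m → Vec ℤ m
      evenDigits = Vec.map (λ d → + 2 ℤ.* + toℕ d)

      second : Fin A → ℤ
      second i = + 2 ℤ.* + (A ℕ.+ toℕ i)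

      -- Nothing here depends on the parameters u and v, which later merely shift `z₁` and `z₀`;
      -- this is why they can be recovered from the coefficients.
      module Interpolation (k : Fin K) (i : Fin A) (g : Vec (Fin A′) m) where

        r : List ℝ
        r = List.map fromℤ (monicPolynomial (evenDigits g))

        a₂ : ℝ
        a₂ = fromℤ (second i)

        p : List ℝ
        p = 0# ∷ 0# ∷ a₂ ∷ r

        -- With a₁* and a₀* in place of integers the polynomial would vanish at both x k and y k.
        slope a₁* a₀* : ℝ
        slope = Δ p (x k) (y k)
        a₁* = - slope
        a₀* = x k * slope - evalʳ p (x k)

        -- The divisors anticipate the parity conditions: a₁ will be even and a₀ will be 2 modulo 4.
        z₁ z₀ : ℤ
        z₁ = proj₁ (integerPart (a₁* / 2#))
        z₀ = proj₁ (integerPart (a₀* / 4#))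

        a₂≈ : a₂ ≈ 2# * (Aʳ + fromℕ (toℕ i))
        a₂≈ = trans (fromℤ-double (+ (A ℕ.+ toℕ i))) (*-congˡ (fromℕ-+ A (toℕ i)))

        a₂≥ : 2# * Aʳ ≤ a₂
        a₂≥ = ≤-by (diff≈ (sym a₂≈) ⊞ scale≤ 1 (0≤fromℕ (toℕ i)))
          (solve 3 (λ a b c → a :- num 2 :* b := a :- num 2 :* (b :+ c) :+ num 2 :* c) refl a₂ Aʳ
          (fromℕ (toℕ i)))

        a₂≤ : ∣ a₂ ∣ ≤ 4# * Aʳ
        a₂≤ = ∣x∣≤
          (≤-by (diff≈ a₂≈ ⊞ scale≤ 1 (diff≤ (fromℕ-mono-≤ (ℕ.<⇒≤ (Fin.toℕ<n i)))))
            (solve 3 (λ a b c → num 4 :* a :- b := num 2 :* (a :+ c) :- b :+ num 2 :* (a :- c))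
            refl Aʳ a₂ (fromℕ (toℕ i))))
          (≤-by (diff≤ a₂≥ ⊞ scale≤ 5 (0≤A))
            (solve 2 (λ a b → num 4 :* a :- :- b := b :- num 2 :* a :+ num 6 :* a) refl Aʳ a₂))

        digits≤ : ∀ {l} (h : Vec (Fin A′) l) →
          VecAll.All (λ z → ∣ fromℤ z ∣ ≤ 2# * A′ʳ) (Vec.map (λ d → + 2 ℤ.* + toℕ d) h)
        digits≤ []      = []
        digits≤ (d ∷ h) = ≤-respˡ (abs-cong (sym (fromℤ-double (+ toℕ d)))) (∣x∣≤
          (≤-by (scale≤ 1 (diff≤ (fromℕ-mono-≤ (ℕ.<⇒≤ (Fin.toℕ<n d)))))
            (solve 2 (λ a b → num 2 :* a :- num 2 :* b := num 2 :* (a :- b)) refl A′ʳ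
            (fromℕ (toℕ d))))
          (≤-by (scale≤ 1 (0≤fromℕ (toℕ d)) ⊞ scale≤ 1 (diff≤ 1≤A′) ⊞ weaken (0<⌜suc⌝ 1))
            (solve 2 (λ a b → num 2 :* a :- :- (num 2 :* b) := num 2 :* b :+ num 2 :*
            (a :- num 1) :+ num 2) refl A′ʳ (fromℕ (toℕ d))))) ∷ digits≤ h

        r≤ : ∀ {H} → 2# * A′ʳ ≤ H → All (λ a → ∣ a ∣ ≤ H) r
        r≤ {H} 2A′≤H = monic-bounded (≤-by (diff≤ 2A′≤H ⊞ scale≤ 1 (diff≤ 1≤A′) ⊞ weaken 0<1)
          (solve 2 (λ H a → H :- num 1 := H :- num 2 :* a :+ num 2 :* (a :- num 1) :+ num 1) refl H
          A′ʳ)) (VecAll.map (λ le → ≤-trans le 2A′≤H) (digits≤ g))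

        zero≤ : ∀ {H} → 0# ≤ H → ∣ 0# ∣ ≤ H
        zero≤ = ≤-respˡ (sym (abs-nonneg ≤-refl))

        length-p : 3 ℕ.+ List.length r ≡ suc n
        length-p = cong (3 ℕ.+_) (monic-length (evenDigits g))

        p≤ : All (λ a → ∣ a ∣ ≤ 4# * Aʳ) p
        p≤ = zero≤ 0≤4A ∷ zero≤ 0≤4A ∷ a₂≤ ∷
          r≤ (≤-by (diff≤ A′≤A ⊞ scale≤ 2 (0≤A))
          (solve 2 (λ a b → num 4 :* a :- num 2 :* b := a :- num 2 :* b :+ num 3 :* a) refl Aʳ A′ʳ))

        slope≤ : ∣ slope ∣ ≤ V
        slope≤ = subst (λ l → ∣ slope ∣ ≤ 4# * Aʳ * B l) length-p
          (Δ-bound 0≤4A {p} p≤ (≤M₀⇒≤M (x≤M₀ k)) (≤M₀⇒≤M (y≤M₀ k)))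

        value≤ : ∣ evalʳ p (x k) ∣ ≤ V
        value≤ = subst (λ l → ∣ evalʳ p (x k) ∣ ≤ 4# * Aʳ * B l) length-p
          (evalʳ-bound 0≤4A {p} p≤ (≤M₀⇒≤M (x≤M₀ k)))

        a₀*≤ : ∣ a₀* ∣ ≤ V * (1# + M)
        a₀*≤ = ≤-respʳ (solve 2 (λ M V → M :* V :+ V := V :* (num 1 :+ M)) refl M V)
          (abs-+-≤ (abs-*-≤ (≤M₀⇒≤M (x≤M₀ k)) slope≤)
          (∣x∣≤ (≤-by (diff≤ (abs≤⇒-≤ value≤))
            (solve 2 (λ V a → V :- :- a := V :- :- a) refl V (evalʳ p (x k))))
            (≤-by (diff≤ (abs≤⇒≤ value≤)) (solve 2 (λ V a → V :- :- (:- a) := V :- a) refl V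
            (evalʳ p (x k))))))

        -- The second divided difference of t² is 1, so a₂ contributes itself, at least 2A; by the
        -- choice of `β` the higher terms take away at most A.
        curvature : ∀ {t} → ∣ t ∣ ≤ M → Aʳ ≤ Δ² p (x k) (y k) t
        curvature {t} t≤M = ≤-by (diff≈ (sym expand) ⊞ diff≤ a₂≥ ⊞ diff≤ (abs≤⇒-≤ rest≤))
          (solve 4 (λ a b c d → a :- b := a :- (c :+ d) :+ (c :- num 2 :* b) :+ (b :- :- d))
          refl (Δ² p (x k) (y k) t) Aʳ a₂ (Δ² p₀ (x k) (y k) t))
          where
          p₀ : List ℝ
          p₀ = 0# ∷ 0# ∷ 0# ∷ r
          expand : Δ² p (x k) (y k) t ≈ a₂ + Δ² p₀ (x k) (y k) t
          expand = solve 7 (λ a t f b d c e →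
            a :+ t :* f :+ b :* (f :+ b :* d) :+ c :* (f :+ b :* d :+ c :* (d :+ c :* e)) := a :+
            (num 0 :+ t :* f :+ b :* (f :+ b :* d) :+ c :* (f :+ b :* d :+ c :* (d :+ c :* e))))
            refl a₂ t f (y k) d (x k) e
            where
            f d e : ℝ
            f = evalʳ r t
            d = Δ r (y k) t
            e = Δ² r (x k) (y k) t
          0≤2A′ : 0# ≤ 2# * A′ʳ
          0≤2A′ = ≤-by (scale≤ 1 (diff≤ 1≤A′) ⊞ weaken (0<⌜suc⌝ 1))
            (solve 1 (λ a → num 2 :* a :- num 0 := num 2 :* (a :- num 1) :+ num 2) refl A′ʳ)
          rest≤ : ∣ Δ² p₀ (x k) (y k) t ∣ ≤ Aʳ
          rest≤ = ≤-trans (subst (λ l → ∣ Δ² p₀ (x k) (y k) t ∣ ≤ 2# * A′ʳ * B l) length-p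
              (Δ²-bound 0≤2A′ {p₀} (zero≤ 0≤2A′ ∷ zero≤ 0≤2A′ ∷ zero≤ 0≤2A′ ∷ r≤ ≤-refl)
                (≤M₀⇒≤M (x≤M₀ k)) (≤M₀⇒≤M (y≤M₀ k)) t≤M))
            (≤-by (diff≈ (sym A≈) ⊞ *-nonneg 0≤2A′ (weaken (diff< B′<Γ)))
              (solve 4 (λ a b c Γ → a :- num 2 :* b :* c := a :- num 2 :* Γ :* b :+ num 2 :* b :*
              (Γ :- c)) refl Aʳ A′ʳ B′ Γ))

      module Candidate (k : Fin K) (i : Fin A) (g : Vec (Fin A′) m) (u v : Fin U) where
        open Interpolation k i g

        half : ℤ
        half = + 2 ℤ.* (z₀ ℤ.+ + toℕ v) ℤ.+ 1ℤ

        w : Vec ℤ n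
        w = + 2 ℤ.* half ∷ + 2 ℤ.* (z₁ ℤ.+ + toℕ u) ∷ second i ∷ evenDigits g

        P : ℤ[t]
        P = monicPolynomial w

        Pʳ : List ℝ
        Pʳ = List.map fromℤ P

        uʳ vʳ a₁ a₀ : ℝ
        uʳ = fromℕ (toℕ u)
        vʳ = fromℕ (toℕ v)
        a₁ = fromℤ (+ 2 ℤ.* (z₁ ℤ.+ + toℕ u))
        a₀ = fromℤ (+ 2 ℤ.* half)

        a₁≈ : a₁ ≈ 2# * (fromℤ z₁ + uʳ)
        a₁≈ = trans (fromℤ-double (z₁ ℤ.+ + toℕ u)) (*-congˡ (fromℤ-+ z₁ (+ toℕ u)))

        a₀≈ : a₀ ≈ 2# * (2# * (fromℤ z₀ + vʳ) + (1# + 0#))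
        a₀≈ = trans (fromℤ-double half) (*-congˡ (trans (fromℤ-+ (+ 2 ℤ.* (z₀ ℤ.+ + toℕ v)) 1ℤ)
          (+-congʳ (trans (fromℤ-double (z₀ ℤ.+ + toℕ v)) (*-congˡ (fromℤ-+ z₀ (+ toℕ v)))))))

        u<U : 1# + uʳ ≤ Uʳ
        u<U = fromℕ-mono-≤ (Fin.toℕ<n u)

        v<U : 1# + vʳ ≤ Uʳ
        v<U = fromℕ-mono-≤ (Fin.toℕ<n v)

        e₁≤ : ∣ a₁ - a₁* ∣ ≤ 4# * Uʳ
        e₁≤ = ∣x∣≤
          (≤-by (diff≈ a₁≈ ⊞ diff≈ (*-/-cancel (0<⌜suc⌝ 1)) ⊞ scale≤ 1
            (diff≤ (proj₁ (proj₂ (integerPart (a₁* / 2#))))) ⊞ scale≤ 1 (diff≤ u<U) ⊞ scale≤ 1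
            (diff≤ 1≤U) ⊞ weaken (0<⌜suc⌝ 3))
            (solve 6 (λ a b c d e f → num 4 :* a :- (b :- c) := num 2 :* (d :+ e) :- b :+
            (c :- num 2 :* f) :+ num 2 :* (f :- d) :+ num 2 :* (a :- (num 1 :+ e)) :+ num 2 :*
            (a :- num 1) :+ num 4) refl Uʳ a₁ a₁* (fromℤ z₁) uʳ (a₁* / 2#)))
          (≤-by (diff≈ (sym a₁≈) ⊞ diff≈ (sym (*-/-cancel (0<⌜suc⌝ 1))) ⊞ weaken
            (scale< 1 (diff< (proj₂ (proj₂ (integerPart (a₁* / 2#)))))) ⊞ scale≤ 1
            (0≤fromℕ (toℕ u)) ⊞ scale≤ 3 (diff≤ 1≤U) ⊞ weaken (0<⌜suc⌝ 1))
            (solve 6 (λ a b c d e f → num 4 :* a :- :- (b :- c) := b :- num 2 :* (d :+ e) :+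
            (num 2 :* f :- c) :+ num 2 :* (d :+ num 1 :- f) :+ num 2 :* e :+ num 4 :*
            (a :- num 1) :+ num 2) refl Uʳ a₁ a₁* (fromℤ z₁) uʳ (a₁* / 2#)))

        e₀≤ : ∣ a₀ - a₀* ∣ ≤ 4# * Uʳ
        e₀≤ = ∣x∣≤
          (≤-by (diff≈ a₀≈ ⊞ diff≈ (*-/-cancel (0<⌜suc⌝ 3)) ⊞ scale≤ 3
            (diff≤ (proj₁ (proj₂ (integerPart (a₀* / 4#))))) ⊞ scale≤ 3 (diff≤ v<U) ⊞ weaken
            (0<⌜suc⌝ 1)) (solve 6 (λ a b c d e f →
            num 4 :* a :- (b :- c) := num 2 :* (num 2 :* (d :+ e) :+ (num 1 :+ num 0)) :- b :+
            (c :- num 4 :* f) :+ num 4 :* (f :- d) :+ num 4 :* (a :- (num 1 :+ e)) :+ num 2) refl Uʳ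
            a₀ a₀* (fromℤ z₀) vʳ (a₀* / 4#)))
          (≤-by (diff≈ (sym a₀≈) ⊞ diff≈ (sym (*-/-cancel (0<⌜suc⌝ 3))) ⊞ weaken
            (scale< 3 (diff< (proj₂ (proj₂ (integerPart (a₀* / 4#)))))) ⊞ scale≤ 3
            (0≤fromℕ (toℕ v)) ⊞ scale≤ 3 (diff≤ 1≤U) ⊞ weaken (0<⌜suc⌝ 1))
            (solve 6 (λ a b c d e f → num 4 :* a :- :- (b :- c) := b :- num 2 :*
            (num 2 :* (d :+ e) :+ (num 1 :+ num 0)) :+ (num 4 :* f :- c) :+ num 4 :*
            (d :+ num 1 :- f) :+ num 4 :* e :+ num 4 :* (a :- num 1) :+ num 2) refl Uʳ a₀ a₀*
            (fromℤ z₀) vʳ (a₀* / 4#)))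

        factored : ∀ t → evalʳ Pʳ t ≈ (t - x k) * ((t - y k) * Δ² p (x k) (y k) t) +
          ((a₁ - a₁*) * t + (a₀ - a₀*))
        factored t = trans (solve 4 (λ a t b c →
          a :+ t :* (b :+ t :* c) := a :+ b :* t :+ (num 0 :+ t :* (num 0 :+ t :* c))) refl a₀ t a₁
          (evalʳ (a₂ ∷ r) t))
          (trans (+-congˡ (trans (Δ-spec p (x k) t) (+-congˡ (*-congˡ (Δ²-spec p (x k) (y k) t)))))
          (solve 8 (λ a b t c d e f g → a :+ b :* t :+ (c :+ (t :- d) :* (e :+ (t :- f) :* g)) :=
            (t :- d) :* ((t :- f) :* g) :+ ((b :- :- e) :* t :+ (a :- (d :* e :- c)))) refl a₀ a₁ t
            (evalʳ p (x k)) (x k) slope (y k) (Δ² p (x k) (y k) t)))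

        error≤ : ∀ {t} → ∣ t ∣ ≤ M → ∣ (a₁ - a₁*) * t + (a₀ - a₀*) ∣ ≤ E
        error≤ t≤M = ≤-respʳ (solve 2 (λ a M →
          num 4 :* a :* M :+ num 4 :* a := num 4 :* a :* (num 1 :+ M)) refl Uʳ M)
          (abs-+-≤ (abs-*-≤ e₁≤ t≤M) e₀≤)

        ε≤x-y : ε ≤ ∣ x k - y k ∣
        ε≤x-y = gap (x k) (x∈window k)

        2q≤ε : 2# * q ≤ ε
        2q≤ε = ≤-by (diff≤ 4q≤ε ⊞ weaken (scale< 1 (0<q)))
          (solve 2 (λ ε q → ε :- num 2 :* q := ε :- num 4 :* q :+ num 2 :* q) refl ε q)

        root₁ : ∃[ z ] ∣ z - x k ∣ ≤ q × evalʳ Pʳ z ≈ 0#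
        root₁ = root-near Pʳ 0<q 2q≤ε ε≤x-y 0≤A E-small λ t close →
          Δ² p (x k) (y k) t , (a₁ - a₁*) * t + (a₀ - a₀*) , curvature (near⇒≤M (x≤M₀ k) close) ,
            error≤ (near⇒≤M (x≤M₀ k) close) , factored t

        root₂ : ∃[ z ] ∣ z - y k ∣ ≤ q × evalʳ Pʳ z ≈ 0#
        root₂ = root-near Pʳ 0<q 2q≤ε (≤-respʳ (abs-swap (x k) (y k)) ε≤x-y) 0≤A E-small λ t close →
          Δ² p (x k) (y k) t , (a₁ - a₁*) * t + (a₀ - a₀*) , curvature (near⇒≤M (y≤M₀ k) close) ,
            error≤ (near⇒≤M (y≤M₀ k) close) ,
          trans (factored t) (+-congʳ (solve 4
            (λ t a b c → (t :- a) :* ((t :- b) :* c) := (t :- b) :* ((t :- a) :* c)) refl t (x k)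
            (y k) (Δ² p (x k) (y k) t)))

        α₁ α₂ : ℝ
        α₁ = proj₁ root₁
        α₂ = proj₁ root₂

        α₁-near : ∣ α₁ - x k ∣ ≤ q
        α₁-near = proj₁ (proj₂ root₁)

        α₂-near : ∣ α₂ - y k ∣ ≤ q
        α₂-near = proj₁ (proj₂ root₂)

        eval-α₁ : eval P α₁ ≈ 0#
        eval-α₁ = trans (reflexive (eval≡evalʳ P α₁)) (proj₂ (proj₂ root₁))

        eval-α₂ : eval P α₂ ≈ 0#
        eval-α₂ = trans (reflexive (eval≡evalʳ P α₂)) (proj₂ (proj₂ root₂))

        -- The roots lie within q of two points that are at least 4q apart.
        distinct : ¬ (α₁ ≈ α₂)
        distinct α₁≈α₂ = <⇒≱ (<-by (scale< 1 (0<q) ⊕ diff≤ close ⊕ diff≤ 4q≤ε)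
          (solve 3 (λ ε a q → ε :- a := num 2 :* q :+ (num 2 :* q :- a) :+ (ε :- num 4 :* q)) refl ε
          (∣ x k - y k ∣) q)) ε≤x-y
          where
          close : ∣ x k - y k ∣ ≤ 2# * q
          close = ∣x∣≤
            (≤-by (diff≤ (abs≤⇒-≤ α₁-near) ⊞ diff≤ (abs≤⇒≤ α₂-near) ⊞ diff≈ α₁≈α₂)
              (solve 5 (λ q a b c d → num 2 :* q :- (a :- b) := q :- :- (c :- a) :+
              (q :- (d :- b)) :+ (d :- c)) refl q (x k) (y k) α₁ α₂))
            (≤-by (diff≤ (abs≤⇒≤ α₁-near) ⊞ diff≤ (abs≤⇒-≤ α₂-near) ⊞ diff≈ (sym α₁≈α₂))
              (solve 5 (λ q a b c d → num 2 :* q :- :- (a :- b) := q :- (c :- a) :+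
              (q :- :- (d :- b)) :+ (c :- d)) refl q (x k) (y k) α₁ α₂))

        even-double : ∀ z → Even (+ 2 ℤ.* z)
        even-double z = divides z (ℤ.*-comm (+ 2) z)

        digits-even : ∀ {l} (h : Vec (Fin A′) l) →
          VecAll.All Even (Vec.map (λ d → + 2 ℤ.* + toℕ d) h)
        digits-even []      = []
        digits-even (d ∷ h) = even-double (+ toℕ d) ∷ digits-even h

        odd : ∀ z → ¬ Even (+ 2 ℤ.* z ℤ.+ 1ℤ)
        odd z even = 2∤1 (subst Even (cancel (+ 2 ℤ.* z)) (∣m∣n⇒∣m-n even (even-double z)))
          where
          2∤1 : ¬ Even 1ℤ
          2∤1 2∣1 = contradiction (ℕ.∣⇒≤ (∣⇒∣ᵤ 2∣1)) λ { (s≤s ()) }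
          cancel : ∀ z → z ℤ.+ 1ℤ ℤ.- z ≡ 1ℤ
          cancel = solve-∀

        isEisenstein : Eisenstein n (coeff 0ℤ P)
        isEisenstein = record
          { leading  = subst (¬_ ∘ Even) (≡.sym (coeff-leading w)) (odd 0ℤ)
          ; lower    = coeff-lower {P = Even} {w}
            (even-double half ∷ even-double (z₁ ℤ.+ + toℕ u) ∷ even-double (+ (A ℕ.+ toℕ i)) ∷
            digits-even g)
          ; above    = coeff-above w
          ; half     = half
          ; constant = ℤ.*-comm (+ 2) half
          ; half-odd = odd (z₀ ℤ.+ + toℕ v)
          }

        minimal : IsMinimalPolynomial n P (α₁ , α₂)
        minimal = record
          { monic       = record { leading = coeff-leading w ; above = coeff-above w _ }
          ; irreducible = eisenstein-irreducible (s≤s z≤n) isEisenstein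
          ; root₁       = eval-α₁
          ; root₂       = eval-α₂
          ; distinct    = distinct
          }

        a₁≤Q : ∣ a₁ ∣ ≤ Q
        a₁≤Q = ∣x∣≤
          (≤-by/ 1 (scale≤ 1 (diff≤ (abs≤⇒≤ e₁≤)) ⊞ scale≤ 1
            (diff≤ (abs≤⇒-≤ slope≤)) ⊞ diff≤ 8U≤Q ⊞ diff≤ 2V[1+M]≤Q ⊞ scale≤ 1 (*-nonneg 0≤V 0≤M))
            (solve 6 (λ Q a b c V M → num 2 :* (Q :- a) := num 2 :*
            (num 4 :* b :- (a :- :- c)) :+ num 2 :* (V :- :- c) :+ (Q :- num 8 :* b) :+
            (Q :- num 2 :* (V :* (num 1 :+ M))) :+ num 2 :* (V :* M)) refl Q a₁ Uʳ slope V M))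
          (≤-by/ 1 (scale≤ 1 (diff≤ (abs≤⇒-≤ e₁≤)) ⊞ scale≤ 1
            (diff≤ (abs≤⇒≤ slope≤)) ⊞ diff≤ 8U≤Q ⊞ diff≤ 2V[1+M]≤Q ⊞ scale≤ 1 (*-nonneg 0≤V 0≤M))
            (solve 6 (λ Q a b c V M → num 2 :* (Q :- :- a) := num 2 :*
            (num 4 :* b :- :- (a :- :- c)) :+ num 2 :* (V :- c) :+ (Q :- num 8 :* b) :+
            (Q :- num 2 :* (V :* (num 1 :+ M))) :+ num 2 :* (V :* M)) refl Q a₁ Uʳ slope V M))

        a₀≤Q : ∣ a₀ ∣ ≤ Q
        a₀≤Q = ∣x∣≤
          (≤-by/ 1 (scale≤ 1 (diff≤ (abs≤⇒≤ e₀≤)) ⊞ scale≤ 1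
            (diff≤ (abs≤⇒≤ a₀*≤)) ⊞ diff≤ 8U≤Q ⊞ diff≤ 2V[1+M]≤Q)
            (solve 6 (λ Q a b c V M → num 2 :* (Q :- a) := num 2 :*
            (num 4 :* b :- (a :- c)) :+ num 2 :* (V :* (num 1 :+ M) :- c) :+ (Q :- num 8 :* b) :+
            (Q :- num 2 :* (V :* (num 1 :+ M)))) refl Q a₀ Uʳ a₀* V M))
          (≤-by/ 1 (scale≤ 1 (diff≤ (abs≤⇒-≤ e₀≤)) ⊞ scale≤ 1
            (diff≤ (abs≤⇒-≤ a₀*≤)) ⊞ diff≤ 8U≤Q ⊞ diff≤ 2V[1+M]≤Q)
            (solve 6 (λ Q a b c V M → num 2 :* (Q :- :- a) := num 2 :*
            (num 4 :* b :- :- (a :- c)) :+ num 2 :* (V :* (num 1 :+ M) :- :- c) :+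
            (Q :- num 8 :* b) :+ (Q :- num 2 :* (V :* (num 1 :+ M)))) refl Q a₀ Uʳ a₀* V M))

        4A≤Q : 4# * Aʳ ≤ Q
        4A≤Q = ≤-by (diff≤ 2V[1+M]≤Q ⊞ scale≤ 1 (*-nonneg 0≤4A (diff≤ 1≤B′)) ⊞ scale≤ 1
          (*-nonneg 0≤V 0≤M) ⊞ 0≤4A) (solve 4
          (λ Q a b M → Q :- num 4 :* a := Q :- num 2 :*
          (num 4 :* a :* b :* (num 1 :+ M)) :+ num 2 :* (num 4 :* a :* (b :- num 1)) :+ num 2 :*
          (num 4 :* a :* b :* M) :+ num 4 :* a) refl Q Aʳ B′ M)

        P-height : fromℕ (height P) ≤ Q
        P-height = ≤-trans (fromℕ-mono-≤
          (monicPolynomial-height (below 1ℤ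
          (≤-respˡ (sym (abs-nonneg (weaken (0<1 ⊕ ≤-refl))))
          (≤-by (weaken (diff< 1<Q)) (solve 1 (λ Q → Q :- (num 1 :+ num 0) := Q :- num 1) refl Q))))
            (VecAll.map (λ {z} → below z) bounded)))
          (proj₁ (proj₂ ⌊ weaken 0<Q ⌋ℕ))
          where
          bounded : VecAll.All (λ z → ∣ fromℤ z ∣ ≤ Q) w
          bounded = a₀≤Q ∷ a₁≤Q ∷ ≤-trans a₂≤ 4A≤Q ∷ VecAll.map (λ le → ≤-trans le
            (≤-by (diff≤ A′≤A ⊞ diff≤ 4A≤Q ⊞ scale≤ 2 (0≤A))
              (solve 3 (λ Q a b → Q :- num 2 :* a := b :- num 2 :* a :+
              (Q :- num 4 :* b) :+ num 3 :* b) refl Q A′ʳ Aʳ))) (digits≤ g)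
          below : ∀ z → ∣ fromℤ z ∣ ≤ Q → ℤ.∣ z ∣ ℕ.≤ proj₁ ⌊ weaken 0<Q ⌋ℕ
          below z z≤Q = ℕ.s≤s⁻¹ (fromℕ-cancel-<
            (≤-<-trans (≤-trans (fromℤ-abs z) z≤Q) (proj₂ (proj₂ ⌊ weaken 0<Q ⌋ℕ))))

        α₁∈J : α₁ ∈ J
        α₁∈J = window α₁ (near-x⇒window k α₁-near)

        -- Moving from the grid point to α₁ changes φ by at most L q, and α₂ is within q of the old
        -- value; the remaining q in (L + 2) q makes the inequality strict.
        near : ∣ φ ⟨ α₁ , J⊆J₀ α₁∈J ⟩ - α₂ ∣ < c₁ * q
        near = ∣x∣<
          (<-by (0<q ⊕ diff≤ (abs≤⇒≤ sy) ⊕ diff≤ (abs≤⇒-≤ α₂-near) ⊕ *-nonneg (weaken 0<q)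
            (diff≤ L+2≤c₁)) (solve 6 (λ a q s b L c →
            a :* q :- (s :- b) := q :+ (L :* q :- (s :- c)) :+ (q :- :- (b :- c)) :+ q :*
            (a :- (L :+ num 2))) refl c₁ q s α₂ L (y k)))
          (<-by (0<q ⊕ diff≤ (abs≤⇒-≤ sy) ⊕ diff≤ (abs≤⇒≤ α₂-near) ⊕ *-nonneg (weaken 0<q)
            (diff≤ L+2≤c₁)) (solve 6 (λ a q s b L c →
            a :* q :- :- (s :- b) := q :+ (L :* q :- :- (s :- c)) :+ (q :- (b :- c)) :+ q :*
            (a :- (L :+ num 2))) refl c₁ q s α₂ L (y k)))
          where
          s : ℝ
          s = φ ⟨ α₁ , J⊆J₀ α₁∈J ⟩
          sy : ∣ s - y k ∣ ≤ L * q
          sy = ≤-trans (φ-lipschitz (J⊆J₀ α₁∈J) (x∈J₀ k)) (*-monoˡ-≤ L 0≤L α₁-near)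

        point : Σ (ℝ × ℝ) Target
        point = (α₁ , α₂) , (P , minimal , P-height) , α₁∈J , near

      same-cell : ∀ {k k′ s s′} → ∣ s - x k ∣ ≤ q → ∣ s′ - x k′ ∣ ≤ q → s ≈ s′ → k ≡ k′
      same-cell {k} {k′} {s} {s′} close close′ s≈s′ = Fin.toℕ-injective (ℕ.≤-antisym
          (ordered {k} {k′} {s} {s′} close close′ s≈s′)
            (ordered {k′} {k} {s′} {s} close′ close (sym s≈s′)))
        where
        ordered : ∀ {k k′ s s′} → ∣ s - x k ∣ ≤ q → ∣ s′ - x k′ ∣ ≤ q → s ≈ s′ → toℕ k ℕ.≤ toℕ k′
        ordered {k} {k′} {s} {s′} close close′ s≈s′ = ℕ.≮⇒≥ λ k′<k →
          <⇒≱ (<-by 0<q (solve 1 (λ q → num 3 :* q :- num 2 :* q := q) refl q))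
          (≤-by (diff≤ (abs≤⇒-≤ close) ⊞ diff≤ (abs≤⇒≤ close′) ⊞ diff≈ s≈s′ ⊞ scale≤ 2
            (*-nonneg (weaken 0<q) (diff≤ (fromℕ-mono-≤ k′<k))))
            (solve 6 (λ q s a b c d → num 2 :* q :- num 3 :* q := q :- :-
            (s :- (a :+ num 3 :* q :* b)) :+ (q :- (c :- (a :+ num 3 :* q :* d))) :+
            (c :- s) :+ num 3 :* (q :* (b :- (num 1 :+ d)))) refl q s x₀ (fromℕ (toℕ k)) s′
            (fromℕ (toℕ k′))))

      double-injective : ∀ {z z′} → + 2 ℤ.* z ≡ + 2 ℤ.* z′ → z ≡ z′
      double-injective = ℤ.*-cancelˡ-≡ (+ 2) _ _

      second-injective : ∀ {i i′} → second i ≡ second i′ → i ≡ i′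
      second-injective {i} {i′} eq =
        Fin.toℕ-injective (ℕ.+-cancelˡ-≡ A _ _
        (ℤ.+-injective (double-injective {+ (A ℕ.+ toℕ i)} {+ (A ℕ.+ toℕ i′)} eq)))

      evenDigits-injective : ∀ {l} (h h′ : Vec (Fin A′) l) →
        Vec.map (λ d → + 2 ℤ.* + toℕ d) h ≡ Vec.map (λ d → + 2 ℤ.* + toℕ d) h′ → h ≡ h′
      evenDigits-injective []      []        _  = ≡.refl
      evenDigits-injective (d ∷ h) (d′ ∷ h′) eq = cong₂ _∷_
        (Fin.toℕ-injective (ℤ.+-injective
          (double-injective {+ toℕ d} {+ toℕ d′} (cong Vec.head eq))))
          (evenDigits-injective h h′ (cong Vec.tail eq))

      offset-injective : ∀ z {u u′ : Fin U} → z ℤ.+ + toℕ u ≡ z ℤ.+ + toℕ u′ → u ≡ u′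
      offset-injective z eq = Fin.toℕ-injective (ℤ.+-injective (ℤ-cancelˡ z _ _ eq))

      Parameters : Set
      Parameters = Fin K × Fin A × Vec (Fin A′) m × Fin U × Fin U

      candidate : Parameters → Σ (ℝ × ℝ) Target
      candidate (k , i , g , u , v) = Candidate.point k i g u v

      -- The first coordinate alone determines everything: its position gives k, and `common-root`
      -- gives the polynomial. The coefficients from a₂ upwards give i and g; only then are `z₁` and
      -- `z₀` known to agree, so that u and v can be read off.
      candidate-injective : ∀ c c′ → Setoid._≈_ ℝ² (proj₁ (candidate c)) (proj₁ (candidate c′)) →
        c ≡ c′
      candidate-injective (k , i , g , u , v) (k′ , i′ , g′ , u′ , v′) (α₁≈α₁′ , _) =
          conclude (same-cell {k} {k′} C.α₁-near C′.α₁-near α₁≈α₁′)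
            (common-root C.w C′.w C.isEisenstein C.eval-α₁ C′.eval-α₁ α₁≈α₁′)
        where
        module C = Candidate k i g u v
        module C′ = Candidate k′ i′ g′ u′ v′
        module U = Interpolation k i g
        conclude : k ≡ k′ → C.w ≡ C′.w → (k , i , g , u , v) ≡ (k′ , i′ , g′ , u′ , v′)
        conclude ≡.refl w≡w′ = step (second-injective {i} {i′}
          (cong (Vec.head ∘ Vec.tail ∘ Vec.tail) w≡w′))
          (evenDigits-injective g g′ (cong (Vec.tail ∘ Vec.tail ∘ Vec.tail) w≡w′))
            (cong Vec.head w≡w′) (cong (Vec.head ∘ Vec.tail) w≡w′)
          where
          step : i ≡ i′ → g ≡ g′ → + 2 ℤ.* C.half ≡ + 2 ℤ.* C′.half →
            + 2 ℤ.* (Interpolation.z₁ k i g ℤ.+ + toℕ u) ≡ + 2 ℤ.*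
              (Interpolation.z₁ k i′ g′ ℤ.+ + toℕ u′) →
            (k , i , g , u , v) ≡ (k , i′ , g′ , u′ , v′)
          step ≡.refl ≡.refl w₀ w₁ = cong₂ (λ u v → k , i , g , u , v)
            (offset-injective U.z₁ (double-injective {U.z₁ ℤ.+ + toℕ u} {U.z₁ ℤ.+ + toℕ u′} w₁))
            (offset-injective U.z₀ (double-injective {U.z₀ ℤ.+ + toℕ v} {U.z₀ ℤ.+ + toℕ v′}
              (ℤ-cancelʳ 1ℤ _ _ (double-injective {C.half} {C′.half} w₀))))

      N N₁ N₂ N₃ : ℕ
      N₃ = U ℕ.* U
      N₂ = A′ ℕ.^ m ℕ.* N₃
      N₁ = A ℕ.* N₂
      N  = K ℕ.* N₁

      parameters : Fin N → Parameters
      parameters e = proj₁ e₁ , proj₁ e₂ , digits m (proj₁ e₃) , proj₁ e₄ , proj₂ e₄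
        where
        e₁ : Fin K × Fin N₁
        e₁ = Fin.remQuot N₁ e
        e₂ : Fin A × Fin N₂
        e₂ = Fin.remQuot N₂ (proj₂ e₁)
        e₃ : Fin (A′ ℕ.^ m) × Fin N₃
        e₃ = Fin.remQuot N₃ (proj₂ e₂)
        e₄ : Fin U × Fin U
        e₄ = Fin.remQuot U (proj₂ e₃)

      parameters-injective : ∀ {e e′} → parameters e ≡ parameters e′ → e ≡ e′
      parameters-injective eq = remQuot-injective {K} N₁ (cong₂ _,_ (cong proj₁ eq)
        (remQuot-injective {A} N₂ (cong₂ _,_ (cong (proj₁ ∘ proj₂) eq)
        (remQuot-injective {A′ ℕ.^ m} N₃
          (cong₂ _,_ (digits-injective m (cong (proj₁ ∘ proj₂ ∘ proj₂) eq))
        (remQuot-injective {U} U (cong (proj₂ ∘ proj₂ ∘ proj₂) eq)))))))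

      N≥ : c₂ * (Q ^ n * q) ≤ fromℕ N
      N≥ = ≤-respʳ (sym N≈) (≤-trans
        (≤-by (*-nonneg 0≤rest (diff≤ r≤))
          (solve 8 (λ a b Q F G c q r → a :*
          (b :* Q :* (F :* G :* (c :* (Q :* q) :* (c :* (Q :* q))))) :- r :*
          (b :* (F :* (c :* c))) :* (Q :* (Q :* (Q :* G)) :* q) := b :* (F :* (c :* c)) :*
          (Q :* (Q :* (Q :* G)) :* q) :* (q :* a :- r)) refl Kʳ c′ Q F G δ′ q r))
        (*-monoˡ-≤ Kʳ (0≤fromℕ K) (*-mono-≤ 0≤c′Q
          (*-nonneg (*-nonneg 0≤F 0≤G) (*-nonneg 0≤δ′Qq 0≤δ′Qq))
          (≤-trans c′Q≤A′ (≤-by (diff≤ A′≤A ⊞ diff≤ 1≤A′ ⊞ weaken 0<1)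
            (solve 2 (λ a b → a :- b := a :- num 2 :* b :+ (b :- num 1) :+ num 1) refl Aʳ A′ʳ)))
          (*-mono-≤ (*-nonneg 0≤F 0≤G) (*-nonneg 0≤δ′Qq 0≤δ′Qq)
            (≤-respˡ (CExp.^-distrib-* c′ Q m) (^-mono-≤ m 0≤c′Q c′Q≤A′))
            (*-mono-≤ 0≤δ′Qq 0≤δ′Qq δ′Qq≤U δ′Qq≤U)))))
        where
        F G r : ℝ
        F = c′ ^ m
        G = Q ^ m
        r = ρ / ⌜ 12 ⌝
        0≤F : 0# ≤ F
        0≤F = weaken (^-pos m 0<c′)
        0≤G : 0# ≤ G
        0≤G = weaken (^-pos m 0<Q)
        0≤c′Q : 0# ≤ c′ * Q
        0≤c′Q = weaken (*-pos 0<c′ 0<Q)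
        0≤δ′Qq : 0# ≤ δ′ * (Q * q)
        0≤δ′Qq = weaken (*-pos 0<δ′ (*-pos 0<Q 0<q))
        r≤ : r ≤ q * Kʳ
        r≤ = ≤-by/ 11 (diff≈ (*-/-cancel (0<⌜suc⌝ 11)) ⊞ diff≤ ρ≤12qK)
          (solve 4 (λ q a r ρ → num 12 :* (q :* a :- r) := ρ :- num 12 :* r :+
          (num 12 :* (q :* a) :- ρ)) refl q Kʳ r ρ)
        0≤rest : 0# ≤ (c′ * (F * (δ′ * δ′))) * ((Q * (Q * (Q * G))) * q)
        0≤rest = *-nonneg (*-nonneg (weaken 0<c′) (*-nonneg 0≤F (weaken (*-pos 0<δ′ 0<δ′))))
          (*-nonneg (weaken (^-pos n 0<Q)) (weaken 0<q))
        N≈ : fromℕ N ≈ Kʳ * (Aʳ * (A′ʳ ^ m * (Uʳ * Uʳ)))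
        N≈ = trans (fromℕ-* K N₁) (*-congˡ
          (trans (fromℕ-* A N₂) (*-congˡ
          (trans (fromℕ-* (A′ ℕ.^ m) N₃) (*-cong (fromℕ-^ A′ m) (fromℕ-* U U))))))

      lower : ∃[ N ] c₂ * (Q ^ n * q) ≤ fromℕ N ×
        Σ (Fin N → Σ (ℝ × ℝ) Target) λ f → ∀ {i j} → Setoid._≈_ ℝ² (proj₁ (f i)) (proj₁ (f j)) →
          i ≡ j
      lower = N , N≥ , candidate ∘ parameters , λ {i} {j} eq →
        parameters-injective (candidate-injective (parameters i) (parameters j) eq)

  -- Leaving the diagonal

  common-lower-bound : ∀ {u v} → 0# < u → 0# < v → ∃[ w ] 0# < w × w ≤ u × w ≤ v
  common-lower-bound {u} {v} 0<u 0<v with ≤-total u v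
  ... | inj₁ u≤v = u , 0<u , ≤-refl , u≤v
  ... | inj₂ v≤u = v , 0<v , v≤u , ≤-refl

  strict⇒≺ : ∀ e {x y} → x < y → ⟨ e ⟩ x ≺ y
  strict⇒≺ included x<y = weaken x<y
  strict⇒≺ excluded x<y = x<y

  module _ {I : Interval} (f : RealFunction I) (finite : Finite ℝ-setoid (FixedPoint f)) where

    -- If φ has N fixed points, they cannot include all of N + 1 distinct points of the interval.
    nonFixedPoint : ∀ {l r} → l < r → (∀ x → l < x → x < r → x ∈ I) → ∃[ x ] Σ (l < x × x < r) λ _ →
      Σ (x ∈ I) λ x∈ → ¬ (f ⟨ x , x∈ ⟩ ≈ x)
    nonFixedPoint {l} {r} l<r inI with em
      {∃[ x ] Σ (l < x × x < r) λ _ → Σ (x ∈ I) λ x∈ → ¬ (f ⟨ x , x∈ ⟩ ≈ x)}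
    ... | yes found = found
    ... | no  none  = contradiction
      (Counting.injection⇒≤ em ℝ-setoid (proj₂ finite) fixed injective) ℕ.1+n≰n
      where
      N : ℕ
      N = proj₁ finite
      s : ℝ
      -- N + 2 equal parts have N + 1 division points in the open interval.
      s = (r - l) / fromℕ (suc (suc N))
      0<2+N : 0# < fromℕ (suc (suc N))
      0<2+N = 0<1 ⊕ 0≤fromℕ (suc N)
      0<s : 0# < s
      0<s = /-pos (diff< l<r) 0<2+N
      x : Fin (suc N) → ℝ
      x i = l + s * fromℕ (suc (toℕ i))
      l<x : ∀ i → l < x i
      l<x i = <-by (0<s ⊕ *-nonneg (weaken 0<s) (0≤fromℕ (toℕ i)))
        (solve 3 (λ l s a → l :+ s :* (num 1 :+ a) :- l := s :+ s :* a) refl l s (fromℕ (toℕ i)))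
      x<r : ∀ i → x i < r
      x<r i = <-by (*-pos 0<s (diff< (fromℕ-mono-< (s≤s (Fin.toℕ<n i)))) ⊕ diff≈ (*-/-cancel 0<2+N))
        (solve 5 (λ r l s a b → r :- (l :+ s :* a) := s :* (b :- a) :+ (r :- l :- b :* s)) refl r l
        s (fromℕ (suc (toℕ i))) (fromℕ (suc (suc N))))
      isFixed : ∀ i (x∈ : x i ∈ I) → f ⟨ x i , x∈ ⟩ ≈ x i
      isFixed i x∈ with em {f ⟨ x i , x∈ ⟩ ≈ x i}
      ... | yes eq = eq
      ... | no neq = contradiction (x i , (l<x i , x<r i) , x∈ , neq) none
      fixed : Fin (suc N) → Σ ℝ (FixedPoint f)
      fixed i = x i , inI (x i) (l<x i) (x<r i) , isFixed i _
      ordered : ∀ {i j} → x i ≈ x j → toℕ i ℕ.≤ toℕ j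
      ordered {i} {j} xi≈xj = ℕ.≮⇒≥ λ j<i →
        <⇒≉ (<-by (*-pos 0<s (diff< (fromℕ-mono-< (s≤s j<i))))
        (solve 4 (λ l s a b → l :+ s :* a :- (l :+ s :* b) := s :* (a :- b)) refl l s
        (fromℕ (suc (toℕ i))) (fromℕ (suc (toℕ j))))) (sym xi≈xj)
      injective : ∀ {i j} → x i ≈ x j → i ≡ j
      injective {i} {j} xi≈xj = Fin.toℕ-injective
        (ℕ.≤-antisym (ordered {i} {j} xi≈xj) (ordered {j} {i} (sym xi≈xj)))

  -- Choice of the window and of the constants

  module Assembly {a b : ℝ} (φ φ′ : RealFunction (openInterval a b))
    (derivative : IsDerivativeOf φ′ φ)
    {K : ℝ} (bounded : ∀ x (x∈ : x ∈ openInterval a b) → ∣ φ′ ⟨ x , x∈ ⟩ ∣ ≤ K)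
      (finite : Finite ℝ-setoid (FixedPoint φ))
    (J : Interval) (J⊆J₀ : J ⊆ openInterval a b) (0<length : 0# < length J)
    (m : ℕ) {γ : ℝ} (0<γ : 0# < γ) (γ<1 : γ < 1#) where

    J₀ : Interval
    J₀ = openInterval a b

    n : ℕ
    n = suc (suc (suc m))

    L l r : ℝ
    L = K + 1#
    l = Interval.left J
    r = Interval.right J

    l<r : l < r
    l<r = <-by 0<length refl

    interior : ∀ x → l < x → x < r → x ∈ J
    interior x l<x x<r = between (strict⇒≺ (Interval.leftEnd J) l<x)
      (strict⇒≺ (Interval.rightEnd J) x<r)

    off-diagonal : ∃[ x ] Σ (l < x × x < r) λ _ → Σ (x ∈ J₀) λ x∈ → ¬ (φ ⟨ x , x∈ ⟩ ≈ x)
    off-diagonal = nonFixedPoint φ finite l<r λ x l<x x<r → J⊆J₀ (interior x l<x x<r)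

    x₀ : ℝ
    x₀ = proj₁ off-diagonal

    l<x₀ : l < x₀
    l<x₀ = proj₁ (proj₁ (proj₂ off-diagonal))

    x₀<r : x₀ < r
    x₀<r = proj₂ (proj₁ (proj₂ off-diagonal))

    x₀∈J₀ : x₀ ∈ J₀
    x₀∈J₀ = proj₁ (proj₂ (proj₂ off-diagonal))

    y₀ : ℝ
    y₀ = φ ⟨ x₀ , x₀∈J₀ ⟩

    a<b : a < b
    a<b = <-trans (_∈_.lower x₀∈J₀) (_∈_.upper x₀∈J₀)

    0≤L : 0# ≤ L
    0≤L = ≤-by (0≤∣x∣ (φ′ ⟨ x₀ , x₀∈J₀ ⟩) ⊞ diff≤ (bounded x₀ x₀∈J₀) ⊞ weaken 0<1)
      (solve 2 (λ K a → K :+ num 1 :- num 0 := a :+ (K :- a) :+ num 1) refl K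
      (∣ φ′ ⟨ x₀ , x₀∈J₀ ⟩ ∣))

    φ-lipschitz : ∀ {x y} (x∈ : x ∈ J₀) (y∈ : y ∈ J₀) → ∣ φ ⟨ x , x∈ ⟩ - φ ⟨ y ,
      y∈ ⟩ ∣ ≤ L * ∣ x - y ∣
    φ-lipschitz = lipschitz φ φ′ derivative bounded

    M₀ : ℝ
    M₀ = ∣ a ∣ + ∣ b ∣ + (∣ y₀ ∣ + L * (b - a))

    x-bound : ∀ x → x ∈ J₀ → ∣ x ∣ ≤ M₀
    x-bound x (between a<x x<b) = ∣x∣≤
      (≤-by (weaken (diff< x<b) ⊞ diff≤ (x≤∣x∣ b) ⊞ 0≤∣x∣ a ⊞ 0≤∣x∣ y₀ ⊞ *-nonneg 0≤L
        (weaken (diff< a<b))) (solve 7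
        (λ c d e L b a x → c :+ d :+ (e :+ L :* (b :- a)) :- x := b :- x :+
        (d :- b) :+ c :+ e :+ L :* (b :- a)) refl (∣ a ∣) (∣ b ∣) (∣ y₀ ∣) L b a x))
      (≤-by (weaken (diff< a<x) ⊞ diff≤ (-x≤∣x∣ a) ⊞ 0≤∣x∣ b ⊞ 0≤∣x∣ y₀ ⊞ *-nonneg 0≤L
        (weaken (diff< a<b))) (solve 7
        (λ c d e L b a x → c :+ d :+ (e :+ L :* (b :- a)) :- :- x := x :- a :+
        (c :- :- a) :+ d :+ e :+ L :* (b :- a)) refl (∣ a ∣) (∣ b ∣) (∣ y₀ ∣) L b a x))

    φ-bound : ∀ x (x∈ : x ∈ J₀) → ∣ φ ⟨ x , x∈ ⟩ ∣ ≤ M₀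
    φ-bound x x∈@(between a<x x<b) = ∣x∣≤
      (≤-by (diff≤ (abs≤⇒≤ y-y₀) ⊞ diff≤ (x≤∣x∣ y₀) ⊞ 0≤∣x∣ a ⊞ 0≤∣x∣ b)
        (solve 8 (λ c d e L b a y f → c :+ d :+ (e :+ L :* (b :- a)) :- y := L :* (b :- a) :-
        (y :- f) :+ (e :- f) :+ c :+ d) refl (∣ a ∣) (∣ b ∣) (∣ y₀ ∣) L b a y y₀))
      (≤-by (diff≤ (abs≤⇒-≤ y-y₀) ⊞ diff≤ (-x≤∣x∣ y₀) ⊞ 0≤∣x∣ a ⊞ 0≤∣x∣ b)
        (solve 8 (λ c d e L b a y f → c :+ d :+ (e :+ L :* (b :- a)) :- :- y := L :* (b :- a) :- :-
        (y :- f) :+ (e :- :- f) :+ c :+ d) refl (∣ a ∣) (∣ b ∣) (∣ y₀ ∣) L b a y y₀))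
      where
      y : ℝ
      y = φ ⟨ x , x∈ ⟩
      y-y₀ : ∣ y - y₀ ∣ ≤ L * (b - a)
      y-y₀ = ≤-trans (φ-lipschitz x∈ x₀∈J₀) (*-monoˡ-≤ L 0≤L (∣x∣≤
        (≤-by (weaken (diff< x<b) ⊞ weaken (diff< (_∈_.lower x₀∈J₀)))
          (solve 4 (λ b a x c → b :- a :- (x :- c) := b :- x :+ (c :- a)) refl b a x x₀))
          (≤-by (weaken (diff< a<x) ⊞ weaken (diff< (_∈_.upper x₀∈J₀)))
          (solve 4 (λ b a x c → b :- a :- :- (x :- c) := x :- a :+ (b :- c)) refl b a x x₀))))

    d : ℝ
    d = ∣ x₀ - y₀ ∣

    0<d : 0# < d
    0<d = positive (0≤∣x∣ (x₀ - y₀))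
      where
      positive : 0# ≤ d → 0# < d
      positive (inj₁ 0<d) = 0<d
      positive (inj₂ 0≈d) = contradiction (≤-antisym
        (≤-by (diff≤ (-x≤∣x∣ (x₀ - y₀)) ⊞ diff≈ (sym 0≈d))
          (solve 3 (λ a b d → a :- b := d :- :- (a :- b) :+ (num 0 :- d)) refl x₀ y₀ d))
        (≤-by (diff≤ (x≤∣x∣ (x₀ - y₀)) ⊞ diff≈ (sym 0≈d))
          (solve 3 (λ a b d → a :- b := d :- (b :- a) :+ (num 0 :- d)) refl y₀ x₀ d)))
          (proj₂ (proj₂ (proj₂ off-diagonal)))

    half : ∀ {z} → 0# < z → 0# < z / 2#
    half 0<z = /-pos 0<z (0<⌜suc⌝ 1)

    ε-choice : ∃[ ε ] 0# < ε × ε ≤ d / 2# × ε ≤ 1#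
    ε-choice = common-lower-bound (half 0<d) 0<1

    ε : ℝ
    ε = proj₁ ε-choice

    0<1+L : 0# < 1# + L
    0<1+L = 0<1 ⊕ 0≤L

    inner : ∃[ ρ ] 0# < ρ × ρ ≤ (x₀ - l) / 2# × ρ ≤ (r - x₀) / 2#
    inner = common-lower-bound (half (diff< l<x₀)) (half (diff< x₀<r))

    -- Moving x by ρ changes x - φ(x) by at most (1 + L) ρ ≤ d/2, so half of the gap at `x₀`
    -- survives on the window.
    ρ-choice : ∃[ ρ ] 0# < ρ × ρ ≤ proj₁ inner × ρ ≤ (d / 2#) / (1# + L)
    ρ-choice = common-lower-bound (proj₁ (proj₂ inner)) (/-pos (half 0<d) 0<1+L)

    ρ : ℝ
    ρ = proj₁ ρ-choice

    window : ∀ x → ∣ x - x₀ ∣ ≤ ρ → x ∈ J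
    window x close = interior x
      (<-by/ 1 (diff< l<x₀ ⊕ scale≤ 1 (diff≤ (abs≤⇒-≤ close)) ⊕ scale≤ 1
        (diff≤ (proj₁ (proj₂ (proj₂ ρ-choice)))) ⊕ scale≤ 1
        (diff≤ (proj₁ (proj₂ (proj₂ inner)))) ⊕ diff≈ (*-/-cancel (0<⌜suc⌝ 1)))
        (solve 6 (λ x l a ρ b c → num 2 :* (x :- l) := a :- l :+ num 2 :*
        (ρ :- :- (x :- a)) :+ num 2 :* (b :- ρ) :+ num 2 :* (c :- b) :+ (a :- l :- num 2 :* c))
        refl x l x₀ ρ (proj₁ inner) ((x₀ - l) / 2#)))
      (<-by/ 1 (diff< x₀<r ⊕ scale≤ 1 (diff≤ (abs≤⇒≤ close)) ⊕ scale≤ 1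
        (diff≤ (proj₁ (proj₂ (proj₂ ρ-choice)))) ⊕ scale≤ 1
        (diff≤ (proj₂ (proj₂ (proj₂ inner)))) ⊕ diff≈ (*-/-cancel (0<⌜suc⌝ 1)))
        (solve 6 (λ r x a ρ b c → num 2 :* (r :- x) := r :- a :+ num 2 :*
        (ρ :- (x :- a)) :+ num 2 :* (b :- ρ) :+ num 2 :* (c :- b) :+ (r :- a :- num 2 :* c)) refl r
        x x₀ ρ (proj₁ inner) ((r - x₀) / 2#)))

    gap : ∀ x (x∈ : ∣ x - x₀ ∣ ≤ ρ) → ε ≤ ∣ x - φ ⟨ x , J⊆J₀ (window x x∈) ⟩ ∣
    gap x close = ≤-trans (proj₁ (proj₂ (proj₂ ε-choice)))
      (≤-by (diff≤ d≤ ⊞ diff≈ (*-/-cancel (0<⌜suc⌝ 1)) ⊞ diff≈ (*-/-cancel 0<1+L) ⊞ *-nonneg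
      (weaken 0<1+L) (diff≤ (proj₂ (proj₂ (proj₂ ρ-choice)))))
      (solve 6 (λ a b ρ L d c → a :- b := a :+ ρ :+ L :* ρ :- d :+ (d :- num 2 :* b) :+
      (b :- (num 1 :+ L) :* c) :+ (num 1 :+ L) :* (c :- ρ)) refl (∣ x - y ∣) (d / 2#) ρ L d
      ((d / 2#) / (1# + L))))
      where
      y : ℝ
      y = φ ⟨ x , J⊆J₀ (window x close) ⟩
      y-y₀ : ∣ y - y₀ ∣ ≤ L * ρ
      y-y₀ = ≤-trans (φ-lipschitz (J⊆J₀ (window x close)) x₀∈J₀) (*-monoˡ-≤ L 0≤L close)
      d≤ : d ≤ ∣ x - y ∣ + ρ + L * ρ
      d≤ = ∣x∣≤
        (≤-by (diff≤ (abs≤⇒-≤ close) ⊞ diff≤ (abs≤⇒≤ y-y₀) ⊞ diff≤ (x≤∣x∣ (x - y)))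
          (solve 7 (λ a ρ L b c x y → a :+ ρ :+ L :* ρ :- (b :- c) := ρ :- :- (x :- b) :+
          (L :* ρ :- (y :- c)) :+ (a :- (x :- y))) refl (∣ x - y ∣) ρ L x₀ y₀ x y))
        (≤-by (diff≤ (abs≤⇒≤ close) ⊞ diff≤ (abs≤⇒-≤ y-y₀) ⊞ diff≤ (-x≤∣x∣ (x - y)))
          (solve 7 (λ a ρ L b c x y → a :+ ρ :+ L :* ρ :- :- (b :- c) := ρ :- (x :- b) :+
          (L :* ρ :- :- (y :- c)) :+ (a :- :- (x :- y))) refl (∣ x - y ∣) ρ L x₀ y₀ x y))

    c* : ℝ
    c* = L + 2#

    module _ {c₁ : ℝ} (0<c₁ : 0# < c₁) (c*≤c₁ : c* ≤ c₁) where

      module Above = UpperBound a<b φ 0≤L φ-lipschitz x-bound φ-bound 0<c₁ (suc m)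
      module Below = LowerBound φ 0≤L φ-lipschitz x-bound φ-bound J⊆J₀ (proj₁ (proj₂ ρ-choice))
        (proj₁ (proj₂ ε-choice)) (proj₂ (proj₂ (proj₂ ε-choice))) window gap c*≤c₁ m

      -- Halving one constant and enlarging the other by 1 makes both inequalities strict.
      c₂ c₃ : ℝ
      c₂ = Below.c₂ / 2#
      c₃ = Above.C + 1#

      0<c₂ : 0# < c₂
      0<c₂ = half Below.0<c₂

      0<c₃ : 0# < c₃
      0<c₃ = <-by (0<1 ⊕ Above.0≤C) (solve 1 (λ a → a :+ num 1 :- num 0 := num 1 :+ a) refl Above.C)

      τ-choice : ∃[ τ ] 0# < τ × τ ≤ Below.smallness × τ ≤ 1#
      τ-choice = common-lower-bound Below.0<smallness 0<1

      -- Large enough for both bounds: the upper one asks for Q q ≥ 1, the lower one for Q q ≥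
      -- `Below.threshold`.
      T : ℝ
      T = 1# + ∣ Below.threshold ∣

      small : ∃[ Q₀ ] (∀ Q → 1# < Q → Q₀ < Q → rpow Q (- γ) ≤ proj₁ τ-choice)
      small = rpow-small 0<γ (proj₁ (proj₂ τ-choice))

      large : ∃[ Q₀ ] (∀ Q → 1# < Q → Q₀ < Q → T ≤ Q * rpow Q (- γ))
      large = rpow-large γ<1 T

      Q₀ : ℝ
      Q₀ = ∣ proj₁ small ∣ + ∣ proj₁ large ∣

      counting : ∀ Q → 1# < Q → Q₀ < Q → ∃[ N ] HasCardinality ℝ² (M̃ φ n Q γ J J⊆J₀ c₁) N ×
        c₂ * rpow Q (fromℕ n - γ) < fromℕ N × fromℕ N < c₃ * rpow Q (fromℕ n - γ)
      counting Q 1<Q Q₀<Q = combine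
          (Above.upper 1<Q 0<q (≤-trans q≤τ (proj₂ (proj₂ (proj₂ τ-choice))))
            (≤-by (diff≤ T≤Qq ⊞ 0≤∣x∣ Below.threshold)
            (solve 3 (λ Q q a → Q :* q :- num 1 := Q :* q :- (num 1 :+ a) :+ a) refl Q q
            (∣ Below.threshold ∣))))
          (Below.lower 1<Q 0<q (≤-trans q≤τ (proj₁ (proj₂ (proj₂ τ-choice))))
            (≤-by (diff≤ T≤Qq ⊞ diff≤ (x≤∣x∣ Below.threshold) ⊞ weaken 0<1)
            (solve 4 (λ Q q a b → Q :* q :- a := Q :* q :- (num 1 :+ b) :+ (b :- a) :+ num 1) refl Q
            q Below.threshold (∣ Below.threshold ∣))))
        where
        q X : ℝ
        q = rpow Q (- γ)
        X = rpow Q (fromℕ n - γ)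
        0<q : 0# < q
        0<q = rpow-pos 1<Q (- γ)
        q≤τ : q ≤ proj₁ τ-choice
        q≤τ = proj₂ small Q 1<Q (<-by (diff< Q₀<Q ⊕ diff≤ (x≤∣x∣ (proj₁ small)) ⊕ 0≤∣x∣
          (proj₁ large)) (solve 4 (λ Q a b c → Q :- a := Q :- (b :+ c) :+ (b :- a) :+ c) refl Q
          (proj₁ small) (∣ proj₁ small ∣) (∣ proj₁ large ∣)))
        T≤Qq : T ≤ Q * q
        T≤Qq = proj₂ large Q 1<Q (<-by
          (diff< Q₀<Q ⊕ diff≤ (x≤∣x∣ (proj₁ large)) ⊕ 0≤∣x∣ (proj₁ small))
          (solve 4 (λ Q a b c → Q :- a := Q :- (b :+ c) :+ (c :- a) :+ b) refl Q (proj₁ large)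
          (∣ proj₁ small ∣) (∣ proj₁ large ∣)))
        X≈ : X ≈ Q ^ n * q
        X≈ = rpow-shift 1<Q n (- γ)
        0<X : 0# < X
        0<X = rpow-pos 1<Q (fromℕ n - γ)
        Set-M̃ : Pred (ℝ × ℝ) 0ℓ
        Set-M̃ = M̃ φ n Q γ J J⊆J₀ c₁
        combine : ∃[ N ] Covered (λ (α₁ , α₂) → AlgebraicIntegerPoint n Q (α₁ , α₂) ×
          Σ (α₁ ∈ J₀) λ α₁∈ → ∣ φ ⟨ α₁ , α₁∈ ⟩ - α₂ ∣ < c₁ * q) N ×
          fromℕ N ≤ Above.C * (Q ^ n * q) →
          ∃[ N ] Below.c₂ * (Q ^ n * q) ≤ fromℕ N ×
            (Σ (Fin N → Σ (ℝ × ℝ) Set-M̃) λ f → ∀ {i j} →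
            Setoid._≈_ ℝ² (proj₁ (f i)) (proj₁ (f j)) → i ≡ j) →
          ∃[ N ] HasCardinality ℝ² Set-M̃ N × c₂ * X < fromℕ N × fromℕ N < c₃ * X
        -- The cover is over all of `J₀`, hence over J as well. It supplies the exact cardinality N
        -- together with its upper bound; the injection then bounds the same N from below.
        combine (N⁺ , cover , N⁺≤) (N⁻ , N⁻≥ , f , f-injective) =
          conclude (cover⇒cardinality (cover-⊆
          (λ (α₁ , α₂) (point , α₁∈J , near) → point , J⊆J₀ α₁∈J , near) cover))
          where
          conclude : ∃[ N ] N ℕ.≤ N⁺ × HasCardinality ℝ² Set-M̃ N →
            ∃[ N ] HasCardinality ℝ² Set-M̃ N × c₂ * X < fromℕ N × fromℕ N < c₃ * X
          conclude (N , N≤N⁺ , card) = N , card ,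
            (<-by (*-pos 0<c₂ 0<X ⊕ diff≈ (*-congʳ (*-/-cancel (0<⌜suc⌝ 1))) ⊕ diff≈
              (*-congˡ X≈) ⊕ diff≤ N⁻≥ ⊕ diff≤ (fromℕ-mono-≤ (injection⇒≤ card f f-injective)))
              (solve 6 (λ a b X c d e → a :- b :* X := b :* X :+ (c :* X :- num 2 :* b :* X) :+
              (c :* d :- c :* X) :+ (e :- c :* d) :+ (a :- e)) refl (fromℕ N) c₂ X Below.c₂
              (Q ^ n * q) (fromℕ N⁻))) ,
            (<-by (0<X ⊕ diff≈ (sym (*-congˡ X≈)) ⊕ diff≤ N⁺≤ ⊕ diff≤ (fromℕ-mono-≤ N≤N⁺))
              (solve 5 (λ a X b c d → (a :+ num 1) :* X :- b := X :+ (a :* X :- a :* c) :+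
              (a :* c :- d) :+ (d :- b)) refl Above.C X (fromℕ N) (Q ^ n * q) (fromℕ N⁺)))

theorem1 :
    (em : ExcludedMiddle 0ℓ) (R : RealField) →
    let open RealField R
        open Theory em R
    in
    (a b : ℝ) →
    let J₀ = openInterval a b in
    (φ φ′ : RealFunction J₀) →
    IsDerivativeOf φ′ φ → Continuous φ′ → Bounded φ′ →
    Finite ℝ-setoid (FixedPoint φ) →
    (J : Interval) (J⊆J₀ : J ⊆ J₀) → 0# < length J →
    (n : ℕ) → 3 ≤ℕ n →
    (γ : ℝ) → 0# < γ → γ < 1# →
    ∃[ c* ] (∀ c₁ → 0# < c₁ → c* ≤ c₁ →
      ∃[ c₂ ] ∃[ c₃ ] ∃[ Q₀ ] 0# < c₂ × 0# < c₃ ×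
        (∀ Q → 1# < Q → Q₀ < Q →
          ∃[ N ] HasCardinality ℝ² (M̃ φ n Q γ J J⊆J₀ c₁) N ×
            c₂ * rpow Q (fromℕ n - γ) < fromℕ N ×
            fromℕ N < c₃ * rpow Q (fromℕ n - γ)))
theorem1 em R a b φ φ′ derivative _ (_ , bounded) finite J J⊆J₀ 0<length
    (suc (suc (suc m))) (s≤s (s≤s (s≤s z≤n))) γ 0<γ γ<1 =
  A.c* , λ c₁ 0<c₁ c*≤c₁ →
    A.c₂ 0<c₁ c*≤c₁ , A.c₃ 0<c₁ c*≤c₁ , A.Q₀ 0<c₁ c*≤c₁ ,
    A.0<c₂ 0<c₁ c*≤c₁ , A.0<c₃ 0<c₁ c*≤c₁ , A.counting 0<c₁ c*≤c₁
  where
  module A = Reals.Assembly em R φ φ′ derivative bounded finite J J⊆J₀ 0<length m 0<γ γ<1
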